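{- Suppose that $G$ is a graph for which there exists a partition $\{S_1, \ldots, S_m\}$ of $V(G)$ such that for each $i$, $|S_i| \geq 3$ and the induced subgraph $G[S_i]$ is an odd cycle or a complete graph. For each $i \geq 2$ suppose each vertex in $S_i$ has at most $\rho_i$ neighbors in $\bigcup_{j=1}^{i-1} S_j$, and let $\rho_1=0$. For each $i \geq 1$ let $$\alpha_i = \begin{cases} \rho_i+3 & \text{if } G[S_i] \text{ is an odd cycle,} \\ \rho_i + |S_i| & \text{if } G[S_i] \text{ is a complete graph,} \end{cases}$$ and let $\alpha = \max_{i} \alpha_i$. Suppose $H$ is a graph on at least two vertices that contains a Hamilton path $w_1, w_2, \ldots, w_n$ such that, for each $i$, $w_i$ has at most $k$ neighbors (in $H$) among $w_1, \ldots, w_{i-1}$. Then $AT(G) \leq \alpha$ and $AT(G \square H) \leq \alpha+k-1$.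
   Context: All graphs are finite and simple, and digraphs are simple. $G[T]$ denotes the subgraph of $G$ induced by $T\subseteq V(G)$. A Hamilton path $w_1,\ldots,w_n$ of $H$ is a listing of all vertices of $H$, each exactly once, with consecutive vertices adjacent in $H$. The Cartesian product $G \square H$ has vertex set $V(G)\times V(H)$, with $(u,v)$ adjacent to $(u',v')$ iff either $u=u'$ and $vv'\in E(H)$, or $v=v'$ and $uu'\in E(G)$. A circulation contained in a digraph $D$ is a spanning subdigraph $E$ of $D$ such that $d^-_E(v)=d^+_E(v)$ (indegree equals outdegree in $E$) for every $v\in V(D)$; it is even (resp. odd) if it has an even (resp. odd) number of edges (the edgeless circulation is even). The Alon-Tarsi number $AT(G)$ is the smallest $k$ for which there is an orientation $D$ of $G$ with maximum indegree $k-1$ such that the number of even circulations and the number of odd circulations contained in $D$ are different. (When $|S_i|=3$ and $G[S_i]$ is a triangle, the two cases in the definition of $\alpha_i$ agree.) -}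

module Defs where

open import Data.Fin.Base using (Fin; toℕ; remQuot)
open import Data.Fin.Permutation using (Permutation′; _⟨$⟩ʳ_)
open import Data.Fin.Properties as Fin using (_<?_; all?)
open import Data.Fin.Subset using (Subset; _∈_; ⋃; ∣_∣; _⊆_; inside; outside)
open import Data.Fin.Subset.Properties using (_∈?_; _⊆?_)
open import Data.List.Base as List using (List; []; _∷_; length; filter; allFin; cartesianProductWith)
open import Data.List.Extrema.Nat using (max)
open import Data.Nat.Base using (ℕ; zero; suc; _+_; _*_; _≤_)
open import Data.Nat.Divisibility using (_∤_; _∣?_)
open import Data.Nat.Properties as ℕ using ()
open import Data.Product using (_×_; _,_; proj₂; ∃; ∃-syntax; ∃!)
open import Data.Sum.Base as Sum using (_⊎_; [_,_]′)
open import Data.Vec.Base as Vec using (Vec; []; _∷_; lookup)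
open import Function.Base using (const; _∘_; _on_)
open import Function.Bundles using (_⇔_)
open import Level using (0ℓ)
open import Relation.Binary.Core using (Rel)
open import Relation.Binary.Definitions using (Symmetric; Irreflexive; Decidable)
open import Relation.Binary.PropositionalEquality using (_≡_; _≢_; refl; sym; cong)
open import Relation.Nullary.Decidable using (Dec; does; ¬?; _×-dec_; _⊎-dec_)
open import Relation.Nullary.Negation using (¬_)

private
  variable
    m n : ℕ

record Graph (n : ℕ) : Set₁ where
  field
    Adj    : Rel (Fin n) 0ℓ
    adj?   : Decidable Adj
    symm   : Symmetric Adj
    irrefl : Irreflexive _≡_ Adj

open Graph public

N : Graph n → Fin n → Subset n
N G v = Vec.tabulate (λ u → does (adj? G v u))

elements : Subset n → List (Fin n)
elements T = filter (_∈? T) (allFin _)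

-- The vertices of the induced subgraph are the positions in the
-- (repetition-free) list of elements of T.
infix 30 _[_]

_[_] : Graph n → (T : Subset n) → Graph (length (elements T))
G [ T ] = record
  { Adj    = Adj G on vertex
  ; adj?   = λ i j → adj? G (vertex i) (vertex j)
  ; symm   = symm G
  ; irrefl = λ i≡j → irrefl G (cong vertex i≡j)
  }
  where
  vertex : Fin (length (elements T)) → Fin _
  vertex = List.lookup (elements T)

-- Fin (m * n) stands for Fin m × Fin n via remQuot/combine.
infixl 7 _□_

_□_ : Graph m → Graph n → Graph (m * n)
_□_ {m} {n} G H = record
  { Adj    = λ x y → Adj□ (remQuot n x) (remQuot n y)
  ; adj?   = λ x y → adj□? (remQuot n x) (remQuot n y)
  ; symm   = Sum.map (λ (p , a) → sym p , symm H a) (λ (p , a) → sym p , symm G a)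
  ; irrefl = λ { refl → [ irrefl H refl ∘ proj₂ , irrefl G refl ∘ proj₂ ]′ }
  }
  where
  Adj□ : Rel (Fin m × Fin n) 0ℓ
  Adj□ (u , v) (u′ , v′) = (u ≡ u′ × Adj H v v′) ⊎ (v ≡ v′ × Adj G u u′)

  adj□? : Decidable Adj□
  adj□? (u , v) (u′ , v′) =
    (u Fin.≟ u′ ×-dec adj? H v v′) ⊎-dec (v Fin.≟ v′ ×-dec adj? G u u′)

IsComplete : Graph n → Set
IsComplete G = ∀ u v → u ≢ v → Adj G u v

CyclicNext : Rel (Fin n) 0ℓ
CyclicNext {n} i j = toℕ j ≡ suc (toℕ i) ⊎ (suc (toℕ i) ≡ n × toℕ j ≡ 0)

IsCycle : Graph n → Set
IsCycle {n} G =
  3 ≤ n ×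
  ∃ λ (c : Permutation′ n) →
    ∀ i j → Adj G (c ⟨$⟩ʳ i) (c ⟨$⟩ʳ j) ⇔ (CyclicNext i j ⊎ CyclicNext j i)

IsOddCycle : Graph n → Set
IsOddCycle {n} G = 2 ∤ n × IsCycle G

IsHamiltonPath : Graph n → Permutation′ n → Set
IsHamiltonPath G w = ∀ i j → toℕ j ≡ suc (toℕ i) → Adj G (w ⟨$⟩ʳ i) (w ⟨$⟩ʳ j)

IsPartition : (Fin m → Subset n) → Set
IsPartition S = ∀ v → ∃! _≡_ (λ i → v ∈ S i)

⋃[<_] : Fin m → (Fin m → Subset n) → Subset n
⋃[< i ] S = ⋃ (List.map S (filter (_<? i) (allFin _)))

-- The evidence selects the case; both cases give the same value when
-- the part induces a triangle.
α : (G : Graph n) (S : Fin m → Subset n) (ρ : Fin m → ℕ) →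
    (∀ i → IsOddCycle (G [ S i ]) ⊎ IsComplete (G [ S i ])) → Fin m → ℕ
α G S ρ kind i = [ const (ρ i + 3) , const (ρ i + ∣ S i ∣) ]′ (kind i)

maximum : (Fin m → ℕ) → ℕ
maximum f = max 0 (List.tabulate f)

-- Row u is the set of out-neighbours of u.  Loops and antiparallel arcs
-- are representable, but no orientation of a graph has any.
Digraph : ℕ → Set
Digraph n = Vec (Subset n) n

Arc : Digraph n → Rel (Fin n) 0ℓ
Arc D u v = v ∈ lookup D u

outdegree : Digraph n → Fin n → ℕ
outdegree D v = ∣ lookup D v ∣

indegree : Digraph n → Fin n → ℕ
indegree D v = ∣ Vec.map (λ row → lookup row v) D ∣

size : Digraph n → ℕ
size D = Vec.sum (Vec.map ∣_∣ D)

IsCirculation : Digraph n → Digraph n → Set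
IsCirculation D E =
  (∀ v → lookup E v ⊆ lookup D v) × (∀ v → indegree E v ≡ outdegree E v)

isCirculation? : (D E : Digraph n) → Dec (IsCirculation D E)
isCirculation? D E =
  all? (λ v → lookup E v ⊆? lookup D v) ×-dec
  all? (λ v → indegree E v ℕ.≟ outdegree E v)

vectors : {A : Set} → List A → (n : ℕ) → List (Vec A n)
vectors xs zero    = [] ∷ []
vectors xs (suc n) = cartesianProductWith _∷_ xs (vectors xs n)

digraphs : (n : ℕ) → List (Digraph n)
digraphs n = vectors (vectors (inside ∷ outside ∷ []) n) n

circulations : Digraph n → List (Digraph n)
circulations D = filter (isCirculation? D) (digraphs _)

#even #odd : Digraph n → ℕ
#even D = length (filter (λ E → 2 ∣? size E) (circulations D))
#odd  D = length (filter (λ E → ¬? (2 ∣? size E)) (circulations D))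

record IsOrientation (G : Graph n) (D : Digraph n) : Set where
  field
    arc⇒adj : ∀ {u v} → Arc D u v → Adj G u v
    adj⇒arc : ∀ {u v} → Adj G u v → Arc D u v ⊎ Arc D v u
    asym    : ∀ {u v} → Arc D u v → ¬ Arc D v u

maxIndegree : Digraph n → ℕ
maxIndegree D = maximum (indegree D)

HasATOrientation : Graph n → ℕ → Set
HasATOrientation G k =
  ∃[ D ] IsOrientation G D × suc (maxIndegree D) ≡ k × #even D ≢ #odd D

record IsAlonTarsiNumber (G : Graph n) (k : ℕ) : Set where
  field
    attained : HasATOrientation G k
    minimal  : ∀ {j} → HasATOrientation G j → k ≤ j

-- The number is unique by minimality; asserting that it exists avoids
-- having to construct it as a function of G.
infix 4 AT_≤_

AT_≤_ : Graph n → ℕ → Set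
AT G ≤ b = ∃[ k ] IsAlonTarsiNumber G k × k ≤ b

{-# OPTIONS --safe #-}

-- By Alon and Tarsi, #even D − #odd D is, up to sign, the coefficient in
-- the graph polynomial ∏ (x − y) of the monomial whose exponents are the
-- indegrees of D, so it suffices to find a nonzero coefficient with small
-- exponents. Listing the parts in order and directing all edges between
-- different parts forward, the coefficient is a product over the parts S,
-- with ρ added to the exponents. It remains to treat K □ H for a single
-- odd cycle or complete graph K of maximum degree d + 1, with
-- exponents at most d + k.
--
-- The layers of K □ H are peeled off from the end of the Hamilton path.
-- The exponents of the last layer leave room for all but one of its edges
-- to earlier layers to be directed into it; summing over the exceptional
-- edge turns the coefficient into one of a linear form Σ a x times the
-- polynomial of the remaining layers, and the form restricts to the
-- preceding layer. The same step then turns a linear form on one layer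
-- into a linear form on earlier layers, and it suffices that the
-- restriction to the preceding layer stays nonconstant. This follows from
-- the translation invariance of the graph polynomial once some new
-- coefficient is nonzero. For complete graphs the latter is the
-- antisymmetry of the Vandermonde polynomial, for odd cycles it is an
-- identity between the entries at two adjacent vertices.

module Submission where

open import Defs
open import Data.Bool.Base using (Bool)
open import Data.Empty using (⊥; ⊥-elim)
open import Data.Fin.Base as Fin using (Fin; zero; suc; toℕ)
open import Data.Fin.Induction as Fin using ()
open import Data.Fin.Permutation using (Permutation′; _⟨$⟩ʳ_; _⟨$⟩ˡ_; inverseˡ; inverseʳ)
open import Data.Fin.Properties as Fin using ()
open import Data.Fin.Subset using (Subset; inside; outside; _∈_; _⊆_; _∩_; ∣_∣; ⁅_⁆; ⋃)
open import Data.Fin.Subset.Properties as Subset using (_∈?_; _⊆?_)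
open import Data.Integer.Base as ℤ using (ℤ; +_; 0ℤ; 1ℤ; -1ℤ)
  renaming (_+_ to _+ᶻ_; _-_ to _-ᶻ_; _*_ to _*ᶻ_; -_ to -ᶻ_; _≤_ to _≤ᶻ_; _<_ to _<ᶻ_)
open import Data.Integer.Properties as ℤ using ()
open import Data.Integer.Tactic.RingSolver using (solve-∀)
open import Data.List.Base as List using (List; []; _∷_; _++_; length; allFin; cartesianProduct; concatMap)
open import Data.List.Extrema.Nat using (max≤v⁺; xs≤max)
open import Data.List.Membership.Propositional as ∈ₗ using () renaming (_∈_ to _∈ₗ_; _∉_ to _∉ₗ_)
open import Data.List.Membership.Propositional.Properties as ∈ₗ using (∈-∃++)
open import Data.List.Membership.Propositional.Properties.WithK using (unique∧set⇒bag)
open import Data.List.Properties as List using ()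
open import Data.List.Relation.Binary.BagAndSetEquality using (∼bag⇒↭)
open import Data.List.Relation.Binary.Permutation.Propositional as Perm using (_↭_; ↭-refl; ↭-sym; ↭-trans)
open import Data.List.Relation.Binary.Permutation.Propositional.Properties as Perm using (∈-resp-↭; All-resp-↭; shift)
open import Data.List.Relation.Binary.Pointwise using (Pointwise; []; _∷_)
open import Data.List.Relation.Unary.All as All using (All; []; _∷_)
open import Data.List.Relation.Unary.All.Properties as All using ()
open import Data.List.Relation.Unary.AllPairs as AllPairs using (AllPairs; []; _∷_)
open import Data.List.Relation.Unary.AllPairs.Properties as AllPairs using ()
open import Data.List.Relation.Unary.Any as Any using (Any; here; there)
open import Data.List.Relation.Unary.Any.Properties as Any using ()
open import Data.List.Relation.Unary.Unique.Propositional using (Unique)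
open import Data.List.Relation.Unary.Unique.Propositional.Properties as Unique using ()
open import Data.Nat.Base as ℕ using (ℕ; zero; suc; _+_; _∸_; _≤_; _<_; z≤n; s≤s)
open import Data.Nat.Divisibility using (_∣_; _∤_; _∣?_; divides)
open import Data.Nat.Properties as ℕ using ()
open import Data.Product.Base as Product using (_×_; _,_; proj₁; proj₂; ∃)
open import Data.Product.Properties using (≡-dec)
open import Data.Sum.Base as Sum using (_⊎_; inj₁; inj₂; [_,_]′)
open import Data.Unit.Base using (⊤; tt)
open import Data.Unit.Properties as ⊤ using ()
open import Data.Vec.Base as Vec using (Vec; []; _∷_; lookup)
open import Data.Vec.Properties as Vec using ()
open import Function.Base using (_∘_; case_of_; id)
open import Function.Bundles using (mk⇔; Equivalence)
open import Relation.Binary.Definitions using (DecidableEquality; Symmetric)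
open import Relation.Binary.PropositionalEquality
  using (_≡_; _≢_; _≗_; refl; sym; cong; cong₂; subst; module ≡-Reasoning) renaming (trans to infixr 5 _∙_)
open import Relation.Nullary.Decidable using (Dec; yes; no; does; ¬?; _×-dec_; _⊎-dec_; _→-dec_; map′; dec-true)
open import Relation.Nullary.Negation using (¬_; contradiction)
open import Algebra.Properties.AbelianGroup ℤ.+-0-abelianGroup using () renaming (∙-cancelˡ to +ᶻ-cancelˡ; ∙-cancelʳ to +ᶻ-cancelʳ)

-- The obstacle is one unit of degree per layer. In K alone no nonzero coefficient has all exponents
-- at most d: for an odd cycle only the all-one exponent would qualify, and there the two cyclic
-- orientations cancel; for a complete graph the exponents are a permutation of 0, ..., d + 1. With
-- k further incoming edges a layer would therefore cost d + 1 + k. Staying at d + k forces one edge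
-- between each later layer and the earlier ones to point backwards, and this debt is finally paid
-- on the first layer, which has no earlier neighbours and at least one unit to spare because k ≥ 1.
--
-- The invariant asks that the polynomial P of K vanish at the base exponent c, and this does two
-- jobs. The translation derivative of (Σ a x) P is (Σ a) P, so it vanishes at c and the next form
-- is nonconstant. And the part of the old form on earlier layers, whose values are not controlled,
-- enters only with the factor P at c and so disappears.

record Index (V : Set) : Set where
  infix 4 _≟_
  field
    _≟_           : DecidableEquality V
    enum          : List V
    enum-complete : ∀ v → v ∈ₗ enum
    enum-unique   : Unique enum

open Index {{...}}

instance
  indexFin : ∀ {n} → Index (Fin n)
  indexFin = record
    { _≟_ = Fin._≟_ ; enum = allFin _
    ; enum-complete = ∈ₗ.∈-allFin ; enum-unique = Unique.allFin⁺ _ }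

  index⊤ : Index ⊤
  index⊤ = record
    { _≟_ = ⊤._≟_ ; enum = tt ∷ []
    ; enum-complete = λ _ → here refl ; enum-unique = [] ∷ [] }

  index× : ∀ {U V} {{_ : Index U}} {{_ : Index V}} → Index (U × V)
  index× = record
    { _≟_ = ≡-dec _≟_ _≟_ ; enum = cartesianProduct enum enum
    ; enum-complete = λ (u , v) → ∈ₗ.∈-cartesianProduct⁺ (enum-complete u) (enum-complete v)
    ; enum-unique = Unique.cartesianProduct⁺ enum-unique enum-unique }

-- Laurent polynomials in vertex variables

private variable U V : Set

-- Integer exponents make lowering by a variable total and invertible, and admit the quotients y/x
-- in the count of circulations. That negative exponents do not occur in products of differences
-- becomes a lemma, `coef-negative`.
Exponent : Set → Set
Exponent V = V → ℤ

-- A Laurent polynomial in variables indexed by V is represented by its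
-- coefficient function.
Poly : Set → Set
Poly V = Exponent V → ℤ

Congruent : Poly V → Set
Congruent F = ∀ {c d} → c ≗ d → F c ≡ F d

Σ[_] : List V → (V → ℤ) → ℤ
Σ[ [] ] f = 0ℤ
Σ[ v ∷ vs ] f = f v +ᶻ Σ[ vs ] f

Σ-cong : ∀ (vs : List V) {f g} → f ≗ g → Σ[ vs ] f ≡ Σ[ vs ] g
Σ-cong []       f≗g = refl
Σ-cong (v ∷ vs) f≗g = cong₂ _+ᶻ_ (f≗g v) (Σ-cong vs f≗g)

module _ {{_ : Index V}} where

  opaque
    e : V → Exponent V
    e v u with u ≟ v
    ... | yes _ = 1ℤ
    ... | no  _ = 0ℤ

    e-same : ∀ {u v} → u ≡ v → e v u ≡ 1ℤ
    e-same {u} {v} u≡v with u ≟ v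
    ... | yes _  = refl
    ... | no u≢v = contradiction u≡v u≢v

    e-diff : ∀ {u v} → u ≢ v → e v u ≡ 0ℤ
    e-diff {u} {v} u≢v with u ≟ v
    ... | yes u≡v = contradiction u≡v u≢v
    ... | no _    = refl

    e≥0 : ∀ v u → 0ℤ ≤ᶻ e v u
    e≥0 v u with u ≟ v
    ... | yes _ = ℤ.+≤+ ℕ.z≤n
    ... | no  _ = ℤ.+≤+ ℕ.z≤n

    e≤1 : ∀ v u → e v u ≤ᶻ 1ℤ
    e≤1 v u with u ≟ v
    ... | yes _ = ℤ.≤-refl
    ... | no  _ = ℤ.+≤+ ℕ.z≤n

  infixl 6 _⊖_ _⊕_ _∔_

  _⊖_ _⊕_ : Exponent V → V → Exponent V
  (c ⊖ v) u = c u -ᶻ e v u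
  (c ⊕ v) u = c u +ᶻ e v u

  ⊖-cong : ∀ {c d} v → c ≗ d → c ⊖ v ≗ d ⊖ v
  ⊖-cong v c≗d u = cong (_-ᶻ e v u) (c≗d u)

  private
    sub-comm : ∀ a b c → a -ᶻ b -ᶻ c ≡ a -ᶻ c -ᶻ b
    sub-comm = solve-∀
    add-sub : ∀ a b c → a +ᶻ b -ᶻ c ≡ a -ᶻ c +ᶻ b
    add-sub = solve-∀
    cancel : ∀ a b → a +ᶻ b -ᶻ b ≡ a
    cancel = solve-∀
    cancel′ : ∀ a b → a -ᶻ b +ᶻ b ≡ a
    cancel′ = solve-∀

  ⊖-comm : ∀ (c : Exponent V) u v → c ⊖ u ⊖ v ≗ c ⊖ v ⊖ u
  ⊖-comm c u v w = sub-comm (c w) (e u w) (e v w)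

  ⊕⊖-comm : ∀ (c : Exponent V) u v → c ⊕ u ⊖ v ≗ c ⊖ v ⊕ u
  ⊕⊖-comm c u v w = add-sub (c w) (e u w) (e v w)

  ⊕⊖-cancel : ∀ (c : Exponent V) v → c ⊕ v ⊖ v ≗ c
  ⊕⊖-cancel c v w = cancel (c w) (e v w)

  ⊖⊕-cancel : ∀ (c : Exponent V) v → c ⊖ v ⊕ v ≗ c
  ⊖⊕-cancel c v w = cancel′ (c w) (e v w)

  zero? : (c : Exponent V) → (∀ v → c v ≡ 0ℤ) ⊎ ∃ λ v → c v ≢ 0ℤ
  zero? c with All.all? (λ v → c v ℤ.≟ 0ℤ) (enum {V})
  ... | yes p = inj₁ λ v → All.lookup p (enum-complete v)
  ... | no ¬p with v , _ , h ← ∈ₗ.find (All.¬All⇒Any¬ (λ v → c v ℤ.≟ 0ℤ) (enum {V}) ¬p) = inj₂ (v , h)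

  opaque
    -- The constant polynomial 1. It also serves as the test that an exponent is zero, hence later
    -- that a digraph is balanced.
    δ : Poly V
    δ c with All.all? (λ v → c v ℤ.≟ 0ℤ) enum
    ... | yes _ = 1ℤ
    ... | no  _ = 0ℤ

    δ-zero : ∀ {c} → (∀ v → c v ≡ 0ℤ) → δ c ≡ 1ℤ
    δ-zero {c} c≡0 with All.all? (λ v → c v ℤ.≟ 0ℤ) enum
    ... | yes _ = refl
    ... | no ¬p = contradiction (All.tabulate (λ {v} _ → c≡0 v)) ¬p

    δ-nonzero : ∀ {c} v → c v ≢ 0ℤ → δ c ≡ 0ℤ
    δ-nonzero {c} v c≢0 with All.all? (λ v → c v ℤ.≟ 0ℤ) enum
    ... | yes p = contradiction (All.lookup p (enum-complete v)) c≢0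
    ... | no _  = refl

    δ-cong : Congruent δ
    δ-cong {c} {d} c≗d
      with All.all? (λ v → c v ℤ.≟ 0ℤ) enum | All.all? (λ v → d v ℤ.≟ 0ℤ) enum
    ... | yes _ | yes _ = refl
    ... | no  _ | no  _ = refl
    ... | yes p | no ¬q = contradiction (All.map (λ {v} h → sym (c≗d v) ∙ h) p) ¬q
    ... | no ¬p | yes q = contradiction (All.map (λ {v} h → c≗d v ∙ h) q) ¬p

  -- Multiplication by the product of the differences x − y over the
  -- pairs (x , y) in the list.
  S : List (V × V) → Poly V → Poly V
  S []             F c = F c
  S ((x , y) ∷ es) F c = S es F (c ⊖ x) -ᶻ S es F (c ⊖ y)

  -- These are the coefficients of the graph polynomial.
  coef : List (V × V) → Poly V
  coef es = S es δ

  S-cong : ∀ es {F} → Congruent F → Congruent (S es F)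
  S-cong []             F-cong c≗d = F-cong c≗d
  S-cong ((x , y) ∷ es) F-cong c≗d =
    cong₂ _-ᶻ_ (S-cong es F-cong (⊖-cong x c≗d)) (S-cong es F-cong (⊖-cong y c≗d))

  coef-cong : ∀ es → Congruent (coef es)
  coef-cong es = S-cong es δ-cong

  S-ext : ∀ es {F G : Poly V} → F ≗ G → S es F ≗ S es G
  S-ext []             F≗G c = F≗G c
  S-ext ((x , y) ∷ es) F≗G c = cong₂ _-ᶻ_ (S-ext es F≗G (c ⊖ x)) (S-ext es F≗G (c ⊖ y))

  S-++ : ∀ es {fs} (F : Poly V) → S (es ++ fs) F ≗ S es (S fs F)
  S-++ []             F c = refl
  S-++ ((x , y) ∷ es) F c = cong₂ _-ᶻ_ (S-++ es F (c ⊖ x)) (S-++ es F (c ⊖ y))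

  private
    exchange : ∀ a b c d → a -ᶻ b -ᶻ (c -ᶻ d) ≡ a -ᶻ c -ᶻ (b -ᶻ d)
    exchange = solve-∀

  S-↭ : ∀ {es fs F} → Congruent F → es ↭ fs → S es F ≗ S fs F
  S-↭ F-cong Perm.refl c = refl
  S-↭ F-cong (Perm.prep (x , y) p) c = cong₂ _-ᶻ_ (S-↭ F-cong p _) (S-↭ F-cong p _)
  S-↭ {F = F} F-cong (Perm.swap {xs = es} {ys = fs} (x , y) (x′ , y′) p) c = begin
    S es F (c ⊖ x ⊖ x′) -ᶻ S es F (c ⊖ x ⊖ y′) -ᶻ (S es F (c ⊖ y ⊖ x′) -ᶻ S es F (c ⊖ y ⊖ y′))
      ≡⟨ cong₂ _-ᶻ_ (cong₂ _-ᶻ_ (flip x x′) (flip x y′)) (cong₂ _-ᶻ_ (flip y x′) (flip y y′)) ⟩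
    S fs F (c ⊖ x′ ⊖ x) -ᶻ S fs F (c ⊖ y′ ⊖ x) -ᶻ (S fs F (c ⊖ x′ ⊖ y) -ᶻ S fs F (c ⊖ y′ ⊖ y))
      ≡⟨ exchange (S fs F (c ⊖ x′ ⊖ x)) _ _ _ ⟩
    S fs F (c ⊖ x′ ⊖ x) -ᶻ S fs F (c ⊖ x′ ⊖ y) -ᶻ (S fs F (c ⊖ y′ ⊖ x) -ᶻ S fs F (c ⊖ y′ ⊖ y)) ∎
    where
    open ≡-Reasoning
    flip : ∀ u v → S es F (c ⊖ u ⊖ v) ≡ S fs F (c ⊖ v ⊖ u)
    flip u v = S-↭ F-cong p _ ∙ S-cong fs F-cong (⊖-comm c u v)
  S-↭ F-cong (Perm.trans p q) c = S-↭ F-cong p c ∙ S-↭ F-cong q c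

  S-zero : ∀ es {F : Poly V} → (∀ c → F c ≡ 0ℤ) → ∀ c → S es F c ≡ 0ℤ
  S-zero []             F≡0 c = F≡0 c
  S-zero ((x , y) ∷ es) F≡0 c = cong₂ _-ᶻ_ (S-zero es F≡0 _) (S-zero es F≡0 _)

  S-linear : ∀ es {F G : Poly V} a c →
             S es (λ d → a *ᶻ F d +ᶻ G d) c ≡ a *ᶻ S es F c +ᶻ S es G c
  S-linear []             a c = refl
  S-linear ((x , y) ∷ es) {F} {G} a c =
    cong₂ _-ᶻ_ (S-linear es a (c ⊖ x)) (S-linear es a (c ⊖ y)) ∙
    lemma a (S es F (c ⊖ x)) _ _ _
    where
    lemma : ∀ a f g f′ g′ → a *ᶻ f +ᶻ g -ᶻ (a *ᶻ f′ +ᶻ g′) ≡ a *ᶻ (f -ᶻ f′) +ᶻ (g -ᶻ g′)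
    lemma = solve-∀

  S-shift : ∀ es {F} → Congruent F → ∀ v c → S es (λ d → F (d ⊖ v)) c ≡ S es F (c ⊖ v)
  S-shift []             F-cong v c = refl
  S-shift ((x , y) ∷ es) F-cong v c = cong₂ _-ᶻ_ (step x) (step y)
    where
    step : ∀ u → S es _ (c ⊖ u) ≡ _
    step u = S-shift es F-cong v (c ⊖ u) ∙ S-cong es F-cong (⊖-comm c u v)

  -- Multiplication by the linear form Σ a x over the pairs (a , x) in
  -- the list.
  lin : List (ℤ × V) → Poly V → Poly V
  lin []            F c = 0ℤ
  lin ((a , v) ∷ l) F c = a *ᶻ F (c ⊖ v) +ᶻ lin l F c

  lin-cong : ∀ l {F} → Congruent F → Congruent (lin l F)
  lin-cong []            F-cong c≗d = refl
  lin-cong ((a , v) ∷ l) F-cong c≗d =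
    cong₂ (λ f g → a *ᶻ f +ᶻ g) (F-cong (⊖-cong v c≗d)) (lin-cong l F-cong c≗d)

  lin-ext : ∀ l {F G : Poly V} → F ≗ G → lin l F ≗ lin l G
  lin-ext []            F≗G c = refl
  lin-ext ((a , v) ∷ l) F≗G c =
    cong₂ (λ f g → a *ᶻ f +ᶻ g) (F≗G (c ⊖ v)) (lin-ext l F≗G c)

  lin-++ : ∀ l {m} (F : Poly V) c → lin (l ++ m) F c ≡ lin l F c +ᶻ lin m F c
  lin-++ []            F c = sym (ℤ.+-identityˡ _)
  lin-++ ((a , v) ∷ l) F c =
    cong (λ z → a *ᶻ F (c ⊖ v) +ᶻ z) (lin-++ l F c) ∙
    sym (ℤ.+-assoc (a *ᶻ F (c ⊖ v)) _ _)

  lin-S : ∀ l es {F} → Congruent F → lin l (S es F) ≗ S es (lin l F)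
  lin-S []            es F-cong c = sym (S-zero es (λ _ → refl) c)
  lin-S ((a , v) ∷ l) es {F} F-cong c = begin
    a *ᶻ S es F (c ⊖ v) +ᶻ lin l (S es F) c
      ≡⟨ cong₂ (λ f g → a *ᶻ f +ᶻ g) (sym (S-shift es F-cong v c)) (lin-S l es F-cong c) ⟩
    a *ᶻ S es (λ d → F (d ⊖ v)) c +ᶻ S es (lin l F) c
      ≡⟨ sym (S-linear es a c) ⟩
    S es (lin ((a , v) ∷ l) F) c ∎
    where open ≡-Reasoning

  formOn : (V → ℤ) → List V → List (ℤ × V)
  formOn a = List.map λ v → a v , v

  form : (V → ℤ) → List (ℤ × V)
  form a = formOn a enum

  _∔_ : Exponent V → Exponent V → Exponent V
  (c ∔ d) u = c u +ᶻ d u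

  -- The indegrees when each pair is read as an arc whose head is its first entry; equivalently, the
  -- exponent obtained by choosing the first term of every difference.
  heads : List (V × V) → Exponent V
  heads []             u = 0ℤ
  heads ((x , y) ∷ es) u = heads es u +ᶻ e x u

neg-sub : ∀ a b → a -ᶻ b ≡ -ᶻ (b -ᶻ a)
neg-sub = solve-∀

Σ-+ : ∀ (vs : List V) f g → Σ[ vs ] (λ v → f v +ᶻ g v) ≡ Σ[ vs ] f +ᶻ Σ[ vs ] g
Σ-+ []       f g = refl
Σ-+ (v ∷ vs) f g = cong (λ z → f v +ᶻ g v +ᶻ z) (Σ-+ vs f g) ∙ lemma (f v) (g v) _ _
  where
  lemma : ∀ a b c d → a +ᶻ b +ᶻ (c +ᶻ d) ≡ a +ᶻ c +ᶻ (b +ᶻ d)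
  lemma = solve-∀

Σ-*ˡ : ∀ (vs : List V) a f → Σ[ vs ] (λ v → a *ᶻ f v) ≡ a *ᶻ Σ[ vs ] f
Σ-*ˡ []       a f = sym (ℤ.*-zeroʳ a)
Σ-*ˡ (v ∷ vs) a f = cong (λ z → a *ᶻ f v +ᶻ z) (Σ-*ˡ vs a f) ∙ sym (ℤ.*-distribˡ-+ a (f v) _)

Σ-zero : ∀ (vs : List V) {f} → (∀ v → v ∈ₗ vs → f v ≡ 0ℤ) → Σ[ vs ] f ≡ 0ℤ
Σ-zero []       f≡0 = refl
Σ-zero (v ∷ vs) f≡0 = cong₂ _+ᶻ_ (f≡0 v (here refl)) (Σ-zero vs (λ u → f≡0 u ∘ there))

-- Edge lists, and the graph polynomial up to sign

Apart : V × V → V × V → Set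
Apart f g = f ≢ g × f ≢ Product.swap g

Joins : List (V × V) → V → V → Set
Joins es x y = (x , y) ∈ₗ es ⊎ (y , x) ∈ₗ es

-- Each pair related by the symmetric relation R is listed once, in one
-- of its two directions.
record EdgeList (R : V → V → Set) (es : List (V × V)) : Set where
  field
    apart    : AllPairs Apart es
    sound    : ∀ {x y} → Joins es x y → R x y
    complete : ∀ {x y} → R x y → Joins es x y
open EdgeList public

Apart-sym : Symmetric (Apart {V})
Apart-sym (f≢g , f≢g′) = (λ g≡f → f≢g (sym g≡f)) , λ g≡f′ → f≢g′ (cong Product.swap (sym g≡f′))

AllPairs-resp-↭ : ∀ {A : Set} {R : A → A → Set} → Symmetric R →
                  ∀ {xs ys} → xs ↭ ys → AllPairs R xs → AllPairs R ys
AllPairs-resp-↭ R-sym Perm.refl ps = ps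
AllPairs-resp-↭ R-sym (Perm.prep x p) (px ∷ ps) = All-resp-↭ p px ∷ AllPairs-resp-↭ R-sym p ps
AllPairs-resp-↭ R-sym (Perm.swap x y p) ((pxy ∷ px) ∷ py ∷ ps) =
  (R-sym pxy ∷ All-resp-↭ p py) ∷ All-resp-↭ p px ∷ AllPairs-resp-↭ R-sym p ps
AllPairs-resp-↭ R-sym (Perm.trans p q) ps = AllPairs-resp-↭ R-sym q (AllPairs-resp-↭ R-sym p ps)

Joins-resp-↭ : ∀ {es fs : List (V × V)} → es ↭ fs → ∀ {x y} → Joins es x y → Joins fs x y
Joins-resp-↭ p = Sum.map (∈-resp-↭ p) (∈-resp-↭ p)

EdgeList-resp-↭ : ∀ {R : V → V → Set} {es fs} → es ↭ fs → EdgeList R es → EdgeList R fs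
EdgeList-resp-↭ p E = record
  { apart    = AllPairs-resp-↭ Apart-sym p (apart E)
  ; sound    = sound E ∘ Joins-resp-↭ (↭-sym p)
  ; complete = Joins-resp-↭ p ∘ complete E }

private
  Joins-there : ∀ {f} {es : List (V × V)} {x y} → Joins es x y → Joins (f ∷ es) x y
  Joins-there = Sum.map there there

  -- For cancelling a matched edge from both lists: since `f` does not recur in `es` in either
  -- direction, no join of `es` can come from `g`.
  Joins-tail : ∀ {f g} {es fs : List (V × V)} {x y} → (f ≡ g ⊎ f ≡ Product.swap g) → All (Apart f) es →
               Joins es x y → Joins (g ∷ fs) x y → Joins fs x y
  Joins-tail f~g ap j (inj₁ (there h)) = inj₁ h
  Joins-tail f~g ap j (inj₂ (there h)) = inj₂ h
  Joins-tail (inj₁ refl) ap (inj₁ k) (inj₁ (here refl)) = contradiction refl (proj₁ (All.lookup ap k))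
  Joins-tail (inj₁ refl) ap (inj₂ k) (inj₁ (here refl)) = contradiction refl (proj₂ (All.lookup ap k))
  Joins-tail (inj₁ refl) ap (inj₁ k) (inj₂ (here refl)) = contradiction refl (proj₂ (All.lookup ap k))
  Joins-tail (inj₁ refl) ap (inj₂ k) (inj₂ (here refl)) = contradiction refl (proj₁ (All.lookup ap k))
  Joins-tail (inj₂ refl) ap (inj₁ k) (inj₁ (here refl)) = contradiction refl (proj₂ (All.lookup ap k))
  Joins-tail (inj₂ refl) ap (inj₂ k) (inj₁ (here refl)) = contradiction refl (proj₁ (All.lookup ap k))
  Joins-tail (inj₂ refl) ap (inj₁ k) (inj₂ (here refl)) = contradiction refl (proj₁ (All.lookup ap k))
  Joins-tail (inj₂ refl) ap (inj₂ k) (inj₂ (here refl)) = contradiction refl (proj₂ (All.lookup ap k))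

-- For graph polynomials the factor is a sign, one -1 for each reversed edge. Being nonzero is all
-- that transferring nonvanishing requires.
record Proportional (F G : Poly V) : Set where
  constructor proportional
  field
    factor   : ℤ
    factor≢0 : factor ≢ 0ℤ
    scale    : ∀ c → F c ≡ factor *ᶻ G c

private
  SameJoins : List (V × V) → List (V × V) → Set
  SameJoins es fs = (∀ {x y} → Joins es x y → Joins fs x y) × (∀ {x y} → Joins fs x y → Joins es x y)

-- Reordering the factors changes nothing, and reversing an edge negates its factor x - y. The head
-- of one list is moved to the front of the other and cancelled.
coef-unique′ : ∀ {{_ : Index V}} (es fs : List (V × V)) → AllPairs Apart es → AllPairs Apart fs →
               SameJoins es fs → Proportional (coef es) (coef fs)
coef-unique′ [] [] _ _ _ = proportional 1ℤ (λ ()) (λ c → sym (ℤ.*-identityˡ _))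
coef-unique′ [] (f ∷ fs) _ _ (_ , h) with h (inj₁ (here refl))
... | inj₁ ()
... | inj₂ ()
coef-unique′ ((x , y) ∷ es) fs (ap ∷ aps) afs (to , from) with to (inj₁ (here refl))
... | inj₁ xy∈ with as , bs , refl ← ∈-∃++ xy∈ =
  proportional factor factor≢0 λ c →
    cong₂ _-ᶻ_ (scale (c ⊖ x)) (scale (c ⊖ y)) ∙ lemma factor _ _ ∙
    cong (factor *ᶻ_) (sym (S-↭ δ-cong p c))
  where
  p = shift (x , y) as bs
  afs′ = AllPairs-resp-↭ Apart-sym p afs
  ih = coef-unique′ es (as ++ bs) aps (case afs′ of λ { (_ ∷ q) → q })
    ( (λ j → Joins-tail (inj₁ refl) ap j (Joins-resp-↭ p (to (Joins-there j))))
    , (λ j → Joins-tail (inj₁ refl) (case afs′ of λ { (q ∷ _) → q }) j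
               (from (Joins-resp-↭ (↭-sym p) (Joins-there j)))))
  open Proportional ih
  lemma : ∀ a b c → a *ᶻ b -ᶻ a *ᶻ c ≡ a *ᶻ (b -ᶻ c)
  lemma = solve-∀
... | inj₂ yx∈ with as , bs , refl ← ∈-∃++ yx∈ =
  proportional (-ᶻ factor) (λ z → factor≢0 (sym (ℤ.neg-involutive _) ∙ cong -ᶻ_ z)) λ c →
    cong₂ _-ᶻ_ (scale (c ⊖ x)) (scale (c ⊖ y)) ∙ lemma factor _ _ ∙
    cong (-ᶻ factor *ᶻ_) (sym (S-↭ δ-cong p c))
  where
  p = shift (y , x) as bs
  afs′ = AllPairs-resp-↭ Apart-sym p afs
  ih = coef-unique′ es (as ++ bs) aps (case afs′ of λ { (_ ∷ q) → q })
    ( (λ j → Joins-tail (inj₂ refl) ap j (Joins-resp-↭ p (to (Joins-there j))))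
    , (λ j → Joins-tail (inj₂ refl) (case afs′ of λ { (q ∷ _) → q }) j
               (from (Joins-resp-↭ (↭-sym p) (Joins-there j)))))
  open Proportional ih
  lemma : ∀ a b c → a *ᶻ b -ᶻ a *ᶻ c ≡ (-ᶻ a) *ᶻ (c -ᶻ b)
  lemma = solve-∀

coef-unique : ∀ {{_ : Index V}} {R : V → V → Set} {es fs} → EdgeList R es → EdgeList R fs →
              Proportional (coef es) (coef fs)
coef-unique E F = coef-unique′ _ _ (apart E) (apart F) (complete F ∘ sound E , complete E ∘ sound F)

-- Degrees, homogeneity and translation invariance

module _ {{_ : Index V}} where

  Untouched : V → List (V × V) → Set
  Untouched v = All (λ (x , y) → v ≢ x × v ≢ y)

  private
    sub-zero : ∀ {a b} → b ≡ 0ℤ → a -ᶻ b ≡ a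
    sub-zero {a} refl = ℤ.+-identityʳ a

  ⊖-at-other : ∀ (c : Exponent V) {u v} → v ≢ u → (c ⊖ u) v ≡ c v
  ⊖-at-other c v≢u = sub-zero (e-diff v≢u)

  coef-untouched : ∀ {es v} → Untouched v es → ∀ c → c v ≢ 0ℤ → coef es c ≡ 0ℤ
  coef-untouched []                    c cv≢0 = δ-nonzero _ cv≢0
  coef-untouched ((v≢x , v≢y) ∷ v∉es) c cv≢0 =
    cong₂ _-ᶻ_ (coef-untouched v∉es _ (cv≢0 ∘ (sym (⊖-at-other c v≢x) ∙_)))
               (coef-untouched v∉es _ (cv≢0 ∘ (sym (⊖-at-other c v≢y) ∙_)))

  ⊖-≤ : ∀ (c : Exponent V) u v → (c ⊖ u) v ≤ᶻ c v
  ⊖-≤ c u v = subst ((c ⊖ u) v ≤ᶻ_) (ℤ.+-identityʳ (c v)) (ℤ.+-monoʳ-≤ (c v) (ℤ.neg-mono-≤ (e≥0 u v)))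

  coef-negative : ∀ es {v} c → c v <ᶻ 0ℤ → coef es c ≡ 0ℤ
  coef-negative []             {v} c cv<0 = δ-nonzero v (ℤ.<⇒≢ cv<0)
  coef-negative ((x , y) ∷ es) {v} c cv<0 =
    cong₂ _-ᶻ_ (coef-negative es _ (ℤ.≤-<-trans (⊖-≤ c x v) cv<0))
               (coef-negative es _ (ℤ.≤-<-trans (⊖-≤ c y v) cv<0))

  coef-nonnegative : ∀ es {c} → coef es c ≢ 0ℤ → ∀ v → 0ℤ ≤ᶻ c v
  coef-nonnegative es {c} nz v with 0ℤ ℤ.≤? c v
  ... | yes p = p
  ... | no ¬p = contradiction (coef-negative es c (ℤ.≰⇒> ¬p)) nz

  total : Exponent V → ℤ
  total = Σ[ enum ]

  total-cong : ∀ {c d : Exponent V} → c ≗ d → total c ≡ total d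
  total-cong = Σ-cong (enum {V})

  Σ-e-∉ : ∀ {vs : List V} {v} → v ∉ₗ vs → Σ[ vs ] (e v) ≡ 0ℤ
  Σ-e-∉ {vs} {v} v∉vs = Σ-zero vs λ u u∈vs → e-diff λ { refl → v∉vs u∈vs }

  Σ-e-∈ : ∀ {vs : List V} {v} → Unique vs → v ∈ₗ vs → Σ[ vs ] (e v) ≡ 1ℤ
  Σ-e-∈ {u ∷ vs} {v} (u∉ ∷ uq) (here refl) =
    cong₂ _+ᶻ_ (e-same refl) (Σ-e-∉ λ u∈ → All.lookup u∉ u∈ refl)
  Σ-e-∈ {u ∷ vs} {v} (u∉ ∷ uq) (there v∈) =
    cong₂ _+ᶻ_ (e-diff (All.lookup u∉ v∈)) (Σ-e-∈ uq v∈)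

  total-e : ∀ (v : V) → total (e v) ≡ 1ℤ
  total-e v = Σ-e-∈ enum-unique (enum-complete v)

  total-∔ : ∀ c d → total (c ∔ d) ≡ total c +ᶻ total d
  total-∔ c d = Σ-+ (enum {V}) c d

  total-⊕ : ∀ c v → total (c ⊕ v) ≡ total c +ᶻ 1ℤ
  total-⊕ c v = total-∔ c (e v) ∙ cong (total c +ᶻ_) (total-e v)

  total-⊖ : ∀ c v → total (c ⊖ v) ≡ total c -ᶻ 1ℤ
  total-⊖ c v = lemma (total (c ⊖ v)) ∙
    cong (_-ᶻ 1ℤ) (sym (total-⊕ (c ⊖ v) v) ∙ total-cong (⊖⊕-cancel c v))
    where
    lemma : ∀ a → a ≡ a +ᶻ 1ℤ -ᶻ 1ℤ
    lemma = solve-∀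

  Homogeneous : ℤ → Poly V → Set
  Homogeneous d F = ∀ c → total c ≢ d → F c ≡ 0ℤ

  δ-homogeneous : Homogeneous 0ℤ δ
  δ-homogeneous c tc≢0 with zero? c
  ... | inj₁ c≡0      = contradiction (Σ-zero (enum {V}) λ v _ → c≡0 v) tc≢0
  ... | inj₂ (v , nz) = δ-nonzero v nz

  coef-homogeneous : ∀ es → Homogeneous (+ length es) (coef es)
  coef-homogeneous []             = δ-homogeneous
  coef-homogeneous ((x , y) ∷ es) c tc≢ = cong₂ _-ᶻ_ (step x) (step y)
    where
    lemma : ∀ a → 1ℤ +ᶻ (a -ᶻ 1ℤ) ≡ a
    lemma = solve-∀
    step : ∀ u → coef es (c ⊖ u) ≡ 0ℤ
    step u = coef-homogeneous es (c ⊖ u) λ h →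
      tc≢ (sym (lemma (total c)) ∙ cong (1ℤ +ᶻ_) (sym (total-⊖ c u) ∙ h))

  coef-degree : ∀ es {c} → coef es c ≢ 0ℤ → total c ≡ + length es
  coef-degree es {c} nz with total c ℤ.≟ + length es
  ... | yes p = p
  ... | no ¬p = contradiction (coef-homogeneous es c ¬p) nz

  lin-homogeneous : ∀ l {d F} → Homogeneous d F → Homogeneous (d +ᶻ 1ℤ) (lin l F)
  lin-homogeneous []            h c tc≢ = refl
  lin-homogeneous ((a , v) ∷ l) {d} h c tc≢ =
    cong₂ _+ᶻ_ (cong (a *ᶻ_) (h (c ⊖ v) λ q → tc≢ (lemma (total c) ∙ cong (_+ᶻ 1ℤ) (sym (total-⊖ c v) ∙ q))) ∙ ℤ.*-zeroʳ a)
               (lin-homogeneous l h c tc≢)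
    where
    lemma : ∀ a → a ≡ a -ᶻ 1ℤ +ᶻ 1ℤ
    lemma = solve-∀

  -- The derivative along (1, …, 1); it kills every product of
  -- differences.
  ∂ : Poly V → Poly V
  ∂ F c = Σ[ enum ] λ v → (c v +ᶻ 1ℤ) *ᶻ F (c ⊕ v)

  -- The product rule for x F, where the derivative of x is 1.
  ∂-shift : ∀ {F} → Congruent F → ∀ x c →
            ∂ (λ d → F (d ⊖ x)) c ≡ ∂ F (c ⊖ x) +ᶻ F c
  ∂-shift {F} F-cong x c = begin
    Σ[ enum ] (λ v → (c v +ᶻ 1ℤ) *ᶻ F (c ⊕ v ⊖ x))
      ≡⟨ Σ-cong (enum {V}) (λ v → cong ((c v +ᶻ 1ℤ) *ᶻ_) (F-cong (⊕⊖-comm c v x))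
                           ∙ lemma (c v) (e x v) (F (c ⊖ x ⊕ v))) ⟩
    Σ[ enum ] (λ v → ((c ⊖ x) v +ᶻ 1ℤ) *ᶻ F (c ⊖ x ⊕ v) +ᶻ e x v *ᶻ F (c ⊖ x ⊕ v))
      ≡⟨ Σ-+ (enum {V}) _ _ ⟩
    ∂ F (c ⊖ x) +ᶻ Σ[ enum ] (λ v → e x v *ᶻ F (c ⊖ x ⊕ v))
      ≡⟨ cong (∂ F (c ⊖ x) +ᶻ_) (Σ-cong (enum {V}) at ∙ Σ-*ˡ (enum {V}) (F c) (e x) ∙ cong (F c *ᶻ_) (total-e x) ∙ ℤ.*-identityʳ (F c)) ⟩
    ∂ F (c ⊖ x) +ᶻ F c ∎
    where
    open ≡-Reasoning
    lemma : ∀ a b f → (a +ᶻ 1ℤ) *ᶻ f ≡ (a -ᶻ b +ᶻ 1ℤ) *ᶻ f +ᶻ b *ᶻ f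
    lemma = solve-∀
    at : ∀ v → e x v *ᶻ F (c ⊖ x ⊕ v) ≡ F c *ᶻ e x v
    at v with v ≟ x
    ... | yes refl = ℤ.*-comm (e x x) _ ∙ cong (_*ᶻ e x x) (F-cong (⊖⊕-cancel c x))
    ... | no v≢x   = cong (_*ᶻ F (c ⊖ x ⊕ v)) (e-diff v≢x) ∙ sym (ℤ.*-zeroʳ (F c))
                     ∙ cong (F c *ᶻ_) (sym (e-diff v≢x))

  -- By the product rule x F and y F have the same extra term F, which cancels in (x - y) F.
  ∂-coef : ∀ es c → ∂ (coef es) c ≡ 0ℤ
  ∂-coef [] c = Σ-zero (enum {V}) at
    where
    lemma : ∀ a → a ≡ a -ᶻ 1ℤ +ᶻ 1ℤ
    lemma = solve-∀
    at : ∀ v → v ∈ₗ enum → (c v +ᶻ 1ℤ) *ᶻ δ (c ⊕ v) ≡ 0ℤ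
    -- The value `δ (c ⊕ v)` can be nonzero only if `c v` is -1, and then the weight `c v +ᶻ 1ℤ`
    -- vanishes.
    at v _ with c v +ᶻ 1ℤ ℤ.≟ 0ℤ
    ... | yes p = cong (_*ᶻ δ (c ⊕ v)) p
    ... | no ¬p = cong ((c v +ᶻ 1ℤ) *ᶻ_) (δ-nonzero v λ q → ¬p (cong (c v +ᶻ_) (sym (e-same refl)) ∙ q))
                  ∙ ℤ.*-zeroʳ (c v +ᶻ 1ℤ)
  ∂-coef ((x , y) ∷ es) c = begin
    Σ[ enum ] (λ v → (c v +ᶻ 1ℤ) *ᶻ (F (c ⊕ v ⊖ x) -ᶻ F (c ⊕ v ⊖ y)))
      ≡⟨ Σ-cong (enum {V}) (λ v → lemma (c v +ᶻ 1ℤ) (F (c ⊕ v ⊖ x)) _) ⟩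
    Σ[ enum ] (λ v → (c v +ᶻ 1ℤ) *ᶻ F (c ⊕ v ⊖ x) +ᶻ -1ℤ *ᶻ ((c v +ᶻ 1ℤ) *ᶻ F (c ⊕ v ⊖ y)))
      ≡⟨ Σ-+ (enum {V}) _ _ ⟩
    ∂ (λ d → F (d ⊖ x)) c +ᶻ Σ[ enum ] (λ v → -1ℤ *ᶻ ((c v +ᶻ 1ℤ) *ᶻ F (c ⊕ v ⊖ y)))
      ≡⟨ cong (∂ (λ d → F (d ⊖ x)) c +ᶻ_) (Σ-*ˡ (enum {V}) -1ℤ _) ⟩
    ∂ (λ d → F (d ⊖ x)) c +ᶻ -1ℤ *ᶻ ∂ (λ d → F (d ⊖ y)) c
      ≡⟨ cong₂ (λ a b → a +ᶻ -1ℤ *ᶻ b) (shifted x) (shifted y) ⟩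
    F c +ᶻ -1ℤ *ᶻ F c
      ≡⟨ lemma′ (F c) ⟩
    0ℤ ∎
    where
    open ≡-Reasoning
    F = coef es
    lemma : ∀ a f g → a *ᶻ (f -ᶻ g) ≡ a *ᶻ f +ᶻ -1ℤ *ᶻ (a *ᶻ g)
    lemma = solve-∀
    lemma′ : ∀ f → f +ᶻ -1ℤ *ᶻ f ≡ 0ℤ
    lemma′ = solve-∀
    shifted : ∀ u → ∂ (λ d → F (d ⊖ u)) c ≡ F c
    shifted u = ∂-shift (coef-cong es) u c ∙ cong (_+ᶻ F c) (∂-coef es (c ⊖ u)) ∙ ℤ.+-identityˡ (F c)

  -- Since `∂` kills the graph polynomial P, the derivative of (Σ a x) P is (Σ a) P, whose
  -- coefficient at `c` is a multiple of `coef es c`.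
  ∂-lin : ∀ l es c → coef es c ≡ 0ℤ → ∂ (lin l (coef es)) c ≡ 0ℤ
  ∂-lin [] es c z = Σ-zero (enum {V}) λ v _ → ℤ.*-zeroʳ (c v +ᶻ 1ℤ)
  ∂-lin ((a , u) ∷ l) es c z = begin
    Σ[ enum ] (λ v → (c v +ᶻ 1ℤ) *ᶻ (a *ᶻ F (c ⊕ v ⊖ u) +ᶻ lin l F (c ⊕ v)))
      ≡⟨ Σ-cong (enum {V}) (λ v → lemma (c v +ᶻ 1ℤ) a (F (c ⊕ v ⊖ u)) _) ⟩
    Σ[ enum ] (λ v → a *ᶻ ((c v +ᶻ 1ℤ) *ᶻ F (c ⊕ v ⊖ u)) +ᶻ (c v +ᶻ 1ℤ) *ᶻ lin l F (c ⊕ v))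
      ≡⟨ Σ-+ (enum {V}) _ _ ⟩
    Σ[ enum ] (λ v → a *ᶻ ((c v +ᶻ 1ℤ) *ᶻ F (c ⊕ v ⊖ u))) +ᶻ ∂ (lin l F) c
      ≡⟨ cong₂ _+ᶻ_ (Σ-*ˡ (enum {V}) a _) (∂-lin l es c z) ⟩
    a *ᶻ ∂ (λ d → F (d ⊖ u)) c +ᶻ 0ℤ
      ≡⟨ cong (λ s → a *ᶻ s +ᶻ 0ℤ) (∂-shift (coef-cong es) u c ∙ cong₂ _+ᶻ_ (∂-coef es (c ⊖ u)) z) ⟩
    a *ᶻ 0ℤ +ᶻ 0ℤ
      ≡⟨ cong (_+ᶻ 0ℤ) (ℤ.*-zeroʳ a) ⟩
    0ℤ ∎
    where
    open ≡-Reasoning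
    F = coef es
    lemma : ∀ k a f g → k *ᶻ (a *ᶻ f +ᶻ g) ≡ a *ᶻ (k *ᶻ f) +ᶻ k *ᶻ g
    lemma = solve-∀

  NonConstant : (V → ℤ) → Set
  NonConstant a = ∃ λ s → ∃ λ t → a s ≢ a t

  Σ-positive : ∀ vs {f : V → ℤ} → (∀ v → 0ℤ <ᶻ f v) → ∀ {v} → v ∈ₗ vs → 0ℤ <ᶻ Σ[ vs ] f
  Σ-positive (u ∷ [])     {f} pos _ = subst (0ℤ <ᶻ_) (sym (ℤ.+-identityʳ (f u))) (pos u)
  Σ-positive (u ∷ w ∷ vs) pos _ = ℤ.+-mono-< (pos u) (Σ-positive (w ∷ vs) pos (here refl))

  -- If all these entries equalled the nonzero value at `v`, the derivative at `c` would be that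
  -- value times the sum of all `c u +ᶻ 1ℤ`, which is positive.
  ∂-nonConstant : ∀ {F c v} → (∀ u → 0ℤ ≤ᶻ c u) → ∂ F c ≡ 0ℤ → F (c ⊕ v) ≢ 0ℤ →
                  NonConstant (λ u → F (c ⊕ u))
  ∂-nonConstant {F} {c} {v} c≥0 ∂F≡0 nz
    with All.all? (λ u → F (c ⊕ u) ℤ.≟ F (c ⊕ v)) enum
  ... | no ¬all = find (enum {V}) ¬all
    where
    find : ∀ vs → ¬ All (λ u → F (c ⊕ u) ≡ F (c ⊕ v)) vs → NonConstant (λ u → F (c ⊕ u))
    find []       ¬p = contradiction [] ¬p
    find (u ∷ us) ¬p with F (c ⊕ u) ℤ.≟ F (c ⊕ v)
    ... | yes q = find us λ r → ¬p (q ∷ r)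
    ... | no ¬q = u , v , ¬q
  ... | yes all = ⊥-elim (case ℤ.i*j≡0⇒i≡0∨j≡0 (F (c ⊕ v)) product of λ
      { (inj₁ z) → nz z ; (inj₂ z) → ℤ.<⇒≢ sum>0 (sym z) })
    where
    sum>0 : 0ℤ <ᶻ Σ[ enum ] (λ u → c u +ᶻ 1ℤ)
    sum>0 = Σ-positive (enum {V}) (λ u → ℤ.+-mono-≤-< (c≥0 u) (ℤ.+<+ (ℕ.s≤s ℕ.z≤n))) (enum-complete v)
    product : F (c ⊕ v) *ᶻ Σ[ enum ] (λ u → c u +ᶻ 1ℤ) ≡ 0ℤ
    product = sym (Σ-*ˡ (enum {V}) (F (c ⊕ v)) _)
      ∙ Σ-cong (enum {V}) (λ u → ℤ.*-comm (F (c ⊕ v)) (c u +ᶻ 1ℤ)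
                           ∙ cong ((c u +ᶻ 1ℤ) *ᶻ_) (sym (All.lookup all (enum-complete u))))
      ∙ ∂F≡0

-- The list `vs` is a parameter because the form is evaluated in a vertex order adapted to two
-- vertices at which `a` differs. The bound d concerns `c`; the extra unit at `v` is the one that is
-- traded for a backward edge.
RobustAtOn : {{_ : Index V}} → ℕ → List (V × V) → (V → ℤ) → List V → Set
RobustAtOn d es a vs = ∃ λ c →
  (∀ v → 0ℤ ≤ᶻ c v) × (∀ v → c v ≤ᶻ + d) × coef es c ≡ 0ℤ ×
  ∃ λ v → lin (formOn a vs) (coef es) (c ⊕ v) ≢ 0ℤ

RobustAt : {{_ : Index V}} → ℕ → List (V × V) → (V → ℤ) → Set
RobustAt d es a = RobustAtOn d es a enum

-- The invariant of the induction along the Hamilton path. The condition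
-- coef es c ≡ 0ℤ lets ∂-nonConstant upgrade the nonzero entry at v to a
-- nonconstant family of entries.
Robust : {{_ : Index V}} → ℕ → List (V × V) → Set
Robust d es = ∀ a → NonConstant a → RobustAt d es a

-- Adding a block of vertices

0̂ : Exponent V
0̂ _ = 0ℤ

infix 5 _↾_

_↾_ : (V → V → Set) → (V → Set) → V → V → Set
(R ↾ A) x y = R x y × A x × A y

module Block {{_ : Index U}} {{_ : Index V}} (φ : U → V)
             (φ-injective : ∀ {u u′} → φ u ≡ φ u′ → u ≡ u′) where

  Off : V → Set
  Off v = ∀ u → φ u ≢ v

  image? : ∀ v → (∃ λ u → φ u ≡ v) ⊎ Off v
  image? v with Any.any? (λ u → φ u ≟ v) (enum {U})
  ... | yes p with u , _ , h ← ∈ₗ.find p = inj₁ (u , h)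
  ... | no ¬p = inj₂ λ u h → ¬p (Any.map (λ { refl → h }) (enum-complete u))

  opaque
    join : Exponent U → Exponent V → Exponent V
    join f c v = [ f ∘ proj₁ , (λ _ → c v) ]′ (image? v)

    join-in : ∀ f c {u v} → φ u ≡ v → join f c v ≡ f u
    join-in f c {u} {v} q with image? v
    ... | inj₁ (u′ , q′) = cong f (φ-injective (q′ ∙ sym q))
    ... | inj₂ off       = contradiction q (off u)

    join-out : ∀ f c {v} → Off v → join f c v ≡ c v
    join-out f c {v} off with image? v
    ... | inj₁ (u , q) = contradiction q (off u)
    ... | inj₂ _       = refl

  join-cong : ∀ {f g c d} → f ≗ g → c ≗ d → join f c ≗ join g d
  join-cong {f} {g} {c} {d} f≗g c≗d v with image? v
  ... | inj₁ (u , q) = join-in f c q ∙ f≗g u ∙ sym (join-in g d q)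
  ... | inj₂ off     = join-out f c off ∙ c≗d v ∙ sym (join-out g d off)

  join-⊖-in : ∀ f c u → join f c ⊖ φ u ≗ join (f ⊖ u) c
  join-⊖-in f c u v with image? v
  ... | inj₂ off = cong (λ z → join f c v -ᶻ z) (e-diff λ q → off u (sym q)) ∙ ℤ.+-identityʳ _
                   ∙ join-out f c off ∙ sym (join-out (f ⊖ u) c off)
  ... | inj₁ (w , refl) = cong₂ _-ᶻ_ (join-in f c refl) same ∙ sym (join-in (f ⊖ u) c refl)
    where
    same : e (φ u) (φ w) ≡ e u w
    same with w ≟ u
    ... | yes refl = e-same refl ∙ sym (e-same refl)
    ... | no w≢u   = e-diff (w≢u ∘ φ-injective) ∙ sym (e-diff w≢u)

  join-⊖-out : ∀ f c {y} → Off y → join f c ⊖ y ≗ join f (c ⊖ y)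
  join-⊖-out f c {y} off-y v with image? v
  ... | inj₂ off = cong (_-ᶻ e y v) (join-out f c off) ∙ sym (join-out f (c ⊖ y) off)
  ... | inj₁ (w , refl) = cong₂ _-ᶻ_ (join-in f c refl) (e-diff (off-y w)) ∙ ℤ.+-identityʳ _
                          ∙ sym (join-in f (c ⊖ y) refl)

  restrict : ∀ {c} → (∀ u → c (φ u) ≡ 0ℤ) → join 0̂ c ≗ c
  restrict {c} c0 v with image? v
  ... | inj₁ (u , refl) = join-in 0̂ c refl ∙ sym (c0 u)
  ... | inj₂ off-v      = join-out 0̂ c off-v

  inner : List (U × U) → List (V × V)
  inner = List.map (Product.map φ φ)

  cross : List (U × V) → List (V × V)
  cross = List.map (Product.map φ id)

  Outside : List (V × V) → Set
  Outside = All (λ (x , y) → Off x × Off y)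

  coef-isOutside : ∀ {es} → Outside es → ∀ f c → (∃ λ u → f u ≢ 0ℤ) → coef es (join f c) ≡ 0ℤ
  coef-isOutside out f c (u , fu≢0) =
    coef-untouched (All.map (λ (p , q) → p u , q u) out) _ (λ h → fu≢0 (sym (join-in f c refl) ∙ h))

  -- The inner edges involve only block variables and `F` involves none of them, so the coefficient
  -- of the product factors.
  S-inner : ∀ es {F} → Congruent F → (∀ f c → (∃ λ u → f u ≢ 0ℤ) → F (join f c) ≡ 0ℤ) →
            ∀ f c → S (inner es) F (join f c) ≡ coef es f *ᶻ F (join 0̂ c)
  S-inner [] {F} F-cong F-out f c with zero? f
  ... | inj₁ f≡0      = F-cong (join-cong f≡0 (λ _ → refl)) ∙ sym (ℤ.*-identityˡ _)
                        ∙ cong (_*ᶻ F (join 0̂ c)) (sym (δ-zero f≡0))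
  ... | inj₂ (u , nz) = F-out f c (u , nz) ∙ cong (_*ᶻ F (join 0̂ c)) (sym (δ-nonzero u nz))
  S-inner ((x , y) ∷ es) {F} F-cong F-out f c =
    cong₂ _-ᶻ_ (step x) (step y) ∙ lemma (coef es (f ⊖ x)) _ _
    where
    lemma : ∀ a b k → a *ᶻ k -ᶻ b *ᶻ k ≡ (a -ᶻ b) *ᶻ k
    lemma = solve-∀
    step : ∀ u → S (inner es) F (join f c ⊖ φ u) ≡ coef es (f ⊖ u) *ᶻ F (join 0̂ c)
    step u = S-cong (inner es) F-cong (join-⊖-in f c u) ∙ S-inner es F-cong F-out (f ⊖ u) c

  -- The indegrees that the cross edges give to the block when all of them point into it.
  tally : List (U × V) → Exponent U
  tally []             w = 0ℤ
  tally ((u , y) ∷ cr) w = tally cr w +ᶻ e u w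

  OffTargets : List (U × V) → Set
  OffTargets = All (Off ∘ proj₂)

  -- The degree of `g` does the bookkeeping: d minus the total of `f` is the number of cross edges
  -- that have to point out of the block.
  module _ {G : Poly V} {g : Poly U} {h : Poly V} {d : ℤ}
           (G-cong : Congruent G) (g-cong : Congruent g)
           (split : ∀ f c → G (join f c) ≡ g f *ᶻ h c)
           (g-homogeneous : Homogeneous d g) where

    private
      cons-in : ∀ cr {u y} f c →
                S (cross cr) G (join (f ∔ tally ((u , y) ∷ cr)) c ⊖ φ u) ≡
                S (cross cr) G (join (f ∔ tally cr) c)
      cons-in cr {u} f c = S-cong (cross cr) G-cong λ v →
        join-⊖-in _ c u v ∙ join-cong (λ w → lemma (f w) (tally cr w) (e u w)) (λ _ → refl) v
        where
        lemma : ∀ a b c → a +ᶻ (b +ᶻ c) -ᶻ c ≡ a +ᶻ b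
        lemma = solve-∀

      cons-out : ∀ cr {u y} f c → Off y →
                 S (cross cr) G (join (f ∔ tally ((u , y) ∷ cr)) c ⊖ y) ≡
                 S (cross cr) G (join (f ⊕ u ∔ tally cr) (c ⊖ y))
      cons-out cr {u} f c off = S-cong (cross cr) G-cong λ v →
        join-⊖-out _ c off v ∙ join-cong (λ w → lemma (f w) (tally cr w) (e u w)) (λ _ → refl) v
        where
        lemma : ∀ a b c → a +ᶻ (b +ᶻ c) ≡ a +ᶻ c +ᶻ b
        lemma = solve-∀

    -- Even if every cross edge points into the block and absorbs one unit, more degree remains on
    -- the block than `g` has.
    cross-exceeding : ∀ {cr} → OffTargets cr → ∀ f c n → total f ≡ d +ᶻ + suc n →
                      S (cross cr) G (join (f ∔ tally cr) c) ≡ 0ℤ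
    cross-exceeding [] f c n tf =
      split (f ∔ tally []) c ∙ cong (_*ᶻ h c) (g-cong (λ w → ℤ.+-identityʳ (f w)) ∙ g-homogeneous f λ q →
        case cancel (sym tf ∙ q) of λ ())
      where
      cancel : d +ᶻ + suc n ≡ d → + suc n ≡ 0ℤ
      cancel q = +ᶻ-cancelˡ d (+ suc n) 0ℤ (q ∙ sym (ℤ.+-identityʳ d))
    cross-exceeding {(u , y) ∷ cr} (off ∷ offs) f c n tf = cong₂ _-ᶻ_
      (cons-in cr {u} {y} f c ∙ cross-exceeding offs f c n tf)
      (cons-out cr f c off ∙ cross-exceeding offs (f ⊕ u) (c ⊖ y) (suc n)
         (total-⊕ f u ∙ cong (_+ᶻ 1ℤ) tf ∙ ℤ.+-assoc d _ _ ∙ cong (λ m → d +ᶻ + m) (ℕ.+-comm (suc n) 1)))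

    -- A cross edge pointing out of the block would leave too much degree for `g`, so only one
    -- choice for the cross edges survives.
    cross-top : ∀ {cr} → OffTargets cr → ∀ f c → total f ≡ d →
                S (cross cr) G (join (f ∔ tally cr) c) ≡ g f *ᶻ h c
    cross-top [] f c tf = split (f ∔ tally []) c ∙ cong (_*ᶻ h c) (g-cong λ w → ℤ.+-identityʳ (f w))
    cross-top {(u , y) ∷ cr} (off ∷ offs) f c tf =
      cong₂ _-ᶻ_ (cons-in cr {u} {y} f c ∙ cross-top offs f c tf)
                 (cons-out cr f c off ∙ cross-exceeding offs (f ⊕ u) (c ⊖ y) 0
                    (total-⊕ f u ∙ cong (_+ᶻ 1ℤ) tf))
      ∙ ℤ.+-identityʳ _

    -- Once an edge from `u` to `y` points outwards, the block exponent is `f ⊕ u`, of full degree,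
    -- and `cross-top` forces the remaining edges inwards. The minus sign is that of y in x - y.
    cross-second : ∀ {cr} → OffTargets cr → ∀ f c → total f +ᶻ 1ℤ ≡ d →
                   S (cross cr) G (join (f ∔ tally cr) c) ≡
                   lin (List.map (λ (u , y) → -ᶻ g (f ⊕ u) , y) cr) h c
    cross-second [] f c tf = split (f ∔ tally []) c ∙ cong (_*ᶻ h c)
      (g-cong (λ w → ℤ.+-identityʳ (f w)) ∙ g-homogeneous f λ q →
        case +ᶻ-cancelˡ (total f) 1ℤ 0ℤ (tf ∙ sym q ∙ sym (ℤ.+-identityʳ _)) of λ ())
    cross-second {(u , y) ∷ cr} (off ∷ offs) f c tf =
      cong₂ _-ᶻ_ (cons-in cr {u} {y} f c ∙ cross-second offs f c tf)
                 (cons-out cr f c off ∙ cross-top offs (f ⊕ u) (c ⊖ y) (total-⊕ f u ∙ tf))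
      ∙ lemma _ (g (f ⊕ u)) (h (c ⊖ y))
      where
      lemma : ∀ l a b → l -ᶻ a *ᶻ b ≡ (-ᶻ a) *ᶻ b +ᶻ l
      lemma = solve-∀

  extend : List (U × U) → List (U × V) → List (V × V) → List (V × V)
  extend es cr fs = inner es ++ cross cr ++ fs

  module _ {es : List (U × U)} {cr : List (U × V)} {fs : List (V × V)}
           (offs : OffTargets cr) (out : Outside fs) where

    private
      extended = extend es cr fs

      rest : Poly V
      rest c = coef fs (join 0̂ c)

      G : Poly V
      G = S (inner es) (coef fs)

      G-cong : Congruent G
      G-cong = S-cong (inner es) (coef-cong fs)

      G-split : ∀ f c → G (join f c) ≡ coef es f *ᶻ rest c
      G-split = S-inner es (coef-cong fs) (coef-isOutside out)

      coef-extended : coef extended ≗ S (cross cr) G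
      coef-extended c = S-↭ δ-cong (Perm.shifts (inner es) (cross cr)) c ∙ S-++ (cross cr) δ c
        ∙ S-ext (cross cr) (S-++ (inner es) δ) c

      lin-rest : ∀ {l c} → All (Off ∘ proj₂) l → (∀ u → c (φ u) ≡ 0ℤ) → lin l rest c ≡ lin l (coef fs) c
      lin-rest [] c0 = refl
      lin-rest {(a , y) ∷ l} {c} (off ∷ offs) c0 =
        cong₂ (λ p q → a *ᶻ p +ᶻ q) (coef-cong fs (restrict λ u → ⊖-at-other c (off u) ∙ c0 u)) (lin-rest offs c0)

      form-split : ∀ (a : U → ℤ) us f c → lin (List.map (λ u → a u , φ u) us) G (join f c) ≡
                                lin (List.map (λ u → a u , u) us) (coef es) f *ᶻ rest c
      form-split a []       f c = refl
      form-split a (u ∷ us) f c =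
        cong₂ (λ p q → a u *ᶻ p +ᶻ q) (G-cong (join-⊖-in f c u) ∙ G-split (f ⊖ u) c) (form-split a us f c)
        ∙ lemma (a u) (coef es (f ⊖ u)) (rest c) _
        where
        lemma : ∀ a b k l → a *ᶻ (b *ᶻ k) +ᶻ l *ᶻ k ≡ (a *ᶻ b +ᶻ l) *ᶻ k
        lemma = solve-∀

      lower-split : ∀ {l} → All (Off ∘ proj₂) l → ∀ f c →
                    lin l G (join f c) ≡ coef es f *ᶻ lin l rest c
      lower-split [] f c = sym (ℤ.*-zeroʳ (coef es f))
      lower-split {(a , y) ∷ l} (off ∷ offs) f c =
        cong₂ (λ p q → a *ᶻ p +ᶻ q) (G-cong (join-⊖-out f c off) ∙ G-split f (c ⊖ y)) (lower-split offs f c)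
        ∙ lemma a (coef es f) _ _
        where
        lemma : ∀ a b k l → a *ᶻ (b *ᶻ k) +ᶻ b *ᶻ l ≡ b *ᶻ (a *ᶻ k +ᶻ l)
        lemma = solve-∀

    -- By homogeneity, a nonzero `coef es f` already fixes the total of `f` as the number of inner
    -- edges, so no cross edge can point out of the block.
    coef-block : ∀ {f c} → coef es f ≢ 0ℤ → (∀ u → c (φ u) ≡ 0ℤ) →
                 coef extended (join (f ∔ tally cr) c) ≡ coef es f *ᶻ coef fs c
    coef-block {f} {c} nz c0 =
      coef-extended _
      ∙ cross-top {g = coef es} G-cong (coef-cong es) G-split (coef-homogeneous es) offs f c (coef-degree es nz)
      ∙ cong (coef es f *ᶻ_) (coef-cong fs (restrict c0))

    private
      degree-⊕ : ∀ {d} f {u} {F : Poly U} → Homogeneous d F → F (f ⊕ u) ≢ 0ℤ → total f +ᶻ 1ℤ ≡ d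
      degree-⊕ {d} f {u} hom nz with total f +ᶻ 1ℤ ℤ.≟ d
      ... | yes p = p
      ... | no ¬p = contradiction (hom (f ⊕ u) (λ q → ¬p (sym (total-⊕ f u) ∙ q))) nz

    -- Exactly one cross edge is directed away from the block.
    coef-deficient : ∀ {f c u} → coef es (f ⊕ u) ≢ 0ℤ → (∀ u → c (φ u) ≡ 0ℤ) →
                     coef extended (join (f ∔ tally cr) c) ≡
                     lin (List.map (λ (u , y) → -ᶻ coef es (f ⊕ u) , y) cr) (coef fs) c
    coef-deficient {f} {c} nz c0 =
      coef-extended _
      ∙ cross-second {g = coef es} G-cong (coef-cong es) G-split (coef-homogeneous es) offs f c
          (degree-⊕ f (coef-homogeneous es) nz)
      ∙ lin-rest (All.map⁺ offs) c0

    lin-block : ∀ (a : U → ℤ) {f c} → lin (form a) (coef es) f ≢ 0ℤ → (∀ u → c (φ u) ≡ 0ℤ) →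
      lin (List.map (λ u → a u , φ u) enum) (coef extended) (join (f ∔ tally cr) c) ≡
      lin (form a) (coef es) f *ᶻ coef fs c
    lin-block a {f} {c} nz c0 =
      lin-ext L₁ coef-extended _ ∙ lin-S L₁ (cross cr) G-cong _
      ∙ cross-top {g = lin (form a) (coef es)} {h = rest} (lin-cong L₁ G-cong) (lin-cong (form a) (coef-cong es))
          (form-split a (enum {U})) (lin-homogeneous (form a) (coef-homogeneous es)) offs f c degree
      ∙ cong (lin (form a) (coef es) f *ᶻ_) (coef-cong fs (restrict c0))
      where
      L₁ = List.map (λ u → a u , φ u) (enum {U})
      degree : total f ≡ + length es +ᶻ 1ℤ
      degree with total f ℤ.≟ + length es +ᶻ 1ℤ
      ... | yes p = p
      ... | no ¬p = contradiction (lin-homogeneous (form a) (coef-homogeneous es) f ¬p) nz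

    -- A term of the form on the block raises the block degree by one and so makes one cross edge
    -- point outwards. A term of `l` leaves the block degree unchanged, forces all cross edges
    -- inwards and contributes a multiple of `coef es f`.
    lin-deficient : ∀ (a : U → ℤ) l {f c u} → All (Off ∘ proj₂) l → coef es f ≡ 0ℤ →
      lin (form a) (coef es) (f ⊕ u) ≢ 0ℤ → (∀ u → c (φ u) ≡ 0ℤ) →
      lin (List.map (λ u → a u , φ u) enum ++ l) (coef extended) (join (f ∔ tally cr) c) ≡
      lin (List.map (λ (u , y) → -ᶻ lin (form a) (coef es) (f ⊕ u) , y) cr) (coef fs) c
    lin-deficient a l {f} {c} {u} off-l f0 nz c0 = begin
      lin L (coef extended) J                     ≡⟨ lin-ext L coef-extended J ⟩
      lin L (S (cross cr) G) J                    ≡⟨ lin-S L (cross cr) G-cong J ⟩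
      S (cross cr) (lin L G) J                    ≡⟨ S-ext (cross cr) separate J ⟩
      S (cross cr) (λ d → 1ℤ *ᶻ lin L₁ G d +ᶻ lin l G d) J
                                                  ≡⟨ S-linear (cross cr) 1ℤ J ⟩
      1ℤ *ᶻ S (cross cr) (lin L₁ G) J +ᶻ S (cross cr) (lin l G) J
        ≡⟨ cong₂ (λ p q → 1ℤ *ᶻ p +ᶻ q) second top ⟩
      1ℤ *ᶻ lin L′ rest c +ᶻ 0ℤ                   ≡⟨ lemma (lin L′ rest c) ⟩
      lin L′ rest c                               ≡⟨ lin-rest (All.map⁺ offs) c0 ⟩
      lin L′ (coef fs) c ∎
      where
      open ≡-Reasoning
      L₁ = List.map (λ u → a u , φ u) enum
      L = L₁ ++ l
      L′ = List.map (λ (u , y) → -ᶻ lin (form a) (coef es) (f ⊕ u) , y) cr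
      J = join (f ∔ tally cr) c
      lemma : ∀ a → 1ℤ *ᶻ a +ᶻ 0ℤ ≡ a
      lemma = solve-∀
      separate : lin L G ≗ λ d → 1ℤ *ᶻ lin L₁ G d +ᶻ lin l G d
      separate d = lin-++ L₁ G d ∙ cong (_+ᶻ lin l G d) (sym (ℤ.*-identityˡ (lin L₁ G d)))
      degree : total f +ᶻ 1ℤ ≡ + length es +ᶻ 1ℤ
      degree = degree-⊕ f (lin-homogeneous (form a) (coef-homogeneous es)) nz
      second : S (cross cr) (lin L₁ G) J ≡ lin L′ rest c
      second = cross-second {g = lin (form a) (coef es)} {h = rest}
        (lin-cong L₁ G-cong) (lin-cong (form a) (coef-cong es)) (form-split a (enum {U}))
        (lin-homogeneous (form a) (coef-homogeneous es)) offs f c degree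
      -- Here the vanishing of the coefficient at the base exponent removes the uncontrolled terms
      -- on earlier vertices.
      top : S (cross cr) (lin l G) J ≡ 0ℤ
      top = cross-top {g = coef es} {h = lin l rest} (lin-cong l G-cong) (coef-cong es) (lower-split off-l)
        (coef-homogeneous es) offs f c (+ᶻ-cancelʳ 1ℤ (total f) (+ length es) degree)
        ∙ cong (_*ᶻ lin l rest c) f0

  module _ {R : V → V → Set} (R-sym : Symmetric R) {R′ : U → U → Set}
           (R′⇒R : ∀ {u u′} → R′ u u′ → R (φ u) (φ u′)) (R⇒R′ : ∀ {u u′} → R (φ u) (φ u′) → R′ u u′)
           {A B : V → Set} (A-off : ∀ {v} → A v → Off v)
           (A⊆B : ∀ {v} → A v → B v) (φ∈B : ∀ u → B (φ u)) (B-split : ∀ {v} → B v → A v ⊎ ∃ λ u → φ u ≡ v)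
           {es cr fs} (E : EdgeList R′ es) (F : EdgeList (R ↾ A) fs) (cr-unique : Unique cr)
           (cr-sound : ∀ {u y} → (u , y) ∈ₗ cr → R (φ u) y × A y)
           (cr-complete : ∀ {u y} → R (φ u) y → A y → (u , y) ∈ₗ cr)
           where

    offTargets : OffTargets cr
    offTargets = All.tabulate (A-off ∘ proj₂ ∘ cr-sound)

    isOutside : Outside fs
    isOutside = All.tabulate λ m → case sound F (inj₁ m) of λ (_ , p , q) → A-off p , A-off q

    edgeList-extend : EdgeList (R ↾ B) (extend es cr fs)
    edgeList-extend = record { apart = all-apart ; sound = [ snd , ↾-sym ∘ snd ]′ ; complete = cmp }
      where
      ↾-sym : ∀ {x y} → (R ↾ B) x y → (R ↾ B) y x
      ↾-sym (r , p , q) = R-sym r , q , p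

      inner-apart : ∀ {f g} → Apart f g → Apart (Product.map φ φ f) (Product.map φ φ g)
      inner-apart (p , q) =
        (λ h → p (cong₂ _,_ (φ-injective (cong proj₁ h)) (φ-injective (cong proj₂ h)))) ,
        (λ h → q (cong₂ _,_ (φ-injective (cong proj₁ h)) (φ-injective (cong proj₂ h))))

      cross-apart : ∀ {cr} → OffTargets cr → Unique cr → AllPairs Apart (cross cr)
      cross-apart [] [] = []
      cross-apart {(u , y) ∷ cr} (off ∷ offs) (≢s ∷ uq) =
        All.map⁺ (All.zipWith (λ (p , off′) →
          (λ h → p (cong₂ _,_ (φ-injective (cong proj₁ h)) (cong proj₂ h))) ,
          (λ h → off′ u (cong proj₁ h))) (≢s , offs))
        ∷ cross-apart offs uq

      from-block : ∀ u y → All (Apart (φ u , y)) fs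
      from-block u y = All.map (λ (p , q) → (λ h → p u (cong proj₁ h)) , (λ h → q u (cong proj₁ h))) isOutside

      all-apart : AllPairs Apart (extend es cr fs)
      all-apart = AllPairs.++⁺ (AllPairs.map⁺ (AllPairs.map inner-apart (apart E)))
        (AllPairs.++⁺ (cross-apart offTargets cr-unique) (apart F)
          (All.map⁺ (All.tabulate λ {(u , y)} _ → from-block u y)))
        (All.map⁺ (All.tabulate λ {(u , u′)} _ → All.++⁺
          (All.map⁺ (All.map (λ off → (λ h → off u′ (cong proj₂ h)) , (λ h → off u (cong proj₁ h))) offTargets))
          (from-block u (φ u′))))

      snd : ∀ {x y} → (x , y) ∈ₗ extend es cr fs → (R ↾ B) x y
      snd m with ∈ₗ.∈-++⁻ (inner es) m
      ... | inj₁ m′ with (u , u′) , k , refl ← ∈ₗ.∈-map⁻ _ m′ =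
        R′⇒R (sound E (inj₁ k)) , φ∈B u , φ∈B u′
      ... | inj₂ m′ with ∈ₗ.∈-++⁻ (cross cr) m′
      ...   | inj₁ m″ with (u , y) , k , refl ← ∈ₗ.∈-map⁻ _ m″ =
        proj₁ (cr-sound k) , φ∈B u , A⊆B (proj₂ (cr-sound k))
      ...   | inj₂ m″ = case sound F (inj₁ m″) of λ (r , p , q) → r , A⊆B p , A⊆B q

      cross∈ : ∀ {u y} → R (φ u) y → A y → (φ u , y) ∈ₗ extend es cr fs
      cross∈ r q = ∈ₗ.∈-++⁺ʳ (inner es) (∈ₗ.∈-++⁺ˡ (∈ₗ.∈-map⁺ _ (cr-complete r q)))

      cmp : ∀ {x y} → (R ↾ B) x y → Joins (extend es cr fs) x y
      cmp (r , p , q) with B-split p | B-split q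
      ... | inj₁ p′         | inj₁ q′         =
        Sum.map there′ there′ (complete F (r , p′ , q′))
        where
        there′ : ∀ {f} → f ∈ₗ fs → f ∈ₗ extend es cr fs
        there′ = ∈ₗ.∈-++⁺ʳ (inner es) ∘ ∈ₗ.∈-++⁺ʳ (cross cr)
      ... | inj₂ (u , refl) | inj₁ q′         = inj₁ (cross∈ r q′)
      ... | inj₁ p′         | inj₂ (u , refl) = inj₂ (cross∈ (R-sym r) p′)
      ... | inj₂ (u , refl) | inj₂ (u′ , refl) =
        Sum.map lift lift (complete E (R⇒R′ r))
        where
        lift : ∀ {u u′} → (u , u′) ∈ₗ es → (φ u , φ u′) ∈ₗ extend es cr fs
        lift = ∈ₗ.∈-++⁺ˡ ∘ ∈ₗ.∈-map⁺ _

-- Layers along a Hamilton path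

lin-nonzero : ∀ {{_ : Index V}} l {F : Poly V} {c} → lin l F c ≢ 0ℤ → ∃ λ u → F (c ⊖ u) ≢ 0ℤ
lin-nonzero []            nz = contradiction refl nz
lin-nonzero ((a , u) ∷ l) {F} {c} nz with F (c ⊖ u) ℤ.≟ 0ℤ
... | no ¬p = u , ¬p
... | yes p = lin-nonzero l λ q → nz (cong₂ (λ x y → a *ᶻ x +ᶻ y) p q ∙ cong (_+ᶻ 0ℤ) (ℤ.*-zeroʳ a))

-- Some term of the nonzero entry is nonzero, which lowers a vertex `u` of `c ⊕ v`. Lowering `u`
-- first keeps the bound d for everything but the unit at `v`.
robust⇒coef : ∀ {{_ : Index V}} {d} {es : List (V × V)} → Robust d es → ∃ (NonConstant {V}) → ∃ λ (c : Exponent V) →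
  (∀ v → 0ℤ ≤ᶻ c v) × (∀ v → c v ≤ᶻ + d) × ∃ λ v → coef es (c ⊕ v) ≢ 0ℤ
robust⇒coef {es = es} robust (a , nonconstant)
  with c , c≥0 , c≤d , c∉ , v , nz ← robust a nonconstant
  with u , nz′ ← lin-nonzero (form a) {coef es} {c ⊕ v} nz =
  c ⊖ u , lower≥0 , (λ w → ℤ.≤-trans (⊖-≤ c u w) (c≤d w)) , v , λ h → nz′ (coef-cong es (⊕⊖-comm c v u) ∙ h)
  where
  -- Lowering `v` itself would return to `c`, where the coefficient vanishes.
  u≢v : u ≢ v
  u≢v refl = nz′ (coef-cong es (⊕⊖-cancel c u) ∙ c∉)
  lower≥0 : ∀ w → 0ℤ ≤ᶻ (c ⊖ u) w
  lower≥0 w with w ≟ u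
  ... | no w≢u   = subst (0ℤ ≤ᶻ_) (sym (⊖-at-other c w≢u)) (c≥0 w)
  ... | yes refl = subst (0ℤ ≤ᶻ_) (cong (_-ᶻ e w w) (cong (c w +ᶻ_) (e-diff u≢v) ∙ ℤ.+-identityʳ (c w)))
                     (coef-nonnegative es {c ⊕ v ⊖ u} nz′ w)

-- This produces a form where none is given yet: without a linear factor the derivative of the graph
-- polynomial vanishes at every exponent.
robust⇒nonConstant : ∀ {{_ : Index V}} {d} {es : List (V × V)} → Robust d es → ∃ (NonConstant {V}) → ∃ λ (c : Exponent V) →
  (∀ v → 0ℤ ≤ᶻ c v) × (∀ v → c v ≤ᶻ + d) × ∃ (λ v → coef es (c ⊕ v) ≢ 0ℤ) ×
  NonConstant (λ v → coef es (c ⊕ v))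
robust⇒nonConstant {es = es} robust nonconstant
  with c , c≥0 , c≤d , v , nz ← robust⇒coef {es = es} robust nonconstant =
  c , c≥0 , c≤d , (v , nz) , ∂-nonConstant {F = coef es} c≥0 (∂-coef es c) nz

nonConstant-neg : ∀ {{_ : Index V}} {a : V → ℤ} → NonConstant a → NonConstant (λ v → -ᶻ a v)
nonConstant-neg (s , t , s≢t) = s , t , s≢t ∘ ℤ.neg-injective

e-sym : ∀ {{_ : Index V}} (u v : V) → e u v ≡ e v u
e-sym u v with u ≟ v
... | yes refl = refl
... | no u≢v   = e-diff (λ { refl → u≢v refl }) ∙ sym (e-diff u≢v)

module Layers {{_ : Index U}} {p : ℕ} {R′ : U → U → Set} (R′-sym : Symmetric R′)
              {Q : Fin (suc (suc p)) → Fin (suc (suc p)) → Set} (Q-sym : Symmetric Q)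
              (Q-irrefl : ∀ {i} → ¬ Q i i)
              (back : Fin (suc p) → List (Fin (suc (suc p))))
              (back-unique : ∀ i → Unique (Fin.inject₁ i ∷ back i))
              (back-sound : ∀ i {j} → j ∈ₗ Fin.inject₁ i ∷ back i → Q (suc i) j × toℕ j ≤ toℕ i)
              (back-complete : ∀ i {j} → Q (suc i) j → toℕ j ≤ toℕ i → j ∈ₗ Fin.inject₁ i ∷ back i)
              {k : ℕ} (back-length : ∀ i → suc (length (back i)) ≤ k)
              {d : ℕ} {es : List (U × U)} (E : EdgeList R′ es) (robust : Robust d es)
              where

  W : Set
  W = U × Fin (suc (suc p))

  R : W → W → Set
  R (u , i) (v , j) = (u ≡ v × Q i j) ⊎ (i ≡ j × R′ u v)

  R-sym : Symmetric R
  R-sym = Sum.map (Product.map sym Q-sym) (Product.map sym R′-sym)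

  UpTo : Fin (suc (suc p)) → W → Set
  UpTo i (v , j) = toℕ j ≤ toℕ i

  layer : Fin (suc (suc p)) → U → W
  layer i u = u , i

  Bounded : Exponent W → Set
  Bounded c = (∀ v → 0ℤ ≤ᶻ c v) × (∀ v → c v ≤ᶻ + (d + k))

  -- The form is arbitrary on layers before `i` because a vertex can have several earlier
  -- neighbours, and peeling leaves terms on all their layers. Only the leading part on layer `i` is
  -- controlled.
  record Upto (i : Fin (suc (suc p))) : Set where
    field
      {edges} : List (W × W)
      edgeList : EdgeList (R ↾ UpTo i) edges
      resist : ∀ a → NonConstant a → ∀ l → All (λ (_ , (_ , j)) → toℕ j < toℕ i) l → ∃ λ c →
        Bounded c × (∀ v → ¬ UpTo i v → c v ≡ 0ℤ) ×
        lin (List.map (λ u → a u , layer i u) enum ++ l) (coef edges) c ≢ 0ℤ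

  layer-injective : ∀ {i u v} → layer i u ≡ layer i v → u ≡ v
  layer-injective = cong proj₁

  open module Layer (i : Fin (suc (suc p))) = Block (layer i) layer-injective

  row : Fin (suc (suc p)) → List (U × W)
  row j = List.map (λ u → u , layer j u) enum

  rows : List (Fin (suc (suc p))) → List (U × W)
  rows = concatMap row

  -- Two adjacent layers are joined by a perfect matching, so each row adds one unit at every
  -- vertex.
  tally-rows : ∀ i js u → tally i (rows js) u ≡ + length js
  tally-rows i []       u = refl
  tally-rows i (j ∷ js) u = go enum ∙ cong₂ _+ᶻ_ (Σ-e-∈ enum-unique (enum-complete u)) (tally-rows i js u)
    where
    go : ∀ us → tally i (List.map (λ u → u , layer j u) us ++ rows js) u ≡ Σ[ us ] (e u) +ᶻ tally i (rows js) u
    go []       = sym (ℤ.+-identityˡ _)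
    go (w ∷ us) = cong₂ _+ᶻ_ (go us) (e-sym w u) ∙ lemma (Σ[ us ] (e u)) _ _
      where
      lemma : ∀ a b c → a +ᶻ b +ᶻ c ≡ c +ᶻ a +ᶻ b
      lemma = solve-∀

  ∈-rows⁺ : ∀ {u j js} → j ∈ₗ js → (u , layer j u) ∈ₗ rows js
  ∈-rows⁺ {u} j∈ = ∈ₗ.∈-concatMap⁺ row (Any.map (λ { refl → ∈ₗ.∈-map⁺ _ (enum-complete u) }) j∈)

  ∈-rows⁻ : ∀ {u v j} js → (u , (v , j)) ∈ₗ rows js → v ≡ u × j ∈ₗ js
  ∈-rows⁻ js m with i , i∈ , m′ ← ∈ₗ.find (∈ₗ.∈-concatMap⁻ row {xs = js} m)
    with _ , _ , refl ← ∈ₗ.∈-map⁻ _ m′ = refl , i∈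

  rows-unique : ∀ {js} → Unique js → Unique (rows js)
  rows-unique [] = []
  rows-unique {j ∷ js} (j∉ ∷ uq) = Unique.++⁺
    (Unique.map⁺ (λ { refl → refl }) enum-unique) (rows-unique uq)
    λ (m , m′) → case ∈ₗ.∈-map⁻ _ m of λ { (_ , _ , refl) → All.lookup j∉ (proj₂ (∈-rows⁻ js m′)) refl }

  neighbours : Fin (suc p) → List (U × W)
  neighbours i = rows (Fin.inject₁ i ∷ back i)

  private
    toℕ-pred : (i : Fin (suc p)) → toℕ (Fin.inject₁ i) ≡ toℕ i
    toℕ-pred = Fin.toℕ-inject₁

  -- The leading part, on the preceding layer of the path, is split off.
  passed-on : ∀ i (b : U → ℤ) → List.map (λ (u , y) → -ᶻ b u , y) (neighbours i) ≡
    List.map (λ u → -ᶻ b u , layer (Fin.inject₁ i) u) enum ++ List.map (λ (u , y) → -ᶻ b u , y) (rows (back i))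
  passed-on i b = List.map-++ _ (row (Fin.inject₁ i)) (rows (back i))
    ∙ cong (_++ List.map (λ (u , y) → -ᶻ b u , y) (rows (back i))) (sym (List.map-∘ enum))

  passed-on-lower : ∀ i (b : U → ℤ) → All (λ (_ , (_ , j)) → toℕ j < toℕ (Fin.inject₁ i))
                    (List.map (λ (u , y) → -ᶻ b u , y) (rows (back i)))
  passed-on-lower i b = All.map⁺ (All.tabulate λ {(u , (v , j))} m →
    let j∈ = proj₂ (∈-rows⁻ (back i) m) in
    ℕ.≤∧≢⇒< (subst (toℕ j ≤_) (sym (toℕ-pred i)) (proj₂ (back-sound i (there j∈))))
      λ eq → case back-unique i of λ { (≢s ∷ _) → All.lookup ≢s j∈ (sym (Fin.toℕ-injective eq)) })

  redirect : (U → ℤ) → List (U × W) → List (ℤ × W)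
  redirect b = List.map λ (u , y) → -ᶻ b u , y

  resist-neighbours : ∀ i (P : Upto (Fin.inject₁ i)) b → NonConstant b → ∃ λ c →
    Bounded c × (∀ v → ¬ UpTo (Fin.inject₁ i) v → c v ≡ 0ℤ) ×
    lin (redirect b (neighbours i)) (coef (Upto.edges P)) c ≢ 0ℤ
  resist-neighbours i P b nonconstant =
    subst (λ l → ∃ λ c → Bounded c × (∀ v → ¬ UpTo (Fin.inject₁ i) v → c v ≡ 0ℤ) × lin l (coef (Upto.edges P)) c ≢ 0ℤ)
      (sym (passed-on i b))
      (Upto.resist P (λ u → -ᶻ b u) (nonConstant-neg {a = b} nonconstant) _ (passed-on-lower i b))

  module Extend (i : Fin (suc p)) {fs} (F : EdgeList (R ↾ UpTo (Fin.inject₁ i)) fs) where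

    older-off : ∀ {v} → UpTo (Fin.inject₁ i) v → Off (suc i) v
    older-off le u refl = ℕ.<-irrefl refl (subst (suc (toℕ i) ≤_) (toℕ-pred i) le)

    cross-sound : ∀ {u y} → (u , y) ∈ₗ neighbours i → R (layer (suc i) u) y × UpTo (Fin.inject₁ i) y
    cross-sound {u} {v , j} m with refl , j∈ ← ∈-rows⁻ (Fin.inject₁ i ∷ back i) m
      with q , le ← back-sound i j∈ = inj₁ (refl , q) , subst (toℕ j ≤_) (sym (toℕ-pred i)) le

    cross-complete : ∀ {u y} → R (layer (suc i) u) y → UpTo (Fin.inject₁ i) y → (u , y) ∈ₗ neighbours i
    cross-complete {u} (inj₁ (refl , q)) le = ∈-rows⁺ (back-complete i q (subst (_ ≤_) (toℕ-pred i) le))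
    cross-complete {u} (inj₂ (refl , _)) le = ⊥-elim (older-off le u refl)

    split : ∀ {v} → UpTo (suc i) v → UpTo (Fin.inject₁ i) v ⊎ ∃ λ u → layer (suc i) u ≡ v
    split {v , j} le with ℕ.m≤n⇒m<n∨m≡n le
    ... | inj₁ (s≤s lt) = inj₁ (subst (toℕ j ≤_) (sym (toℕ-pred i)) lt)
    ... | inj₂ eq       = inj₂ (v , cong (v ,_) (sym (Fin.toℕ-injective eq)))

    next : List (W × W)
    next = extend (suc i) es (neighbours i) fs

    private
      module X = Layer (suc i)

    nextEdgeList : EdgeList (R ↾ UpTo (suc i)) next
    nextEdgeList = X.edgeList-extend R-sym (λ r → inj₂ (refl , r))
      (λ { (inj₁ (_ , q)) → ⊥-elim (Q-irrefl q) ; (inj₂ (_ , r)) → r })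
      older-off (λ {v} le → ℕ.m≤n⇒m≤1+n (subst (toℕ (proj₂ v) ≤_) (toℕ-pred i) le)) (λ _ → ℕ.≤-refl) split
      E F (rows-unique (back-unique i)) cross-sound cross-complete

    offs : X.OffTargets (neighbours i)
    offs = All.tabulate (older-off ∘ proj₂ ∘ cross-sound)

    out : X.Outside fs
    out = All.tabulate λ m → case sound F (inj₁ m) of λ (_ , p , q) → older-off p , older-off q

    glue : Exponent U → Exponent W → Exponent W
    glue f = X.join (f ∔ X.tally (neighbours i))

    -- A vertex of the new layer receives at most d from `f` and one unit for each of its at most k
    -- earlier neighbours.
    glue-bounded : ∀ f c → (∀ v → 0ℤ ≤ᶻ f v) → (∀ v → f v ≤ᶻ + d) → Bounded c → Bounded (glue f c)
    glue-bounded f c f≥0 f≤d (c≥0 , c≤) = lower , upper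
      where
      on-layer : ∀ u → glue f c (layer (suc i) u) ≡ f u +ᶻ + suc (length (back i))
      on-layer u = X.join-in _ c refl ∙ cong (f u +ᶻ_) (tally-rows (suc i) (Fin.inject₁ i ∷ back i) u)
      lower : ∀ v → 0ℤ ≤ᶻ glue f c v
      lower v with X.image? v
      ... | inj₂ off        = subst (0ℤ ≤ᶻ_) (sym (X.join-out _ c off)) (c≥0 v)
      ... | inj₁ (u , refl) = subst (0ℤ ≤ᶻ_) (sym (on-layer u)) (ℤ.+-mono-≤ (f≥0 u) (ℤ.+≤+ z≤n))
      upper : ∀ v → glue f c v ≤ᶻ + (d + k)
      upper v with X.image? v
      ... | inj₂ off        = subst (_≤ᶻ + (d + k)) (sym (X.join-out _ c off)) (c≤ v)
      ... | inj₁ (u , refl) = subst (_≤ᶻ + (d + k)) (sym (on-layer u))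
                                (ℤ.+-mono-≤ (f≤d u) (ℤ.+≤+ (back-length i)))

    glue-vanishes : ∀ f (c : Exponent W) → (∀ v → ¬ UpTo (Fin.inject₁ i) v → c v ≡ 0ℤ) →
                    ∀ v → ¬ UpTo (suc i) v → glue f c v ≡ 0ℤ
    glue-vanishes f c c0 v ¬le with X.image? v
    ... | inj₁ (u , refl) = ⊥-elim (¬le ℕ.≤-refl)
    ... | inj₂ off        = X.join-out _ c off ∙
      c0 v λ le → ¬le (ℕ.m≤n⇒m≤1+n (subst (toℕ (proj₂ v) ≤_) (toℕ-pred i) le))

    vanishes-here : ∀ (c : Exponent W) → (∀ v → ¬ UpTo (Fin.inject₁ i) v → c v ≡ 0ℤ) → ∀ u → c (layer (suc i) u) ≡ 0ℤ
    vanishes-here c c0 u = c0 _ λ le → older-off le u refl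

  -- With no earlier layer to pass the form on to, the extra unit at `v` stays in the exponent, and
  -- the nonzero entry of `robust` is the required coefficient.
  first : Upto zero
  first = record { edgeList = firstEdgeList ; resist = resist }
    where
    module X = Layer zero
    fs = X.extend es [] []
    firstEdgeList : EdgeList (R ↾ UpTo zero) fs
    firstEdgeList = X.edgeList-extend R-sym (λ r → inj₂ (refl , r))
      (λ { (inj₁ (_ , q)) → ⊥-elim (Q-irrefl q) ; (inj₂ (_ , r)) → r }) {A = λ _ → ⊥} (λ ()) (λ ()) (λ _ → z≤n)
      (λ { {v , zero} _ → inj₂ (v , refl) ; {v , suc j} () })
      E (record { apart = [] ; sound = λ { (inj₁ ()) ; (inj₂ ()) } ; complete = λ () }) [] (λ ()) (λ _ ())
    -- The second vertex of the path has the first as an earlier neighbour. This pays for the unit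
    -- at `v`, since d + 1 ≤ d + k.
    k>0 : 1 ≤ k
    k>0 = ℕ.≤-trans (s≤s z≤n) (back-length zero)
    resist : ∀ a → NonConstant a → ∀ l → All (λ (_ , (_ , j)) → toℕ j < 0) l → ∃ λ c →
      Bounded c × (∀ v → ¬ UpTo zero v → c v ≡ 0ℤ) ×
      lin (List.map (λ u → a u , layer zero u) enum ++ l) (coef fs) c ≢ 0ℤ
    resist a nonconstant (_ ∷ _) (() ∷ _)
    resist a nonconstant [] [] with f , f≥0 , f≤d , _ , v , nz ← robust a nonconstant =
      c , (lower , upper) , vanish , nonzero
      where
      c = X.join (f ⊕ v ∔ X.tally []) 0̂
      on-layer : ∀ u → c (layer zero u) ≡ (f ⊕ v) u
      on-layer u = X.join-in _ 0̂ refl ∙ ℤ.+-identityʳ _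
      f⊕v≤ : ∀ u → (f ⊕ v) u ≤ᶻ + (d + k)
      f⊕v≤ u = ℤ.≤-trans (ℤ.+-mono-≤ (f≤d u) (e≤1 v u)) (ℤ.+≤+ (ℕ.+-monoʳ-≤ d k>0))
      lower : ∀ w → 0ℤ ≤ᶻ c w
      lower (u , zero)  = subst (0ℤ ≤ᶻ_) (sym (on-layer u)) (ℤ.+-mono-≤ (f≥0 u) (e≥0 v u))
      lower (u , suc j) = ℤ.≤-reflexive (sym (X.join-out _ 0̂ λ _ ()))
      upper : ∀ w → c w ≤ᶻ + (d + k)
      upper (u , zero)  = subst (_≤ᶻ + (d + k)) (sym (on-layer u)) (f⊕v≤ u)
      upper (u , suc j) = subst (_≤ᶻ + (d + k)) (sym (X.join-out _ 0̂ λ _ ())) (ℤ.+≤+ z≤n)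
      vanish : ∀ w → ¬ UpTo zero w → c w ≡ 0ℤ
      vanish (u , zero)  ¬le = ⊥-elim (¬le z≤n)
      vanish (u , suc j) _   = X.join-out _ 0̂ λ _ ()
      nonzero : lin (List.map (λ u → a u , layer zero u) enum ++ []) (coef fs) c ≢ 0ℤ
      nonzero rewrite List.++-identityʳ (List.map (λ u → a u , layer zero u) (enum {U})) = λ h →
        nz (sym (ℤ.*-identityʳ _) ∙ cong (lin (form a) (coef es) (f ⊕ v) *ᶻ_) (sym (δ-zero λ _ → refl))
            ∙ sym (X.lin-block {es = es} [] [] a {f ⊕ v} {0̂} nz (λ _ → refl)) ∙ h)

  -- The entries at `f ⊕ u`, as a function of `u`, are nonconstant by `∂-nonConstant`; negated, they
  -- are the form on the preceding layer, to which the hypothesis applies.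
  step : ∀ i → Upto (Fin.inject₁ i) → Upto (suc i)
  step i P = record { edgeList = nextEdgeList ; resist = resist }
    where
    open Upto P using () renaming (edgeList to F)
    open Extend i F
    module X = Layer (suc i)
    resist : ∀ a → NonConstant a → ∀ l → All (λ (_ , (_ , j)) → toℕ j < suc (toℕ i)) l → ∃ λ c →
      Bounded c × (∀ v → ¬ UpTo (suc i) v → c v ≡ 0ℤ) ×
      lin (List.map (λ u → a u , layer (suc i) u) enum ++ l) (coef next) c ≢ 0ℤ
    resist a nonconstant l l-lower with f , f≥0 , f≤d , f∉ , v , nz ← robust a nonconstant
      with c , bounded , c0 , nz′ ← resist-neighbours i P (λ u → lin (form a) (coef es) (f ⊕ u))
                                      (∂-nonConstant {F = lin (form a) (coef es)} {v = v} f≥0 (∂-lin (form a) es f f∉) nz) =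
      glue f c , glue-bounded f c f≥0 f≤d bounded , glue-vanishes f c c0 , λ h →
        nz′ (sym (X.lin-deficient {es = es} offs out a l {f} {c} {v}
               (All.map (λ lt u → λ { refl → ℕ.<-irrefl refl lt }) l-lower) f∉ nz (vanishes-here c c0)) ∙ h)

  -- On this layer the polynomial itself, one unit short of its degree, creates the first linear
  -- form.
  last-step : ∃ (NonConstant {U}) → Upto (Fin.inject₁ (Fin.fromℕ p)) →
              ∃ λ fs → EdgeList R fs × ∃ λ c → Bounded c × coef fs c ≢ 0ℤ
  last-step nonconstant P with f , f≥0 , f≤d , (v , nz) , nonconstant′ ← robust⇒nonConstant {es = es} robust nonconstant
    with c , bounded , c0 , nz′ ← resist-neighbours (Fin.fromℕ p) P (λ u → coef es (f ⊕ u)) nonconstant′ =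
    next , record { apart = apart nextEdgeList ; sound = proj₁ ∘ sound nextEdgeList ; complete = cmp }
    , glue f c , glue-bounded f c f≥0 f≤d bounded , λ h →
        nz′ (sym (X.coef-deficient {es = es} offs out {f} {c} {v} nz (vanishes-here c c0)) ∙ h)
    where
    last : Fin (suc p)
    last = Fin.fromℕ p
    open Upto P using () renaming (edgeList to F)
    open Extend last F
    module X = Layer (suc last)
    le : ∀ v → UpTo (suc last) v
    le (v , j) = subst (toℕ j ≤_) (cong suc (sym (Fin.toℕ-fromℕ p))) (Fin.toℕ≤pred[n] j)
    cmp : ∀ {x y} → R x y → Joins next x y
    cmp {x} {y} r = complete nextEdgeList (r , le x , le y)

  result : ∃ (NonConstant {U}) → ∃ λ fs → EdgeList R fs × ∃ λ c → Bounded c × coef fs c ≢ 0ℤ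
  result nonconstant =
    last-step nonconstant (Fin.<-weakInduction Upto first step (Fin.inject₁ (Fin.fromℕ p)))

-- Signed counting of circulations

Σ-++ : ∀ (xs : List V) {ys} f → Σ[ xs ++ ys ] f ≡ Σ[ xs ] f +ᶻ Σ[ ys ] f
Σ-++ []       f = sym (ℤ.+-identityˡ _)
Σ-++ (x ∷ xs) f = cong (f x +ᶻ_) (Σ-++ xs f) ∙ sym (ℤ.+-assoc (f x) _ _)

Σ-map : ∀ (g : U → V) xs f → Σ[ List.map g xs ] f ≡ Σ[ xs ] (f ∘ g)
Σ-map g []       f = refl
Σ-map g (x ∷ xs) f = cong (f (g x) +ᶻ_) (Σ-map g xs f)

Σ-cartesianProductWith : ∀ {A B C : Set} (g : A → B → C) xs ys f →
  Σ[ List.cartesianProductWith g xs ys ] f ≡ Σ[ xs ] λ x → Σ[ ys ] λ y → f (g x y)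
Σ-cartesianProductWith g []       ys f = refl
Σ-cartesianProductWith g (x ∷ xs) ys f =
  Σ-++ (List.map (g x) ys) f ∙ cong₂ _+ᶻ_ (Σ-map (g x) ys f) (Σ-cartesianProductWith g xs ys f)

sgn : ℕ → ℤ
sgn zero    = 1ℤ
sgn (suc n) = -ᶻ sgn n

sgn-+ : ∀ m n → sgn (m + n) ≡ sgn m *ᶻ sgn n
sgn-+ zero    n = sym (ℤ.*-identityˡ _)
sgn-+ (suc m) n = cong -ᶻ_ (sgn-+ m n) ∙ ℤ.neg-distribˡ-* (sgn m) (sgn n)

sgn-even : ∀ n → 2 ∣ n → sgn n ≡ 1ℤ
sgn-even zero          _ = refl
sgn-even (suc zero)    (divides zero ())
sgn-even (suc zero)    (divides (suc q) ())
sgn-even (suc (suc n)) (divides (suc q) eq) =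
  ℤ.neg-involutive (sgn n) ∙ sgn-even n (divides q (ℕ.suc-injective (ℕ.suc-injective eq)))

sgn-odd : ∀ n → 2 ∤ n → sgn n ≡ -1ℤ
sgn-odd zero          odd = contradiction (divides 0 refl) odd
sgn-odd (suc zero)    odd = refl
sgn-odd (suc (suc n)) odd = ℤ.neg-involutive (sgn n) ∙
  sgn-odd n λ { (divides q eq) → odd (divides (suc q) (cong (λ m → suc (suc m)) eq)) }

bit : Bool → ℤ
bit inside  = 1ℤ
bit outside = 0ℤ

∣∷∣ : ∀ {n} b (r : Subset n) → + ∣ b ∷ r ∣ ≡ bit b +ᶻ + ∣ r ∣
∣∷∣ inside  r = refl
∣∷∣ outside r = sym (ℤ.+-identityˡ _)

-- The indicator of inclusion, computed entry by entry so that the sum over all subdigraphs can be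
-- expanded one arc at a time.
rowWithin : ∀ {n} → Subset n → Subset n → ℤ
rowWithin []            []            = 1ℤ
rowWithin (inside  ∷ p) (outside ∷ q) = 0ℤ
rowWithin (inside  ∷ p) (inside  ∷ q) = rowWithin p q
rowWithin (outside ∷ p) (_       ∷ q) = rowWithin p q

rowWithin-yes : ∀ {n} (p q : Subset n) → p ⊆ q → rowWithin p q ≡ 1ℤ
rowWithin-yes []            []            p⊆q = refl
rowWithin-yes (inside  ∷ p) (inside  ∷ q) p⊆q = rowWithin-yes p q (Subset.drop-∷-⊆ p⊆q)
rowWithin-yes (inside  ∷ p) (outside ∷ q) p⊆q with () ← p⊆q Vec.here
rowWithin-yes (outside ∷ p) (_       ∷ q) p⊆q = rowWithin-yes p q (Subset.drop-∷-⊆ p⊆q)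

rowWithin-no : ∀ {n} (p q : Subset n) → ¬ p ⊆ q → rowWithin p q ≡ 0ℤ
rowWithin-no []            []            p⊈q = contradiction (λ ()) p⊈q
rowWithin-no (inside  ∷ p) (inside  ∷ q) p⊈q = rowWithin-no p q (λ h → p⊈q (Subset.in⊆in h))
rowWithin-no (inside  ∷ p) (outside ∷ q) p⊈q = refl
rowWithin-no (outside ∷ p) (_       ∷ q) p⊈q = rowWithin-no p q (λ h → p⊈q (Subset.out⊆ h))

within : ∀ {m n} → Vec (Subset n) m → Vec (Subset n) m → ℤ
within []      []      = 1ℤ
within (p ∷ P) (q ∷ Q) = rowWithin p q *ᶻ within P Q

within-yes : ∀ {m n} (P Q : Vec (Subset n) m) → (∀ v → lookup P v ⊆ lookup Q v) → within P Q ≡ 1ℤ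
within-yes []      []      P⊆Q = refl
within-yes (p ∷ P) (q ∷ Q) P⊆Q = cong₂ _*ᶻ_ (rowWithin-yes p q (P⊆Q zero)) (within-yes P Q (P⊆Q ∘ suc))

within-no : ∀ {m n} (P Q : Vec (Subset n) m) → ¬ (∀ v → lookup P v ⊆ lookup Q v) → within P Q ≡ 0ℤ
within-no []      []      P⊈Q = contradiction (λ ()) P⊈Q
within-no (p ∷ P) (q ∷ Q) P⊈Q with p ⊆? q
... | no p⊈q  = cong (_*ᶻ within P Q) (rowWithin-no p q p⊈q)
... | yes p⊆q = cong (rowWithin p q *ᶻ_) (within-no P Q λ h → P⊈Q λ { zero → p⊆q ; (suc v) → h v })
                ∙ ℤ.*-zeroʳ (rowWithin p q)

module _ {{_ : Index V}} where

  -- The pair (x , y) stands for an arc with head x and tail y.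
  rowArcs : ∀ {m} → (Fin m → V × V) → Subset m → List (V × V)
  rowArcs g []            = []
  rowArcs g (inside  ∷ r) = g zero ∷ rowArcs (g ∘ suc) r
  rowArcs g (outside ∷ r) = rowArcs (g ∘ suc) r

  arcs : ∀ {m n} → (Fin m → Fin n → V × V) → Vec (Subset n) m → List (V × V)
  arcs g []      = []
  arcs g (r ∷ D) = rowArcs (g zero) r ++ arcs (g ∘ suc) D

  -- Adds indegree minus outdegree. The accumulator form follows the expansion of a product of
  -- quotients y/x, where each chosen factor shifts the exponent once.
  push : List (V × V) → Exponent V → Exponent V
  push []             c = c
  push ((x , y) ∷ es) c = push es (c ⊕ x ⊖ y)

  push-++ : ∀ es {fs} c → push (es ++ fs) c ≡ push fs (push es c)
  push-++ []             c = refl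
  push-++ ((x , y) ∷ es) c = push-++ es (c ⊕ x ⊖ y)

  tails : List (V × V) → Exponent V
  tails []             u = 0ℤ
  tails ((x , y) ∷ es) u = tails es u +ᶻ e y u

  push-value : ∀ es c v → push es c v ≡ c v +ᶻ (heads es v -ᶻ tails es v)
  push-value []             c v = sym (ℤ.+-identityʳ (c v))
  push-value ((x , y) ∷ es) c v = push-value es (c ⊕ x ⊖ y) v ∙ lemma (c v) (e x v) (e y v) (heads es v) (tails es v)
    where
    lemma : ∀ c x y h t → c +ᶻ x -ᶻ y +ᶻ (h -ᶻ t) ≡ c +ᶻ (h +ᶻ x -ᶻ (t +ᶻ y))
    lemma = solve-∀

  heads-++ : ∀ (es fs : List (V × V)) → heads (es ++ fs) ≗ heads fs ∔ heads es
  heads-++ []             fs v = sym (ℤ.+-identityʳ _)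
  heads-++ ((x , y) ∷ es) fs v = cong (_+ᶻ e x v) (heads-++ es fs v) ∙ ℤ.+-assoc (heads fs v) _ _

  tails-++ : ∀ (es fs : List (V × V)) → tails (es ++ fs) ≗ tails fs ∔ tails es
  tails-++ []             fs v = sym (ℤ.+-identityʳ _)
  tails-++ ((x , y) ∷ es) fs v = cong (_+ᶻ e y v) (tails-++ es fs v) ∙ ℤ.+-assoc (tails fs v) _ _

  S-translate : ∀ (es : List (V × V)) {F} → Congruent F → ∀ (h c : Exponent V) → S es (λ d → F (d ∔ h)) c ≡ S es F (c ∔ h)
  S-translate []             F-cong h c = refl
  S-translate ((x , y) ∷ es) F-cong h c = cong₂ _-ᶻ_ (step x) (step y)
    where
    lemma : ∀ a b c → a -ᶻ b +ᶻ c ≡ a +ᶻ c -ᶻ b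
    lemma = solve-∀
    step : ∀ u → S es _ (c ⊖ u) ≡ _
    step u = S-translate es F-cong h (c ⊖ u) ∙ S-cong es F-cong (λ w → lemma (c w) (e u w) (h w))

  private
    -- Dividing by the monomial of heads turns x - y into 1 - y/x: the first choice leaves `c`
    -- unchanged, the second moves one unit from y to x.
    S-heads-cons : ∀ (x y : V) es {F} → Congruent F → ∀ (c : Exponent V) →
      S ((x , y) ∷ es) F (c ∔ heads ((x , y) ∷ es)) ≡
      S es F (c ∔ heads es) -ᶻ S es F (c ⊕ x ⊖ y ∔ heads es)
    S-heads-cons x y es F-cong c = cong₂ _-ᶻ_
      (S-cong es F-cong λ w → lemma₁ (c w) (heads es w) (e x w))
      (S-cong es F-cong λ w → lemma₂ (c w) (heads es w) (e x w) (e y w))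
      where
      lemma₁ : ∀ c h x → c +ᶻ (h +ᶻ x) -ᶻ x ≡ c +ᶻ h
      lemma₁ = solve-∀
      lemma₂ : ∀ c h x y → c +ᶻ (h +ᶻ x) -ᶻ y ≡ c +ᶻ x -ᶻ y +ᶻ h
      lemma₂ = solve-∀

  bits : List Bool
  bits = inside ∷ outside ∷ []

  -- Expands the product of 1 - y/x over the arcs of `q`; the set `p` consists of the arcs for which
  -- -y/x is chosen, which explains the sign and the shift.
  rowSum : ∀ {m} (g : Fin m → V × V) (q : Subset m) {F} → Congruent F → ∀ c →
    Σ[ vectors bits m ] (λ p → rowWithin p q *ᶻ (sgn ∣ p ∣ *ᶻ F (push (rowArcs g p) c))) ≡
    S (rowArcs g q) F (c ∔ heads (rowArcs g q))
  rowSum {zero} g [] {F} F-cong c =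
    lemma (F c) ∙ F-cong (λ w → sym (ℤ.+-identityʳ (c w)))
    where
    lemma : ∀ a → 1ℤ *ᶻ (1ℤ *ᶻ a) +ᶻ 0ℤ ≡ a
    lemma = solve-∀
  rowSum {suc m} g (outside ∷ q) {F} F-cong c =
    Σ-cartesianProductWith _∷_ bits (vectors bits m) _
    ∙ cong₂ (λ a b → a +ᶻ (b +ᶻ 0ℤ)) (Σ-zero (vectors bits m) (λ _ _ → refl)) (rowSum (g ∘ suc) q F-cong c)
    ∙ lemma (S (rowArcs (g ∘ suc) q) F (c ∔ heads (rowArcs (g ∘ suc) q)))
    where
    lemma : ∀ a → 0ℤ +ᶻ (a +ᶻ 0ℤ) ≡ a
    lemma = solve-∀
  rowSum {suc m} g (inside ∷ q) {F} F-cong c =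
    Σ-cartesianProductWith _∷_ bits (vectors bits m) _
    ∙ cong₂ (λ a b → a +ᶻ (b +ᶻ 0ℤ))
        (Σ-cong (vectors bits m) (λ p → neg (rowWithin p q) (sgn ∣ p ∣) (F (push (rowArcs (g ∘ suc) p) (c ⊕ x ⊖ y))))
         ∙ Σ-*ˡ (vectors bits m) -1ℤ _ ∙ cong (-1ℤ *ᶻ_) (rowSum (g ∘ suc) q F-cong (c ⊕ x ⊖ y)))
        (rowSum (g ∘ suc) q F-cong c)
    ∙ lemma (S tail F (c ⊕ x ⊖ y ∔ heads tail)) (S tail F (c ∔ heads tail))
    ∙ sym (S-heads-cons x y tail F-cong c)
    where
    x = proj₁ (g zero)
    y = proj₂ (g zero)
    tail = rowArcs (g ∘ suc) q
    neg : ∀ a s f → a *ᶻ ((-ᶻ s) *ᶻ f) ≡ -1ℤ *ᶻ (a *ᶻ (s *ᶻ f))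
    neg = solve-∀
    lemma : ∀ a b → -1ℤ *ᶻ a +ᶻ (b +ᶻ 0ℤ) ≡ b -ᶻ a
    lemma = solve-∀

  sizeOf : ∀ {m n} → Vec (Subset n) m → ℕ
  sizeOf E = Vec.sum (Vec.map ∣_∣ E)

  -- The expansion over the later rows is itself a polynomial `H`, to which `rowSum` for the first
  -- row applies.
  matrixSum : ∀ {m n} (g : Fin m → Fin n → V × V) (D : Vec (Subset n) m) {F} → Congruent F → ∀ c →
    Σ[ vectors (vectors bits n) m ] (λ E → within E D *ᶻ (sgn (sizeOf E) *ᶻ F (push (arcs g E) c))) ≡
    S (arcs g D) F (c ∔ heads (arcs g D))
  matrixSum g [] {F} F-cong c = lemma (F c) ∙ F-cong (λ w → sym (ℤ.+-identityʳ (c w)))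
    where
    lemma : ∀ a → 1ℤ *ᶻ (1ℤ *ᶻ a) +ᶻ 0ℤ ≡ a
    lemma = solve-∀
  matrixSum {suc m} {n} g (q ∷ D) {F} F-cong c = begin
    Σ[ vectors rows (suc m) ] (λ E → within E (q ∷ D) *ᶻ (sgn (sizeOf E) *ᶻ F (push (arcs g E) c)))
      ≡⟨ Σ-cartesianProductWith _∷_ rows (vectors rows m) _ ⟩
    Σ[ rows ] (λ p → Σ[ vectors rows m ] λ E →
      rowWithin p q *ᶻ within E D *ᶻ (sgn (∣ p ∣ + sizeOf E) *ᶻ F (push (rowArcs (g zero) p ++ arcs (g ∘ suc) E) c)))
      ≡⟨ Σ-cong rows (λ p → Σ-cong (vectors rows m) (λ E → regroup p E) ∙ Σ-*ˡ (vectors rows m) (rowWithin p q *ᶻ sgn ∣ p ∣)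
             (λ E → within E D *ᶻ (sgn (sizeOf E) *ᶻ F (push (arcs (g ∘ suc) E) (push (rowArcs (g zero) p) c))))
           ∙ cong (rowWithin p q *ᶻ sgn ∣ p ∣ *ᶻ_) (matrixSum (g ∘ suc) D F-cong (push (rowArcs (g zero) p) c))
           ∙ ℤ.*-assoc (rowWithin p q) (sgn ∣ p ∣) (H (push (rowArcs (g zero) p) c))) ⟩
    Σ[ rows ] (λ p → rowWithin p q *ᶻ (sgn ∣ p ∣ *ᶻ H (push (rowArcs (g zero) p) c)))
      ≡⟨ rowSum (g zero) q {H} H-cong c ⟩
    S (rowArcs (g zero) q) H (c ∔ heads (rowArcs (g zero) q))
      ≡⟨ S-translate (rowArcs (g zero) q) (S-cong (arcs (g ∘ suc) D) F-cong) _ _ ⟩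
    S (rowArcs (g zero) q) (S (arcs (g ∘ suc) D) F) (c ∔ heads (rowArcs (g zero) q) ∔ heads (arcs (g ∘ suc) D))
      ≡⟨ sym (S-++ (rowArcs (g zero) q) F _) ⟩
    S (arcs g (q ∷ D)) F (c ∔ heads (rowArcs (g zero) q) ∔ heads (arcs (g ∘ suc) D))
      ≡⟨ S-cong (arcs g (q ∷ D)) F-cong (λ w → assoc (c w) _ _ ∙
           cong (c w +ᶻ_) (sym (heads-++ (rowArcs (g zero) q) (arcs (g ∘ suc) D) w))) ⟩
    S (arcs g (q ∷ D)) F (c ∔ heads (arcs g (q ∷ D))) ∎
    where
    open ≡-Reasoning
    rows = vectors bits n
    H : Poly V
    H d = S (arcs (g ∘ suc) D) F (d ∔ heads (arcs (g ∘ suc) D))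
    H-cong : Congruent H
    H-cong c≗d = S-cong (arcs (g ∘ suc) D) F-cong (λ w → cong (_+ᶻ heads (arcs (g ∘ suc) D) w) (c≗d w))
    assoc : ∀ a b c → a +ᶻ b +ᶻ c ≡ a +ᶻ (c +ᶻ b)
    assoc = solve-∀
    lemma : ∀ a b s t f → a *ᶻ b *ᶻ (s *ᶻ t *ᶻ f) ≡ a *ᶻ s *ᶻ (b *ᶻ (t *ᶻ f))
    lemma = solve-∀
    regroup : ∀ p E →
      rowWithin p q *ᶻ within E D *ᶻ (sgn (∣ p ∣ + sizeOf E) *ᶻ F (push (rowArcs (g zero) p ++ arcs (g ∘ suc) E) c)) ≡
      rowWithin p q *ᶻ sgn ∣ p ∣ *ᶻ (within E D *ᶻ (sgn (sizeOf E) *ᶻ F (push (arcs (g ∘ suc) E) (push (rowArcs (g zero) p) c))))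
    regroup p E = cong₂ (λ s d → rowWithin p q *ᶻ within E D *ᶻ (s *ᶻ F d))
        (sgn-+ ∣ p ∣ (sizeOf E)) (push-++ (rowArcs (g zero) p) c)
      ∙ lemma (rowWithin p q) (within E D) (sgn ∣ p ∣) (sgn (sizeOf E)) (F (push (arcs (g ∘ suc) E) (push (rowArcs (g zero) p) c)))

module _ {n : ℕ} where

  arc : Fin n → Fin n → Fin n × Fin n
  arc u v = v , u

  module _ (u : Fin n) where

    rowHeads-∉ : ∀ {m} (f : Fin m → Fin n) r {w} → (∀ j → w ≢ f j) → heads (rowArcs (arc u ∘ f) r) w ≡ 0ℤ
    rowHeads-∉ f []            w∉ = refl
    rowHeads-∉ f (inside  ∷ r) w∉ = cong₂ _+ᶻ_ (rowHeads-∉ (f ∘ suc) r (w∉ ∘ suc)) (e-diff (w∉ zero))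
    rowHeads-∉ f (outside ∷ r) w∉ = rowHeads-∉ (f ∘ suc) r (w∉ ∘ suc)

    rowHeads-∈ : ∀ {m} (f : Fin m → Fin n) → (∀ {i j} → f i ≡ f j → i ≡ j) → ∀ r j →
                 heads (rowArcs (arc u ∘ f) r) (f j) ≡ bit (lookup r j)
    rowHeads-∈ f inj (inside  ∷ r) zero =
      cong₂ _+ᶻ_ (rowHeads-∉ (f ∘ suc) r (λ j h → case inj h of λ ())) (e-same refl)
    rowHeads-∈ f inj (outside ∷ r) zero = rowHeads-∉ (f ∘ suc) r (λ j h → case inj h of λ ())
    rowHeads-∈ f inj (inside  ∷ r) (suc j) =
      cong₂ _+ᶻ_ (rowHeads-∈ (f ∘ suc) (Fin.suc-injective ∘ inj) r j) (e-diff λ h → case inj h of λ ())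
      ∙ ℤ.+-identityʳ _
    rowHeads-∈ f inj (outside ∷ r) (suc j) = rowHeads-∈ (f ∘ suc) (Fin.suc-injective ∘ inj) r j

    rowTails : ∀ {m} (f : Fin m → Fin n) r w → tails (rowArcs (arc u ∘ f) r) w ≡ + ∣ r ∣ *ᶻ e u w
    rowTails f []            w = refl
    rowTails f (inside  ∷ r) w = cong (_+ᶻ e u w) (rowTails (f ∘ suc) r w) ∙ lemma (+ ∣ r ∣) (e u w)
      where
      lemma : ∀ a b → a *ᶻ b +ᶻ b ≡ (1ℤ +ᶻ a) *ᶻ b
      lemma = solve-∀
    rowTails f (outside ∷ r) w = rowTails (f ∘ suc) r w

  heads-arcs : ∀ {m} (h : Fin m → Fin n) (E : Vec (Subset n) m) w →
               heads (arcs (arc ∘ h) E) w ≡ + ∣ Vec.map (λ row → lookup row w) E ∣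
  heads-arcs h []      w = refl
  heads-arcs h (r ∷ E) w =
    heads-++ (rowArcs (arc (h zero)) r) _ w
    ∙ cong₂ _+ᶻ_ (heads-arcs (h ∘ suc) E w) (rowHeads-∈ (h zero) id id r w)
    ∙ ℤ.+-comm (+ ∣ Vec.map (λ row → lookup row w) E ∣) (bit (lookup r w))
    ∙ sym (∣∷∣ (lookup r w) (Vec.map (λ row → lookup row w) E))

  tails-arcs-∉ : ∀ {m} (h : Fin m → Fin n) (E : Vec (Subset n) m) {w} → (∀ i → w ≢ h i) →
                 tails (arcs (arc ∘ h) E) w ≡ 0ℤ
  tails-arcs-∉ h []      w∉ = refl
  tails-arcs-∉ h (r ∷ E) {w} w∉ =
    tails-++ (rowArcs (arc (h zero)) r) _ w
    ∙ cong₂ _+ᶻ_ (tails-arcs-∉ (h ∘ suc) E (w∉ ∘ suc))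
        (rowTails (h zero) id r w ∙ cong (+ ∣ r ∣ *ᶻ_) (e-diff (w∉ zero)) ∙ ℤ.*-zeroʳ (+ ∣ r ∣))

  tails-arcs : ∀ {m} (h : Fin m → Fin n) → (∀ {i j} → h i ≡ h j → i ≡ j) → ∀ (E : Vec (Subset n) m) i →
               tails (arcs (arc ∘ h) E) (h i) ≡ + ∣ lookup E i ∣
  tails-arcs h inj (r ∷ E) zero =
    tails-++ (rowArcs (arc (h zero)) r) _ (h zero)
    ∙ cong₂ _+ᶻ_ (tails-arcs-∉ (h ∘ suc) E (λ i q → case inj q of λ ()))
        (rowTails (h zero) id r (h zero) ∙ cong (+ ∣ r ∣ *ᶻ_) (e-same refl) ∙ ℤ.*-identityʳ (+ ∣ r ∣))
    ∙ ℤ.+-identityˡ _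
  tails-arcs h inj (r ∷ E) (suc i) =
    tails-++ (rowArcs (arc (h zero)) r) _ (h (suc i))
    ∙ cong₂ _+ᶻ_ (tails-arcs (h ∘ suc) (Fin.suc-injective ∘ inj) E i)
        (rowTails (h zero) id r (h (suc i)) ∙ cong (+ ∣ r ∣ *ᶻ_) (e-diff λ q → case inj q of λ ()) ∙ ℤ.*-zeroʳ (+ ∣ r ∣))
    ∙ ℤ.+-identityʳ _

  digraphArcs : Digraph n → List (Fin n × Fin n)
  digraphArcs = arcs arc

  -- The outer factors are the indicators of the two conditions on a circulation, inclusion and
  -- balance; the middle one is the parity sign.
  weight : Digraph n → Digraph n → ℤ
  weight D E = within E D *ᶻ (sgn (size E) *ᶻ δ (push (digraphArcs E) 0̂))

  push-arcs : ∀ (E : Digraph n) v → push (digraphArcs E) 0̂ v ≡ + indegree E v -ᶻ + outdegree E v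
  push-arcs E v = push-value (digraphArcs E) 0̂ v ∙ ℤ.+-identityˡ _
    ∙ cong₂ _-ᶻ_ (heads-arcs id E v) (tails-arcs id id E v)

  weight-circulation : ∀ D E → IsCirculation D E → weight D E ≡ sgn (size E)
  weight-circulation D E (E⊆D , balanced) =
    cong₂ (λ a b → a *ᶻ (sgn (size E) *ᶻ b)) (within-yes E D E⊆D)
      (δ-zero λ v → push-arcs E v ∙ ℤ.i≡j⇒i-j≡0 (cong +_ (balanced v)))
    ∙ ℤ.*-identityˡ _ ∙ ℤ.*-identityʳ (sgn (size E))

  weight-other : ∀ D E → ¬ IsCirculation D E → weight D E ≡ 0ℤ
  weight-other D E ¬circ with Fin.all? (λ v → lookup E v ⊆? lookup D v)
  ... | no E⊈D  = cong (_*ᶻ (sgn (size E) *ᶻ δ (push (digraphArcs E) 0̂))) (within-no E D E⊈D)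
  ... | yes E⊆D with zero? (push (digraphArcs E) 0̂)
  ...   | inj₁ z = contradiction
    (E⊆D , λ v → ℤ.+-injective (ℤ.i-j≡0⇒i≡j _ _ (sym (push-arcs E v) ∙ z v))) ¬circ
  ...   | inj₂ (v , nz) =
    cong (λ a → within E D *ᶻ (sgn (size E) *ᶻ a)) (δ-nonzero v nz)
    ∙ cong (within E D *ᶻ_) (ℤ.*-zeroʳ (sgn (size E))) ∙ ℤ.*-zeroʳ (within E D)

  signed-count : ∀ D → + #even D -ᶻ + #odd D ≡ Σ[ digraphs n ] (weight D)
  signed-count D = go (digraphs n)
    where
    even? : (E : Digraph n) → Dec (2 ∣ size E)
    even? E = 2 ∣? size E
    odd? : (E : Digraph n) → Dec (2 ∤ size E)
    odd? E = ¬? (2 ∣? size E)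
    go : ∀ Es → + length (List.filter even? (List.filter (isCirculation? D) Es))
             -ᶻ + length (List.filter odd? (List.filter (isCirculation? D) Es)) ≡ Σ[ Es ] (weight D)
    go [] = refl
    go (E ∷ Es) with isCirculation? D E
    ... | no ¬circ = cong (λ l → + length (List.filter even? l) -ᶻ + length (List.filter odd? l))
            (List.filter-reject (isCirculation? D) ¬circ)
          ∙ go Es ∙ sym (cong (_+ᶻ Σ[ Es ] (weight D)) (weight-other D E ¬circ) ∙ ℤ.+-identityˡ _)
    ... | yes circ = cong (λ l → + length (List.filter even? l) -ᶻ + length (List.filter odd? l))
            (List.filter-accept (isCirculation? D) circ)
          ∙ head (even? E) ∙ cong₂ _+ᶻ_ (sym (weight-circulation D E circ)) (go Es)
      where
      Cs = List.filter (isCirculation? D) Es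
      lemma₁ : ∀ a b → 1ℤ +ᶻ a -ᶻ b ≡ 1ℤ +ᶻ (a -ᶻ b)
      lemma₁ = solve-∀
      lemma₂ : ∀ a b → a -ᶻ (1ℤ +ᶻ b) ≡ -1ℤ +ᶻ (a -ᶻ b)
      lemma₂ = solve-∀
      head : Dec (2 ∣ size E) → + length (List.filter even? (E ∷ Cs)) -ᶻ + length (List.filter odd? (E ∷ Cs)) ≡
        sgn (size E) +ᶻ (+ length (List.filter even? Cs) -ᶻ + length (List.filter odd? Cs))
      evens = + length (List.filter even? Cs)
      odds = + length (List.filter odd? Cs)
      head (yes p) = cong₂ (λ k l → + length k -ᶻ + length l)
          (List.filter-accept even? {E} {Cs} p) (List.filter-reject odd? {E} {Cs} (contradiction p))
        ∙ lemma₁ evens odds ∙ cong (_+ᶻ (evens -ᶻ odds)) (sym (sgn-even (size E) p))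
      head (no ¬p) = cong₂ (λ k l → + length k -ᶻ + length l)
          (List.filter-reject even? {E} {Cs} ¬p) (List.filter-accept odd? {E} {Cs} ¬p)
        ∙ lemma₂ evens odds ∙ cong (_+ᶻ (evens -ᶻ odds)) (sym (sgn-odd (size E) ¬p))

  -- The Alon–Tarsi identity: expanding the product of 1 − y/x over
  -- the arcs, the constant term counts circulations with sign.
  even-odd : ∀ D → + #even D -ᶻ + #odd D ≡ coef (digraphArcs D) (heads (digraphArcs D))
  even-odd D = signed-count D ∙ matrixSum arc D δ-cong 0̂
    ∙ coef-cong (digraphArcs D) (λ w → ℤ.+-identityˡ _)

-- From coefficients to orientations

heads-resp-↭ : ∀ {{_ : Index V}} {es fs : List (V × V)} → es ↭ fs → heads es ≗ heads fs
heads-resp-↭ Perm.refl v = refl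
heads-resp-↭ (Perm.prep (x , y) p) v = cong (_+ᶻ e x v) (heads-resp-↭ p v)
heads-resp-↭ {fs = (x′ , y′) ∷ (x , y) ∷ fs} (Perm.swap _ _ p) v =
  cong (λ h → h +ᶻ e x′ v +ᶻ e x v) (heads-resp-↭ p v) ∙ lemma (heads fs v) (e x′ v) (e x v)
  where
  lemma : ∀ a b c → a +ᶻ b +ᶻ c ≡ a +ᶻ c +ᶻ b
  lemma = solve-∀
heads-resp-↭ (Perm.trans p q) v = heads-resp-↭ p v ∙ heads-resp-↭ q v

Redirected : List (V × V) → List (V × V) → Set
Redirected = Pointwise λ f g → f ≡ g ⊎ f ≡ Product.swap g

redirect-edgeList : ∀ {R : V → V → Set} {es fs} → Redirected es fs → EdgeList R es → EdgeList R fs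
redirect-edgeList rd E = record
  { apart = aparts rd (apart E) ; sound = sound E ∘ joins⁻ rd ; complete = joins⁺ rd ∘ complete E }
  where
  apart-right : ∀ {f g h : V × V} → (g ≡ h ⊎ g ≡ Product.swap h) → Apart f g → Apart f h
  apart-right (inj₁ refl) ap      = ap
  apart-right (inj₂ refl) (p , q) = q , p
  aparts-right : ∀ {f es fs} → Redirected es fs → All (Apart f) es → All (Apart f) fs
  aparts-right []       []         = []
  aparts-right (r ∷ rd) (ap ∷ aps) = apart-right r ap ∷ aparts-right rd aps
  aparts : ∀ {es fs} → Redirected es fs → AllPairs Apart es → AllPairs Apart fs
  aparts []       []         = []
  aparts (r ∷ rd) (ap ∷ aps) =
    All.map (λ ap → Apart-sym (apart-right r (Apart-sym ap))) (aparts-right rd ap) ∷ aparts rd aps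
  joins⁺ : ∀ {es fs} → Redirected es fs → ∀ {x y} → Joins es x y → Joins fs x y
  joins⁺ (inj₁ refl ∷ rd) (inj₁ (here refl)) = inj₁ (here refl)
  joins⁺ (inj₁ refl ∷ rd) (inj₂ (here refl)) = inj₂ (here refl)
  joins⁺ (inj₂ refl ∷ rd) (inj₁ (here refl)) = inj₂ (here refl)
  joins⁺ (inj₂ refl ∷ rd) (inj₂ (here refl)) = inj₁ (here refl)
  joins⁺ (r ∷ rd)         (inj₁ (there m))   = Sum.map there there (joins⁺ rd (inj₁ m))
  joins⁺ (r ∷ rd)         (inj₂ (there m))   = Sum.map there there (joins⁺ rd (inj₂ m))
  joins⁻ : ∀ {es fs} → Redirected es fs → ∀ {x y} → Joins fs x y → Joins es x y
  joins⁻ (inj₁ refl ∷ rd) (inj₁ (here refl)) = inj₁ (here refl)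
  joins⁻ (inj₁ refl ∷ rd) (inj₂ (here refl)) = inj₂ (here refl)
  joins⁻ (inj₂ refl ∷ rd) (inj₁ (here refl)) = inj₂ (here refl)
  joins⁻ (inj₂ refl ∷ rd) (inj₂ (here refl)) = inj₁ (here refl)
  joins⁻ (r ∷ rd)         (inj₁ (there m))   = Sum.map there there (joins⁻ rd (inj₁ m))
  joins⁻ (r ∷ rd)         (inj₂ (there m))   = Sum.map there there (joins⁻ rd (inj₂ m))

-- A monomial occurring in the expansion arises by choosing one end of
-- every edge.
orient : ∀ {{_ : Index V}} (es : List (V × V)) {c} → coef es c ≢ 0ℤ →
         ∃ λ fs → Redirected es fs × heads fs ≗ c
orient [] {c} nz with zero? c
... | inj₁ c≡0     = [] , [] , λ v → sym (c≡0 v)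
... | inj₂ (v , h) = contradiction (δ-nonzero v h) nz
orient ((x , y) ∷ es) {c} nz with coef es (c ⊖ x) ℤ.≟ 0ℤ
... | no nz′ with fs , rd , h ← orient es nz′ =
  (x , y) ∷ fs , inj₁ refl ∷ rd , λ v → cong (_+ᶻ e x v) (h v) ∙ ⊖⊕-cancel c x v
... | yes z with fs , rd , h ← orient es {c ⊖ y} (λ z′ → nz (cong₂ _-ᶻ_ z z′)) =
  (y , x) ∷ fs , inj₂ refl ∷ rd , λ v → cong (_+ᶻ e y v) (h v) ∙ ⊖⊕-cancel c y v

-- This yields the asymmetry of the orientation, because a graph has no loops.
apart-swap : ∀ {es : List (V × V)} {f} → AllPairs Apart es → f ∈ₗ es → Product.swap f ∈ₗ es → f ≡ Product.swap f
apart-swap (ap ∷ aps) (here refl) (here q)    = sym q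
apart-swap (ap ∷ aps) (here refl) (there m)   = contradiction refl (proj₂ (All.lookup ap m))
apart-swap (ap ∷ aps) (there m)   (here refl) = contradiction refl (proj₁ (Product.swap (All.lookup ap m)))
apart-swap (ap ∷ aps) (there m)   (there m′)  = apart-swap aps m m′

module _ {{_ : Index V}} where

  ∈-rowArcs⁻ : ∀ {m} (g : Fin m → V × V) r {f} → f ∈ₗ rowArcs g r → ∃ λ j → lookup r j ≡ inside × f ≡ g j
  ∈-rowArcs⁻ g (inside  ∷ r) (here refl) = zero , refl , refl
  ∈-rowArcs⁻ g (inside  ∷ r) (there m) with j , p , q ← ∈-rowArcs⁻ (g ∘ suc) r m = suc j , p , q
  ∈-rowArcs⁻ g (outside ∷ r) m         with j , p , q ← ∈-rowArcs⁻ (g ∘ suc) r m = suc j , p , q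

  ∈-rowArcs⁺ : ∀ {m} (g : Fin m → V × V) r j → lookup r j ≡ inside → g j ∈ₗ rowArcs g r
  ∈-rowArcs⁺ g (inside  ∷ r) zero    p = here refl
  ∈-rowArcs⁺ g (inside  ∷ r) (suc j) p = there (∈-rowArcs⁺ (g ∘ suc) r j p)
  ∈-rowArcs⁺ g (outside ∷ r) (suc j) p = ∈-rowArcs⁺ (g ∘ suc) r j p

  rowArcs-unique : ∀ {m} (g : Fin m → V × V) → (∀ {i j} → g i ≡ g j → i ≡ j) → ∀ r → Unique (rowArcs g r)
  rowArcs-unique g inj []            = []
  rowArcs-unique g inj (inside  ∷ r) =
    All.tabulate (λ m q → case ∈-rowArcs⁻ (g ∘ suc) r m of λ { (j , _ , refl) → case inj q of λ () })
    ∷ rowArcs-unique (g ∘ suc) (Fin.suc-injective ∘ inj) r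
  rowArcs-unique g inj (outside ∷ r) = rowArcs-unique (g ∘ suc) (Fin.suc-injective ∘ inj) r

  module _ {n : ℕ} where

    ∈-arcs⁻ : ∀ {m} (g : Fin m → Fin n → V × V) D {f} → f ∈ₗ arcs g D →
              ∃ λ i → ∃ λ j → lookup (lookup D i) j ≡ inside × f ≡ g i j
    ∈-arcs⁻ g (r ∷ D) m with ∈ₗ.∈-++⁻ (rowArcs (g zero) r) m
    ... | inj₁ m′ with j , p , q ← ∈-rowArcs⁻ (g zero) r m′ = zero , j , p , q
    ... | inj₂ m′ with i , j , p , q ← ∈-arcs⁻ (g ∘ suc) D m′ = suc i , j , p , q

    ∈-arcs⁺ : ∀ {m} (g : Fin m → Fin n → V × V) D i j → lookup (lookup D i) j ≡ inside → g i j ∈ₗ arcs g D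
    ∈-arcs⁺ g (r ∷ D) zero    j p = ∈ₗ.∈-++⁺ˡ (∈-rowArcs⁺ (g zero) r j p)
    ∈-arcs⁺ g (r ∷ D) (suc i) j p = ∈ₗ.∈-++⁺ʳ (rowArcs (g zero) r) (∈-arcs⁺ (g ∘ suc) D i j p)

    arcs-unique : ∀ {m} (g : Fin m → Fin n → V × V) →
                  (∀ {i i′ j j′} → g i j ≡ g i′ j′ → i ≡ i′ × j ≡ j′) → ∀ D → Unique (arcs g D)
    arcs-unique g inj []      = []
    arcs-unique g inj (r ∷ D) = Unique.++⁺
      (rowArcs-unique (g zero) (proj₂ ∘ inj) r)
      (arcs-unique (g ∘ suc) (λ q → Product.map₁ Fin.suc-injective (inj q)) D)
      λ (m , m′) → case ∈-rowArcs⁻ (g zero) r m of λ { (j , _ , refl) →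
        case ∈-arcs⁻ (g ∘ suc) D m′ of λ (i , j′ , _ , q) → case proj₁ (inj q) of λ () }

-- Existence of the Alon-Tarsi number, and coefficients as upper bounds

maximum-upper : ∀ {m} (f : Fin m → ℕ) i → f i ≤ maximum f
maximum-upper f i = All.lookup (xs≤max 0 (List.tabulate f)) (∈ₗ.∈-tabulate⁺ i)

maximum-least : ∀ {m} (f : Fin m → ℕ) {b} → (∀ i → f i ≤ b) → maximum f ≤ b
maximum-least f h = max≤v⁺ z≤n (All.tabulate⁺ h)

∈-vectors : ∀ {A : Set} {xs : List A} → (∀ x → x ∈ₗ xs) → ∀ {n} (v : Vec A n) → v ∈ₗ vectors xs n
∈-vectors all []      = here refl
∈-vectors all (x ∷ v) = ∈ₗ.∈-cartesianProductWith⁺ _∷_ (all x) (∈-vectors all v)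

∈-digraphs : ∀ {n} (D : Digraph n) → D ∈ₗ digraphs n
∈-digraphs = ∈-vectors (∈-vectors λ { inside → here refl ; outside → there (here refl) })

isOrientation? : ∀ {n} (G : Graph n) (D : Digraph n) → Dec (IsOrientation G D)
isOrientation? G D = map′
  (λ (p , q , r) → record { arc⇒adj = p _ _ ; adj⇒arc = q _ _ ; asym = r _ _ })
  (λ o → (λ _ _ → IsOrientation.arc⇒adj o) , (λ _ _ → IsOrientation.adj⇒arc o) , (λ _ _ → IsOrientation.asym o))
  (∀∀? (λ u v → arc? u v →-dec adj? G u v)
   ×-dec ∀∀? (λ u v → adj? G u v →-dec (arc? u v ⊎-dec arc? v u))
   ×-dec ∀∀? (λ u v → arc? u v →-dec ¬? (arc? v u)))
  where
  ∀∀? : {P : Fin _ → Fin _ → Set} → (∀ u v → Dec (P u v)) → Dec (∀ u v → P u v)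
  ∀∀? P? = Fin.all? λ u → Fin.all? (P? u)
  arc? : ∀ u v → Dec (Arc D u v)
  arc? u v = v ∈? lookup D u

hasATOrientation? : ∀ {n} (G : Graph n) k → Dec (HasATOrientation G k)
hasATOrientation? G k = map′
  (λ m → let D , _ , h = ∈ₗ.find m in D , h)
  (λ (D , h) → Any.map (λ { refl → h }) (∈-digraphs D))
  (Any.any? (λ D → isOrientation? G D ×-dec (suc (maxIndegree D) ℕ.≟ k) ×-dec ¬? (#even D ℕ.≟ #odd D))
            (digraphs _))

least : ∀ {P : ℕ → Set} → (∀ k → Dec (P k)) → ∀ k → P k → ∃ λ l → P l × (∀ {j} → P j → l ≤ j) × l ≤ k
least {P} P? k pk =
  let l , pl , min , le = search k 0 (subst P (sym (ℕ.+-identityʳ k)) pk) (λ _ → z≤n)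
  in l , pl , min , subst (l ≤_) (ℕ.+-identityʳ k) le
  where
  search : ∀ fuel j → P (fuel + j) → (∀ {i} → P i → j ≤ i) →
           ∃ λ l → P l × (∀ {i} → P i → l ≤ i) × l ≤ fuel + j
  search zero       j pj below = j , pj , below , ℕ.≤-refl
  search (suc fuel) j pj below with P? j
  ... | yes p = j , p , below , ℕ.m≤n+m j (suc fuel)
  ... | no ¬p with l , pl , min , le ← search fuel (suc j) (subst P (sym (ℕ.+-suc fuel j)) pj)
                    (λ {i} pi → ℕ.≤∧≢⇒< (below pi) λ { refl → ¬p pi }) =
    l , pl , min , subst (l ≤_) (ℕ.+-suc fuel j) le

-- One admissible orientation suffices: the property is decidable by running through all digraphs,
-- so the least admissible value exists.
AT-upper : ∀ {n} (G : Graph n) {k b} → HasATOrientation G k → k ≤ b → AT G ≤ b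
AT-upper G {k} h k≤b with l , hl , min , l≤k ← least (hasATOrientation? G) k h =
  l , record { attained = hl ; minimal = min } , ℕ.≤-trans l≤k k≤b

module _ {n : ℕ} where
  open import Data.List.Membership.DecPropositional (≡-dec (Fin._≟_ {n}) (Fin._≟_ {n})) using () renaming (_∈?_ to _∈ₗ?_)

  toDigraph : List (Fin n × Fin n) → Digraph n
  toDigraph es = Vec.tabulate λ u → Vec.tabulate λ v → does ((v , u) ∈ₗ? es)

  private
    entry : ∀ es u v → lookup (lookup (toDigraph es) u) v ≡ does ((v , u) ∈ₗ? es)
    entry es u v = cong (λ r → lookup r v) (Vec.lookup∘tabulate _ u) ∙ Vec.lookup∘tabulate _ v

  entry⁻ : ∀ es {u v} → lookup (lookup (toDigraph es) u) v ≡ inside → (v , u) ∈ₗ es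
  entry⁻ es {u} {v} q with (v , u) ∈ₗ? es | entry es u v
  ... | yes p | _ = p
  ... | no _  | h = case sym q ∙ h of λ ()

  entry⁺ : ∀ es {u v} → (v , u) ∈ₗ es → lookup (lookup (toDigraph es) u) v ≡ inside
  entry⁺ es {u} {v} m = entry es u v ∙ dec-true ((v , u) ∈ₗ? es) m

  -- Reading arcs off the matrix only changes their order: both lists are free of repetitions and
  -- have the same members.
  arcs-toDigraph : ∀ {es} → AllPairs Apart es → digraphArcs (toDigraph es) ↭ es
  arcs-toDigraph {es} aps = ∼bag⇒↭ (unique∧set⇒bag
    (arcs-unique arc (λ q → cong proj₂ q , cong proj₁ q) (toDigraph es))
    (AllPairs.map proj₁ aps)
    (mk⇔ (λ m → case ∈-arcs⁻ arc (toDigraph es) m of λ { (u , v , p , refl) → entry⁻ es p })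
         (λ {m → ∈-arcs⁺ arc (toDigraph es) _ _ (entry⁺ es m)})))

  -- `orient` directs the edges with indegrees `c`. Redirecting changes the coefficient by a nonzero
  -- factor only, and at its own indegrees the coefficient is the signed count of circulations.
  coef⇒AT : (G : Graph n) {es : List (Fin n × Fin n)} → EdgeList (Adj G) es →
            ∀ {c b} → coef es c ≢ 0ℤ → (∀ v → c v ≤ᶻ + b) → AT G ≤ suc b
  coef⇒AT G {es} E {c} {b} nz c≤b with fs , rd , hd ← orient es nz =
    AT-upper G (D , orientation , refl , even≢odd) (s≤s (maximum-least (indegree D) λ v →
      ℤ.drop‿+≤+ (subst (_≤ᶻ + b) (sym (hd v) ∙ sym (heads-resp-↭ D↭fs v) ∙ heads-arcs id D v) (c≤b v))))
    where
    D = toDigraph fs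
    F = redirect-edgeList rd E
    D↭fs = arcs-toDigraph (apart F)
    arc⁻ : ∀ {u v} → Arc D u v → (v , u) ∈ₗ fs
    arc⁻ a = entry⁻ fs (Vec.[]=⇒lookup a)
    arc⁺ : ∀ {u v} → (v , u) ∈ₗ fs → Arc D u v
    arc⁺ m = Vec.lookup⇒[]= _ _ (entry⁺ fs m)
    orientation : IsOrientation G D
    orientation = record
      { arc⇒adj = λ a → sound F (inj₂ (arc⁻ a))
      ; adj⇒arc = λ adj → Sum.map arc⁺ arc⁺ (Sum.swap (complete F adj))
      ; asym = λ a a′ → irrefl G (cong proj₂ (apart-swap (apart F) (arc⁻ a) (arc⁻ a′))) (sound F (inj₂ (arc⁻ a))) }
    open Proportional (coef-unique E F)
    even≢odd : #even D ≢ #odd D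
    even≢odd eq = nz (scale c ∙ cong (factor *ᶻ_)
      (coef-cong fs (λ v → sym (hd v) ∙ sym (heads-resp-↭ D↭fs v))
       ∙ sym (S-↭ δ-cong D↭fs (heads (digraphArcs D))) ∙ sym (even-odd D) ∙ ℤ.i≡j⇒i-j≡0 (cong +_ eq))
      ∙ ℤ.*-zeroʳ factor)

-- Independence of robustness from edge list and vertex order

lin-scale : ∀ {{_ : Index V}} l {F G : Poly V} σ → (∀ c → F c ≡ σ *ᶻ G c) →
            ∀ c → lin l F c ≡ σ *ᶻ lin l G c
lin-scale []            σ h c = sym (ℤ.*-zeroʳ σ)
lin-scale ((a , v) ∷ l) {G = G} σ h c =
  cong₂ (λ p q → a *ᶻ p +ᶻ q) (h (c ⊖ v)) (lin-scale l σ h c) ∙ lemma a σ (G (c ⊖ v)) (lin l G c)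
  where
  lemma : ∀ a s f g → a *ᶻ (s *ᶻ f) +ᶻ s *ᶻ g ≡ s *ᶻ (a *ᶻ f +ᶻ g)
  lemma = solve-∀

lin-↭ : ∀ {{_ : Index V}} {l m} (F : Poly V) → l ↭ m → ∀ c → lin l F c ≡ lin m F c
lin-↭ F Perm.refl c = refl
lin-↭ F (Perm.prep (a , v) p) c = cong (a *ᶻ F (c ⊖ v) +ᶻ_) (lin-↭ F p c)
lin-↭ {m = (b , w) ∷ (a , v) ∷ m} F (Perm.swap _ _ p) c =
  cong (λ z → a *ᶻ F (c ⊖ v) +ᶻ (b *ᶻ F (c ⊖ w) +ᶻ z)) (lin-↭ F p c)
  ∙ lemma (a *ᶻ F (c ⊖ v)) (b *ᶻ F (c ⊖ w)) (lin m F c)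
  where
  lemma : ∀ a b c → a +ᶻ (b +ᶻ c) ≡ b +ᶻ (a +ᶻ c)
  lemma = solve-∀
lin-↭ F (Perm.trans p q) c = lin-↭ F p c ∙ lin-↭ F q c

-- Allows an edge list and a vertex order to be chosen separately for every form `a`.
robustAt-transfer : ∀ {{_ : Index V}} {R : V → V → Set} {d es fs a vs} → vs ↭ enum {V} →
                    EdgeList R es → EdgeList R fs → RobustAtOn d fs a vs → RobustAt d es a
robustAt-transfer {es = es} {fs} {a} {vs} p E F (c , c≥0 , c≤d , z , v , nz) =
  c , c≥0 , c≤d , scale c ∙ cong (factor *ᶻ_) z ∙ ℤ.*-zeroʳ factor , v , λ h →
    [ factor≢0 , (λ h′ → nz (lin-↭ (coef fs) (Perm.map⁺ (λ v → a v , v) p) (c ⊕ v) ∙ h′)) ]′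
      (ℤ.i*j≡0⇒i≡0∨j≡0 factor (sym (lin-scale (form a) factor scale (c ⊕ v)) ∙ h))
  where open Proportional (coef-unique E F)

enumeration-↭ : ∀ {{_ : Index V}} {vs : List V} → Unique vs → (∀ v → v ∈ₗ vs) → vs ↭ enum {V}
enumeration-↭ uq all = ∼bag⇒↭ (unique∧set⇒bag uq enum-unique (mk⇔ (λ _ → enum-complete _) (λ _ → all _)))

lin-zero : ∀ {{_ : Index V}} (a : V → ℤ) us {F : Poly V} {c} → (∀ u → u ∈ₗ us → F (c ⊖ u) ≡ 0ℤ) →
           lin (formOn a us) F c ≡ 0ℤ
lin-zero a []       h = refl
lin-zero a (u ∷ us) h =
  cong₂ (λ p q → a u *ᶻ p +ᶻ q) (h u (here refl)) (lin-zero a us (λ v → h v ∘ there)) ∙ cong (_+ᶻ 0ℤ) (ℤ.*-zeroʳ (a u))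

self-negative : ∀ {i} → i ≡ -ᶻ i → i ≡ 0ℤ
self-negative {+ zero}    q = refl
self-negative {+ suc n}   ()
self-negative {ℤ.-[1+ n ]} ()

-- Complete graphs

completeEdges : List V → List (V × V)
completeEdges []       = []
completeEdges (v ∷ vs) = List.map (v ,_) vs ++ completeEdges vs

completeEdges-map : ∀ (f : U → V) vs → completeEdges (List.map f vs) ≡ List.map (Product.map f f) (completeEdges vs)
completeEdges-map f []       = refl
completeEdges-map f (v ∷ vs) =
  cong₂ _++_ (sym (List.map-∘ vs) ∙ List.map-∘ vs) (completeEdges-map f vs) ∙ sym (List.map-++ (Product.map f f) (List.map (v ,_) vs) _)

module _ {{_ : Index V}} where

  completeEdges-∈⁻ : ∀ (vs : List V) {x y} → Unique vs → (x , y) ∈ₗ completeEdges vs → x ≢ y × x ∈ₗ vs × y ∈ₗ vs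
  completeEdges-∈⁻ (v ∷ vs) (v∉ ∷ uq) m with ∈ₗ.∈-++⁻ (List.map (v ,_) vs) m
  ... | inj₁ m′ with y , k , refl ← ∈ₗ.∈-map⁻ _ m′ = All.lookup v∉ k , here refl , there k
  ... | inj₂ m′ with x≢y , p , q ← completeEdges-∈⁻ vs uq m′ = x≢y , there p , there q

  completeEdges-apart : ∀ (vs : List V) → Unique vs → AllPairs Apart (completeEdges vs)
  completeEdges-apart []       []        = []
  completeEdges-apart (v ∷ vs) (v∉ ∷ uq) = AllPairs.++⁺
    (AllPairs.map⁺ (star v∉ uq)) (completeEdges-apart vs uq)
    (All.map⁺ (All.tabulate λ _ → All.tabulate λ {(x , y)} m →
      let _ , p , q = completeEdges-∈⁻ vs uq m in
      (λ h → All.lookup v∉ p (cong proj₁ h)) , (λ h → All.lookup v∉ q (cong proj₁ h))))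
    where
    star : ∀ {ws} → All (v ≢_) ws → Unique ws → AllPairs (λ x y → Apart (v , x) (v , y)) ws
    star []        []         = []
    star (v≢ ∷ vs) (≢s ∷ uq) =
      All.zipWith (λ (x≢y , v≢y) → (λ h → x≢y (cong proj₂ h)) , (λ h → v≢y (cong proj₁ h))) (≢s , vs) ∷ star vs uq

  completeEdges-complete : ∀ {vs : List V} {x y} → x ≢ y → x ∈ₗ vs → y ∈ₗ vs → Joins (completeEdges vs) x y
  completeEdges-complete x≢y (here refl) (here refl) = contradiction refl x≢y
  completeEdges-complete x≢y (here refl) (there q)   = inj₁ (∈ₗ.∈-++⁺ˡ (∈ₗ.∈-map⁺ _ q))
  completeEdges-complete x≢y (there p)   (here refl) = inj₂ (∈ₗ.∈-++⁺ˡ (∈ₗ.∈-map⁺ _ p))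
  completeEdges-complete {v ∷ vs} x≢y (there p) (there q) =
    Sum.map (∈ₗ.∈-++⁺ʳ (List.map (v ,_) vs)) (∈ₗ.∈-++⁺ʳ (List.map (v ,_) vs)) (completeEdges-complete x≢y p q)

  edgeList-complete : ∀ {vs : List V} → Unique vs → (∀ v → v ∈ₗ vs) → EdgeList _≢_ (completeEdges vs)
  edgeList-complete {vs} uq all = record
    { apart    = completeEdges-apart vs uq
    ; sound    = λ { (inj₁ m) → proj₁ (completeEdges-∈⁻ vs uq m)
                   ; (inj₂ m) → proj₁ (completeEdges-∈⁻ vs uq m) ∘ sym }
    ; complete = λ x≢y → completeEdges-complete x≢y (all _) (all _) }

  -- The number of later vertices: the indegrees of the transitive orientation, and the exponents of
  -- the leading Vandermonde monomial.
  rank : List V → Exponent V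
  rank []       u = 0ℤ
  rank (v ∷ vs) u = rank vs u +ᶻ + length vs *ᶻ e v u

  rank-other : ∀ {v u} vs → u ≢ v → rank (v ∷ vs) u ≡ rank vs u
  rank-other {v} {u} vs u≢v =
    cong (rank vs u +ᶻ_) (cong (+ length vs *ᶻ_) (e-diff u≢v) ∙ ℤ.*-zeroʳ (+ length vs)) ∙ ℤ.+-identityʳ _

  rank-∉ : ∀ vs {u} → u ∉ₗ vs → rank vs u ≡ 0ℤ
  rank-∉ []       u∉ = refl
  rank-∉ (v ∷ vs) u∉ = rank-other vs (λ { refl → u∉ (here refl) }) ∙ rank-∉ vs (u∉ ∘ there)

  rank-head : ∀ v vs → v ∉ₗ vs → rank (v ∷ vs) v ≡ + length vs
  rank-head v vs v∉ = cong₂ _+ᶻ_ (rank-∉ vs v∉) (cong (+ length vs *ᶻ_) (e-same refl) ∙ ℤ.*-identityʳ (+ length vs))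
    ∙ ℤ.+-identityˡ _

  unique-∉ : ∀ {v : V} {vs} → All (v ≢_) vs → v ∉ₗ vs
  unique-∉ v∉ m = All.lookup v∉ m refl

  rank-bounds : ∀ {v : V} vs → Unique (v ∷ vs) → ∀ u → 0ℤ ≤ᶻ rank (v ∷ vs) u × rank (v ∷ vs) u ≤ᶻ + length vs
  rank-bounds {v} vs (v∉ ∷ uq) u with u ≟ v
  ... | yes refl rewrite rank-head v vs (unique-∉ v∉) = ℤ.+≤+ z≤n , ℤ.≤-refl
  rank-bounds [] (v∉ ∷ uq) u | no u≢v rewrite rank-other [] u≢v = ℤ.≤-refl , ℤ.≤-refl
  rank-bounds (w ∷ vs) (v∉ ∷ uq) u | no u≢v rewrite rank-other (w ∷ vs) u≢v =
    let lo , hi = rank-bounds vs uq u in lo , ℤ.≤-trans hi (ℤ.+≤+ (ℕ.n≤1+n _))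

  -- The first vertex is a one-point block that takes all its edges, so `coef-block` reduces the
  -- claim to the remaining vertices.
  coef-rank : ∀ {vs : List V} → Unique vs → coef (completeEdges vs) (rank vs) ≡ 1ℤ
  coef-rank [] = δ-zero λ _ → refl
  coef-rank {v ∷ vs} (v∉ ∷ uq) =
    cong (λ es → coef (es ++ completeEdges vs) (rank (v ∷ vs))) (List.map-∘ vs)
    ∙ coef-cong (X.extend [] cr (completeEdges vs)) agree
    ∙ X.coef-block {es = []} {cr} offs out {0̂} {rank vs} (λ h → case sym δ0 ∙ h of λ ()) (λ _ → rank-∉ vs (unique-∉ v∉))
    ∙ cong₂ _*ᶻ_ δ0 (coef-rank uq)
    where
    module X = Block {⊤} {V} (λ _ → v) (λ _ → refl)
    cr = List.map (tt ,_) vs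
    δ0 : δ {⊤} 0̂ ≡ 1ℤ
    δ0 = δ-zero λ _ → refl
    offs : X.OffTargets cr
    offs = All.map⁺ (All.map (λ v≢ _ → v≢) v∉)
    out : X.Outside (completeEdges vs)
    out = All.tabulate λ m → let _ , p , q = completeEdges-∈⁻ vs uq m in (λ _ → All.lookup v∉ p) , (λ _ → All.lookup v∉ q)
    tally-star : ∀ ws → X.tally (List.map (tt ,_) ws) tt ≡ + length ws
    tally-star []       = refl
    tally-star (w ∷ ws) = cong₂ _+ᶻ_ (tally-star ws) (e-same {⊤} refl) ∙ ℤ.+-comm (+ length ws) 1ℤ
    agree : rank (v ∷ vs) ≗ X.join (0̂ ∔ X.tally cr) (rank vs)
    agree u with u ≟ v
    ... | yes refl = rank-head v vs (unique-∉ v∉) ∙ sym (X.join-in _ (rank vs) {tt} refl ∙ ℤ.+-identityˡ _ ∙ tally-star vs)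
    ... | no u≢v   = rank-other vs u≢v ∙ sym (X.join-out _ (rank vs) (λ _ h → u≢v (sym h)))

  transpose : V → V → V → V
  transpose s t u with u ≟ s | u ≟ t
  ... | yes _ | _     = t
  ... | no _  | yes _ = s
  ... | no _  | no _  = u

  transpose-s : ∀ s t → transpose s t s ≡ t
  transpose-s s t with s ≟ s | s ≟ t
  ... | yes _ | _ = refl
  ... | no ¬p | _ = contradiction refl ¬p

  transpose-t : ∀ s t → transpose s t t ≡ s
  transpose-t s t with t ≟ s | t ≟ t
  ... | yes t≡s | _     = t≡s
  ... | no _    | yes _ = refl
  ... | no _    | no ¬p = contradiction refl ¬p

  transpose-else : ∀ {s t u} → u ≢ s → u ≢ t → transpose s t u ≡ u
  transpose-else {s} {t} {u} u≢s u≢t with u ≟ s | u ≟ t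
  ... | yes p | _     = contradiction p u≢s
  ... | no _  | yes p = contradiction p u≢t
  ... | no _  | no _  = refl

  transpose-involutive : ∀ s t u → transpose s t (transpose s t u) ≡ u
  transpose-involutive s t u with u ≟ s | u ≟ t
  ... | yes refl | _        = transpose-t s t
  ... | no _     | yes refl = transpose-s s t
  ... | no u≢s   | no u≢t   = transpose-else u≢s u≢t

  module _ (τ : V → V) (τ-involutive : ∀ u → τ (τ u) ≡ u) where

    private
      τ-injective : ∀ {u v} → τ u ≡ τ v → u ≡ v
      τ-injective {u} {v} q = sym (τ-involutive u) ∙ cong τ q ∙ τ-involutive v

      e-τ : ∀ u v → e (τ u) (τ v) ≡ e u v
      e-τ u v with v ≟ u
      ... | yes refl = e-same refl ∙ sym (e-same refl)
      ... | no v≢u   = e-diff (v≢u ∘ τ-injective) ∙ sym (e-diff v≢u)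

    coef-relabel : ∀ es c → coef (List.map (Product.map τ τ) es) c ≡ coef es (c ∘ τ)
    coef-relabel [] c with zero? c
    ... | inj₁ c≡0     = δ-zero c≡0 ∙ sym (δ-zero (c≡0 ∘ τ))
    ... | inj₂ (v , h) = δ-nonzero v h ∙ sym (δ-nonzero (τ v) (h ∘ (sym (cong c (τ-involutive v)) ∙_)))
    coef-relabel ((x , y) ∷ es) c = cong₂ _-ᶻ_ (step x) (step y)
      where
      step : ∀ u → coef (List.map (Product.map τ τ) es) (c ⊖ τ u) ≡ coef es (c ∘ τ ⊖ u)
      step u = coef-relabel es (c ⊖ τ u) ∙ coef-cong es (λ w → cong (λ z → c (τ w) -ᶻ z) (e-τ u w))

  S-negate : ∀ es {F G : Poly V} → (∀ c → F c ≡ -ᶻ G c) → ∀ c → S es F c ≡ -ᶻ S es G c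
  S-negate []             h c = h c
  S-negate ((x , y) ∷ es) {F} {G} h c =
    cong₂ _-ᶻ_ (S-negate es h (c ⊖ x)) (S-negate es h (c ⊖ y)) ∙ lemma (S es G (c ⊖ x)) (S es G (c ⊖ y))
    where
    lemma : ∀ a b → -ᶻ a -ᶻ (-ᶻ b) ≡ -ᶻ (a -ᶻ b)
    lemma = solve-∀

  -- Interchanging the last two vertices reverses only the edge between them; the edges from earlier
  -- vertices are merely reordered.
  swap-last : ∀ (vs : List V) s t c → coef (completeEdges (vs ++ t ∷ s ∷ [])) c ≡ -ᶻ coef (completeEdges (vs ++ s ∷ t ∷ [])) c
  swap-last []       s t c = neg-sub (δ (c ⊖ t)) (δ (c ⊖ s))
  swap-last (v ∷ vs) s t c =
    S-++ (star (t ∷ s ∷ [])) δ c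
    ∙ S-negate (star (t ∷ s ∷ [])) (swap-last vs s t) c
    ∙ cong -ᶻ_ (S-↭ (coef-cong (completeEdges (vs ++ s ∷ t ∷ [])))
        (Perm.map⁺ (v ,_) (Perm.++⁺ˡ vs (Perm.swap t s ↭-refl))) c
      ∙ sym (S-++ (star (s ∷ t ∷ [])) δ c))
    where
    star : List V → List (V × V)
    star ws = List.map (v ,_) (vs ++ ws)

  -- Placing `t` and `s` last gives them the ranks 1 and 0, which one unit makes equal. Placing `z`
  -- first makes it the only vertex whose rank exceeds the bound, and lowering it restores the
  -- bound.
  module Complete {z s t : V} {xs : List V} (uq : Unique (z ∷ xs ++ t ∷ s ∷ []))
                  (all : ∀ v → v ∈ₗ z ∷ xs ++ t ∷ s ∷ []) where

    vs : List V
    vs = z ∷ xs ++ t ∷ s ∷ []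

    private
      es = completeEdges vs
      τ = transpose s t
      r = rank vs

      split : Unique (xs ++ t ∷ s ∷ [])
      split = case uq of λ { (_ ∷ q) → q }

      distinct : ∀ ys {s t : V} → Unique (ys ++ t ∷ s ∷ []) → t ≢ s × (∀ {u} → u ∈ₗ ys → u ≢ s × u ≢ t)
      distinct []       ((t≢s ∷ []) ∷ _) = t≢s , λ ()
      distinct (y ∷ ys) (y∉ ∷ uq) with t≢s , rec ← distinct ys uq =
        t≢s , λ { (here refl) → All.lookup y∉ (∈ₗ.∈-++⁺ʳ ys (there (here refl))) , All.lookup y∉ (∈ₗ.∈-++⁺ʳ ys (here refl))
                ; (there m)   → rec m }

      t≢s : t ≢ s
      t≢s = proj₁ (distinct (z ∷ xs) uq)

      others : ∀ {u} → u ∈ₗ z ∷ xs → u ≢ s × u ≢ t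
      others = proj₂ (distinct (z ∷ xs) uq)

      z≢s : z ≢ s
      z≢s = proj₁ (others (here refl))

      z≢t : z ≢ t
      z≢t = proj₂ (others (here refl))

      τ-fixes : ∀ {ys : List V} → (∀ {u} → u ∈ₗ ys → u ≢ s × u ≢ t) → List.map τ ys ≡ ys
      τ-fixes {[]}     h = refl
      τ-fixes {y ∷ ys} h = cong₂ _∷_ (let p , q = h (here refl) in transpose-else p q) (τ-fixes (h ∘ there))

    antisymmetric : ∀ c → coef es (c ∘ τ) ≡ -ᶻ coef es c
    antisymmetric c =
      sym (coef-relabel τ (transpose-involutive s t) es c)
      ∙ cong (λ fs → coef fs c) (sym (completeEdges-map τ vs)
          ∙ cong completeEdges (List.map-++ τ (z ∷ xs) (t ∷ s ∷ [])
            ∙ cong₂ _++_ (τ-fixes others) (cong₂ (λ p q → p ∷ q ∷ []) (transpose-t s t) (transpose-s s t))))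
      ∙ swap-last (z ∷ xs) t s c

    -- The transposition fixes such an exponent, so the coefficient equals its own negative.
    vanishes : ∀ {c : Exponent V} → c s ≡ c t → coef es c ≡ 0ℤ
    vanishes {c} q = self-negative (coef-cong es fixed ∙ antisymmetric c)
      where
      fixed : c ≗ c ∘ τ
      fixed u with u ≟ s | u ≟ t
      ... | yes refl | _        = q
      ... | no _     | yes refl = sym q
      ... | no _     | no _     = refl

    private
      rank-end : ∀ ys → Unique (ys ++ t ∷ s ∷ []) → (∀ {u} → u ∈ₗ ys → u ≢ s × u ≢ t) →
                 rank (ys ++ t ∷ s ∷ []) s ≡ 0ℤ × rank (ys ++ t ∷ s ∷ []) t ≡ 1ℤ
      rank-end [] _ _ =
        (rank-other (s ∷ []) (t≢s ∘ sym) ∙ rank-head s [] λ ()) ,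
        rank-head t (s ∷ []) (λ { (here q) → t≢s q })
      rank-end (y ∷ ys) (_ ∷ uq) h with p , q ← rank-end ys uq (h ∘ there) | y≢s , y≢t ← h (here refl) =
        (rank-other (ys ++ t ∷ s ∷ []) (y≢s ∘ sym) ∙ p) , (rank-other (ys ++ t ∷ s ∷ []) (y≢t ∘ sym) ∙ q)

      r-s : r s ≡ 0ℤ
      r-s = proj₁ (rank-end (z ∷ xs) uq others)

      r-t : r t ≡ 1ℤ
      r-t = proj₂ (rank-end (z ∷ xs) uq others)

      r-z : r z ≡ + suc (suc (length xs))
      r-z = rank-head z _ (case uq of λ { (z∉ ∷ _) → unique-∉ z∉ })
        ∙ cong +_ (List.length-++ xs ∙ ℕ.+-comm (length xs) 2)

      -- Equal exponents at s and t make the coefficient vanish, and after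
      -- raising z only lowering s or t gives distinct exponents again.
      c : Exponent V
      c = r ⊖ z ⊕ s

      value : ∀ {a b x y u} → r u ≡ a → e z u ≡ x → e s u ≡ y → a -ᶻ x +ᶻ y ≡ b → c u ≡ b
      value refl refl refl q = q

      bounds : ∀ u → 0ℤ ≤ᶻ c u × c u ≤ᶻ + suc (length xs)
      bounds u with u ≟ z | u ≟ s
      ... | yes refl | _ rewrite value {b = + suc (length xs)} r-z (e-same {u = z} refl) (e-diff z≢s) (ℤ.+-identityʳ _) =
        ℤ.+≤+ z≤n , ℤ.≤-refl
      ... | no u≢z | yes refl rewrite value {b = 1ℤ} r-s (e-diff u≢z) (e-same {u = s} refl) refl =
        ℤ.+≤+ z≤n , ℤ.+≤+ (s≤s z≤n)
      ... | no u≢z | no u≢s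
        rewrite value {b = r u} refl (e-diff u≢z) (e-diff u≢s) (ℤ.+-identityʳ _ ∙ ℤ.+-identityʳ _)
              | rank-other (xs ++ t ∷ s ∷ []) u≢z = go xs split
        where
        go : ∀ ys → Unique (ys ++ t ∷ s ∷ []) → 0ℤ ≤ᶻ rank (ys ++ t ∷ s ∷ []) u × rank (ys ++ t ∷ s ∷ []) u ≤ᶻ + suc (length ys)
        go []       uq = rank-bounds (s ∷ []) uq u
        go (y ∷ ys) uq with lo , hi ← rank-bounds (ys ++ t ∷ s ∷ []) uq u =
          lo , subst (λ m → rank (y ∷ ys ++ t ∷ s ∷ []) u ≤ᶻ + m) (List.length-++ ys ∙ ℕ.+-comm (length ys) 2) hi

      c-symmetric : c s ≡ c t
      c-symmetric = value {b = 1ℤ} r-s (e-diff (z≢s ∘ sym)) (e-same {u = s} refl) refl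
        ∙ sym (value {b = 1ℤ} r-t (e-diff (z≢t ∘ sym)) (e-diff t≢s) refl)

      c⊕z : c ⊕ z ≗ r ⊕ s
      c⊕z u = lemma (r u) (e z u) (e s u)
        where
        lemma : ∀ a b c → a -ᶻ b +ᶻ c +ᶻ b ≡ a +ᶻ c
        lemma = solve-∀

      r⊕s-s : (r ⊕ s) s ≡ 1ℤ
      r⊕s-s = cong₂ _+ᶻ_ r-s (e-same refl)

      r⊕s-t : (r ⊕ s) t ≡ 1ℤ
      r⊕s-t = cong₂ _+ᶻ_ r-t (e-diff t≢s)

      at-other : ∀ u → u ∈ₗ z ∷ xs → coef es (r ⊕ s ⊖ u) ≡ 0ℤ
      at-other u m with u≢s , u≢t ← others m = vanishes
        (⊖-at-other (r ⊕ s) (u≢s ∘ sym) ∙ r⊕s-s ∙ sym (⊖-at-other (r ⊕ s) (u≢t ∘ sym) ∙ r⊕s-t))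

      at-s : coef es (r ⊕ s ⊖ s) ≡ 1ℤ
      at-s = coef-cong es (⊕⊖-cancel r s) ∙ coef-rank uq

      at-t : coef es (r ⊕ s ⊖ t) ≡ -1ℤ
      at-t = coef-cong es swapped ∙ antisymmetric r ∙ cong -ᶻ_ (coef-rank uq)
        where
        swapped : r ⊕ s ⊖ t ≗ r ∘ τ
        swapped u with u ≟ s | u ≟ t
        ... | yes refl | _        = ⊖-at-other (r ⊕ s) (t≢s ∘ sym) ∙ r⊕s-s ∙ sym r-t
        ... | no _     | yes refl = cong₂ _-ᶻ_ r⊕s-t (e-same refl) ∙ sym r-s
        ... | no u≢s   | no u≢t   = ⊖-at-other (r ⊕ s) u≢t ∙ cong (r u +ᶻ_) (e-diff u≢s) ∙ ℤ.+-identityʳ _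

    robustAtOn : ∀ a → a s ≢ a t → RobustAtOn (suc (length xs)) es a vs
    robustAtOn a as≢at = c , proj₁ ∘ bounds , proj₂ ∘ bounds , vanishes c-symmetric , z , λ h →
      as≢at (ℤ.i-j≡0⇒i≡j (a s) (a t) (sym value′ ∙ h))
      where
      lemma : ∀ a b → 0ℤ +ᶻ (a *ᶻ -1ℤ +ᶻ (b *ᶻ 1ℤ +ᶻ 0ℤ)) ≡ b -ᶻ a
      lemma = solve-∀
      -- Lowering `s` in `r ⊕ s` gives back `r`, with coefficient 1; lowering `t` gives `r` with `s`
      -- and `t` exchanged, with coefficient -1.
      value′ : lin (formOn a vs) (coef es) (c ⊕ z) ≡ a s -ᶻ a t
      value′ = lin-cong (formOn a vs) (coef-cong es) c⊕z
        ∙ cong (λ l → lin l (coef es) (r ⊕ s)) (List.map-++ (λ v → a v , v) (z ∷ xs) (t ∷ s ∷ []))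
        ∙ lin-++ (formOn a (z ∷ xs)) (coef es) (r ⊕ s)
        ∙ cong₂ _+ᶻ_ (lin-zero a (z ∷ xs) at-other) (cong₂ (λ p q → a t *ᶻ p +ᶻ (a s *ᶻ q +ᶻ 0ℤ)) at-t at-s)
        ∙ lemma (a t) (a s)

length-enumeration : ∀ {n} {vs : List (Fin n)} → vs ↭ allFin n → length vs ≡ n
length-enumeration p = Perm.↭-length p ∙ List.length-tabulate id

robust-complete : ∀ {n} {R : Fin (2 + n) → Fin (2 + n) → Set} → 1 ≤ n → (∀ {u v} → R u v → u ≢ v) →
                  (∀ {u v} → u ≢ v → R u v) → ∀ {es} → EdgeList R es → Robust n es
robust-complete {n} 1≤n sound′ complete′ {es} E a (s , t , as≢at)
  with as , bs , p ← ∈-∃++ (enum-complete s)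
  with ↭₁ ← subst (_↭ s ∷ as ++ bs) (sym p) (shift s as bs)
  with cs , ds , q ← ∈-∃++ (case ∈-resp-↭ ↭₁ (enum-complete t) of λ
                              { (here t≡s) → contradiction (cong a (sym t≡s)) as≢at ; (there m) → m })
  with ↭₂ ← ↭-trans ↭₁ (Perm.prep s (subst (_↭ t ∷ cs ++ ds) (sym q) (shift t cs ds)))
  with cs ++ ds
-- A third vertex, in the role of `z`, exists because there are at least three vertices.
... | [] = contradiction (sym (length-enumeration (↭-sym ↭₂))) λ { refl → case 1≤n of λ () }
... | z ∷ xs = subst (λ d → RobustAt d es a) (ℕ.suc-injective (ℕ.suc-injective (length-enumeration (↭-sym ↭₂))))
    (robustAt-transfer {es = es} {a = a} (↭-sym ↭₃) E E′ (X.robustAtOn a as≢at))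
  where
  vs = z ∷ xs ++ t ∷ s ∷ []
  ↭₃ : allFin (2 + n) ↭ vs
  ↭₃ = ↭-trans ↭₂ (↭-trans (Perm.++-comm (s ∷ t ∷ []) (z ∷ xs)) (Perm.++⁺ˡ (z ∷ xs) (Perm.swap s t ↭-refl)))
  uq : Unique vs
  uq = AllPairs-resp-↭ (λ p q → p (sym q)) ↭₃ enum-unique
  all : ∀ v → v ∈ₗ vs
  all v = ∈-resp-↭ ↭₃ (enum-complete v)
  module X = Complete uq all
  E′ = let E″ = edgeList-complete uq all in
       record { apart = apart E″ ; sound = complete′ ∘ sound E″ ; complete = complete E″ ∘ sound′ }

-- Odd cycles

path : V → List V → List (V × V)
path x []       = []
path x (y ∷ ys) = (y , x) ∷ path y ys

path-++ : ∀ (x : V) ys z zs → path x (ys ++ z ∷ zs) ≡ path x (ys ++ z ∷ []) ++ path z zs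
path-++ x []       z zs = refl
path-++ x (y ∷ ys) z zs = cong ((y , x) ∷_) (path-++ y ys z zs)

path-ends : ∀ (x : V) ys → All (λ (u , v) → u ∈ₗ x ∷ ys × v ∈ₗ x ∷ ys) (path x ys)
path-ends x []       = []
path-ends x (y ∷ ys) = (there (here refl) , here refl) ∷ All.map (Product.map there there) (path-ends y ys)

path-apart : ∀ (x : V) ys → Unique (x ∷ ys) → AllPairs Apart (path x ys)
path-apart x []       uq        = []
path-apart x (y ∷ ys) (x∉ ∷ uq) =
  All.map (λ (p , q) → (λ h → All.lookup x∉ q (cong proj₂ h)) , (λ h → All.lookup x∉ p (cong proj₂ h))) (path-ends y ys)
  ∷ path-apart y ys uq

cycle : V → List V → List (V × V)
cycle x xs = path x (xs ++ x ∷ [])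

private
  rotate-unique : ∀ {x : V} {ys : List V} → Unique (x ∷ ys) → Unique (ys ++ x ∷ [])
  rotate-unique {x = x} {ys} = AllPairs-resp-↭ (λ p q → p (sym q)) (Perm.∷↭∷ʳ x ys)

-- Without the edge from x to y a path on the rotated list remains, and in it only the edge from y
-- to z has y as an end.
cycle-apart : ∀ (x y z : V) ys → Unique (x ∷ y ∷ z ∷ ys) → AllPairs Apart (cycle x (y ∷ z ∷ ys))
cycle-apart x y z ys uq@((x≢y ∷ x≢z ∷ _) ∷ (y≢z ∷ y∉) ∷ _) =
  (((λ h → y≢z (cong proj₁ h)) , (λ h → x≢z (cong proj₂ h)))
   ∷ All.map (λ (p , q) → (λ h → y∉rest (subst (_∈ₗ _) (sym (cong proj₁ h)) p)) , (λ h → y∉rest (subst (_∈ₗ _) (sym (cong proj₁ h)) q)))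
       (path-ends z (ys ++ x ∷ [])))
  ∷ path-apart y (z ∷ ys ++ x ∷ []) (rotate-unique uq)
  where
  y∉rest : y ∉ₗ z ∷ ys ++ x ∷ []
  y∉rest m with ∈ₗ.∈-++⁻ (z ∷ ys) m
  ... | inj₁ m′          = All.lookup (y≢z ∷ y∉) m′ refl
  ... | inj₂ (here y≡x) = x≢y (sym y≡x)

-- Otherwise `a` would keep the value `a x` along the whole list.
consecutive : ∀ (a : V → ℤ) x xs {u} → u ∈ₗ x ∷ xs → a u ≢ a x →
              ∃ λ pre → ∃ λ s → ∃ λ t → ∃ λ post → x ∷ xs ≡ pre ++ s ∷ t ∷ post × a s ≢ a t
consecutive a x xs       (here refl) a≢ = contradiction refl a≢
consecutive a x (y ∷ ys) (there m)   a≢ with a y ℤ.≟ a x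
... | no ay≢ax = [] , x , y , ys , refl , ay≢ax ∘ sym
... | yes ay≡ax with pre , s , t , post , eq , h ← consecutive a y ys m (a≢ ∘ (_∙ ay≡ax)) =
  x ∷ pre , s , t , post , cong (x ∷_) eq , h

-- Cuts the cycle open at the chosen edge, so that its coefficients reduce to those of a path from
-- `t` to `s`.
cycle-rotate : ∀ (x : V) xs pre s t post → x ∷ xs ≡ pre ++ s ∷ t ∷ post →
               cycle x xs ↭ (t , s) ∷ path t ((post ++ pre) ++ s ∷ [])
cycle-rotate x .(t ∷ post) [] .x t post refl =
  subst (λ l → (t , x) ∷ path t (post ++ x ∷ []) ↭ (t , x) ∷ path t (l ++ x ∷ [])) (sym (List.++-identityʳ post)) ↭-refl
cycle-rotate x xs (.x ∷ pre) s t post refl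
  rewrite List.++-assoc pre (s ∷ t ∷ post) (x ∷ []) | List.++-assoc post (x ∷ pre) (s ∷ [])
        | path-++ x pre s (t ∷ post ++ x ∷ []) | path-++ t post x (pre ++ s ∷ []) =
  ↭-trans (shift (t , s) (path x (pre ++ s ∷ [])) (path t (post ++ x ∷ [])))
    (Perm.prep (t , s) (Perm.++-comm (path x (pre ++ s ∷ [])) (path t (post ++ x ∷ []))))

module _ {{_ : Index V}} where

  1̂ : Exponent V
  1̂ _ = 1ℤ

  path-untouched : ∀ {x : V} {ys v} → v ∉ₗ x ∷ ys → Untouched v (path x ys)
  path-untouched {x} {ys} v∉ =
    All.map (λ (p , q) → (λ { refl → v∉ p }) , (λ { refl → v∉ q })) (path-ends x ys)

  coef-zero-cons : ∀ (x y : V) es (c : Exponent V) → coef es (c ⊖ x) ≡ 0ℤ → coef es (c ⊖ y) ≡ 0ℤ → coef ((x , y) ∷ es) c ≡ 0ℤ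
  coef-zero-cons x y es c p q = cong₂ _-ᶻ_ p q

  ⊖-at-self : ∀ (c : Exponent V) v → (c ⊖ v) v ≡ c v -ᶻ 1ℤ
  ⊖-at-self c v = cong (λ z → c v -ᶻ z) (e-same refl)

  -- The exponent 0 at the start forces the first edge to choose its later end, and so on along the
  -- path; no sign arises.
  path-forward : ∀ (x : V) ys (c : Exponent V) → Unique (x ∷ ys) → (∀ u → u ∈ₗ ys → c u ≡ 1ℤ) → (∀ u → u ∉ₗ ys → c u ≡ 0ℤ) →
                 coef (path x ys) c ≡ 1ℤ
  path-forward x []       c uq on off = δ-zero λ u → off u λ ()
  path-forward x (y ∷ ys) c ((x∉ ∷ uq)) on off = cong₂ _-ᶻ_
    (path-forward y ys (c ⊖ y) uq
      (λ u m → ⊖-at-other c (λ { refl → All.lookup (AllPairs.head uq) m refl }) ∙ on u (there m))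
      (λ u u∉ → off′ u u∉))
    (coef-negative (path y ys) {x} (c ⊖ x)
      (subst (_<ᶻ 0ℤ) (sym (⊖-at-self c x ∙ cong (_-ᶻ 1ℤ) (off x (unique-∉ x∉)))) ℤ.-<+))
    where
    off′ : ∀ u → u ∉ₗ ys → (c ⊖ y) u ≡ 0ℤ
    off′ u u∉ with u ≟ y
    ... | yes refl = ⊖-at-self c y ∙ cong (_-ᶻ 1ℤ) (on y (here refl))
    ... | no u≢y   = ⊖-at-other c u≢y ∙ off u λ { (here p) → u≢y p ; (there m) → u∉ m }

  -- The exponent 1 at the start can come only from the first edge, and so on along the path; every
  -- edge contributes a sign.
  path-backward : ∀ (x : V) ys s (c : Exponent V) → Unique (x ∷ ys ++ s ∷ []) →
                  (∀ u → u ∈ₗ x ∷ ys → c u ≡ 1ℤ) → (∀ u → u ∉ₗ x ∷ ys → c u ≡ 0ℤ) →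
                  coef (path x (ys ++ s ∷ [])) c ≡ sgn (suc (length ys))
  path-backward x [] s c ((x≢s ∷ []) ∷ _) on off = cong₂ _-ᶻ_
    (δ-nonzero s λ h → case sym h ∙ ⊖-at-self c s ∙ cong (_-ᶻ 1ℤ) (off s λ { (here p) → x≢s (sym p) }) of λ ())
    (δ-zero at)
    where
    at : ∀ u → (c ⊖ x) u ≡ 0ℤ
    at u with u ≟ x
    ... | yes refl = ⊖-at-self c x ∙ cong (_-ᶻ 1ℤ) (on x (here refl))
    ... | no u≢x   = ⊖-at-other c u≢x ∙ off u λ { (here p) → u≢x p }
  path-backward x (y ∷ ys) s c (x∉@(x≢y ∷ _) ∷ uq) on off =
    cong₂ _-ᶻ_
      (coef-untouched (path-untouched (unique-∉ x∉)) (c ⊖ y)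
        λ h → case sym h ∙ ⊖-at-other c x≢y ∙ on x (here refl) of λ ())
      (path-backward y ys s (c ⊖ x) uq
        (λ u m → ⊖-at-other c (λ { refl → All.lookup x∉ (∈ₗ.∈-++⁺ˡ m) refl }) ∙ on u (there m)) off′)
    ∙ ℤ.+-identityˡ _
    where
    off′ : ∀ u → u ∉ₗ y ∷ ys → (c ⊖ x) u ≡ 0ℤ
    off′ u u∉ with u ≟ x
    ... | yes refl = ⊖-at-self c x ∙ cong (_-ᶻ 1ℤ) (on x (here refl))
    ... | no u≢x   = ⊖-at-other c u≢x ∙ off u λ { (here p) → u≢x p ; (there m) → u∉ m }

  -- The ends of a path have degree 1.
  path-first : ∀ (x y : V) ys (c : Exponent V) → Unique (x ∷ y ∷ ys) → c x ≡ + 2 → coef (path x (y ∷ ys)) c ≡ 0ℤ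
  path-first x y ys c (x∉@(x≢y ∷ _) ∷ uq) cx = coef-zero-cons y x (path y ys) c
    (coef-untouched un (c ⊖ y) λ h → case sym h ∙ ⊖-at-other c x≢y ∙ cx of λ ())
    (coef-untouched un (c ⊖ x) λ h → case sym h ∙ ⊖-at-self c x ∙ cong (_-ᶻ 1ℤ) cx of λ ())
    where
    un = path-untouched (unique-∉ x∉)

  path-last : ∀ (x : V) ys s (c : Exponent V) → Unique (x ∷ ys ++ s ∷ []) → c s ≡ + 2 → coef (path x (ys ++ s ∷ [])) c ≡ 0ℤ
  path-last x [] s c ((x≢s ∷ []) ∷ _) cs = coef-zero-cons s x [] c
    (δ-nonzero s λ h → case sym h ∙ ⊖-at-self c s ∙ cong (_-ᶻ 1ℤ) cs of λ ())
    (δ-nonzero s λ h → case sym h ∙ ⊖-at-other c (x≢s ∘ sym) ∙ cs of λ ())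
  path-last x (y ∷ ys) s c (x∉ ∷ uq) cs = coef-zero-cons y x (path y (ys ++ s ∷ [])) c
    (path-last y ys s (c ⊖ y) uq (⊖-at-other c (s≢y uq) ∙ cs))
    (path-last y ys s (c ⊖ x) uq (⊖-at-other c (λ { refl → All.lookup x∉ (there (∈ₗ.∈-++⁺ʳ ys (here refl))) refl }) ∙ cs))
    where
    s≢y : Unique (y ∷ ys ++ s ∷ []) → s ≢ y
    s≢y (y∉ ∷ _) refl = All.lookup y∉ (∈ₗ.∈-++⁺ʳ ys (here refl)) refl

  -- For adjacent vertices s and t of the cycle, the entries for s and t
  -- of the transformed form add up to a s − a t.
  module OddCycle {t s : V} {ys : List V} (uq : Unique (t ∷ ys ++ s ∷ [])) (all : ∀ v → v ∈ₗ t ∷ ys ++ s ∷ [])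
                  (odd : 2 ∤ length (t ∷ ys ++ s ∷ [])) where

    vs : List V
    vs = t ∷ ys ++ s ∷ []

    private
      Q = coef (path t (ys ++ s ∷ []))

      Q-cong : Congruent Q
      Q-cong = coef-cong (path t (ys ++ s ∷ []))

      es : List (V × V)
      es = (t , s) ∷ path t (ys ++ s ∷ [])

      t∉ : t ∉ₗ ys ++ s ∷ []
      t∉ = case uq of λ { (p ∷ _) → unique-∉ p }

      t≢s : t ≢ s
      t≢s refl = t∉ (∈ₗ.∈-++⁺ʳ ys (here refl))

      s∉init : ∀ (xs : List V) → Unique (xs ++ s ∷ []) → s ∉ₗ xs
      s∉init (x ∷ xs) (x∉ ∷ uq) (here refl) = unique-∉ x∉ (∈ₗ.∈-++⁺ʳ xs (here refl))
      s∉init (x ∷ xs) (x∉ ∷ uq) (there m)   = s∉init xs uq m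

      s∉ : s ∉ₗ t ∷ ys
      s∉ = s∉init (t ∷ ys) uq

      Q-forward : Q (1̂ ⊖ t) ≡ 1ℤ
      Q-forward = path-forward t (ys ++ s ∷ []) (1̂ ⊖ t) uq
        (λ u m → ⊖-at-other 1̂ λ { refl → t∉ m })
        (λ u u∉ → case all u of λ { (here refl) → ⊖-at-self 1̂ t ; (there m) → contradiction m u∉ })

      Q-backward : Q (1̂ ⊖ s) ≡ 1ℤ
      Q-backward = path-backward t ys s (1̂ ⊖ s) uq
        (λ u m → ⊖-at-other 1̂ λ { refl → s∉ m })
        (λ u u∉ → case ∈ₗ.∈-++⁻ (t ∷ ys) (all u) of λ
          { (inj₁ m) → contradiction m u∉ ; (inj₂ (here refl)) → ⊖-at-self 1̂ s })
        ∙ sym (ℤ.neg-involutive (sgn (suc (length ys))))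
        ∙ cong -ᶻ_ (cong sgn (cong suc (sym (List.length-++ ys ∙ ℕ.+-comm (length ys) 1))) ∙ sgn-odd (length vs) odd)

      -- The all-one exponent arises from the two cyclic orientations only, and for odd length their
      -- signs are opposite.
      one : coef es 1̂ ≡ 0ℤ
      one = cong₂ _-ᶻ_ Q-forward Q-backward

      ⊕-at-self : ∀ (c : Exponent V) v → (c ⊕ v) v ≡ c v +ᶻ 1ℤ
      ⊕-at-self c v = cong (c v +ᶻ_) (e-same refl)

      ⊕-at-other : ∀ (c : Exponent V) {u v} → v ≢ u → (c ⊕ u) v ≡ c v
      ⊕-at-other c v≢u = cong (c _ +ᶻ_) (e-diff v≢u) ∙ ℤ.+-identityʳ _

      w : V → ℤ
      w u = Q (1̂ ⊕ s ⊖ u ⊖ t) -ᶻ Q (1̂ ⊕ t ⊖ u ⊖ s)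

      -- Choosing s from the edge (t , s) in the first entry and t in the second leaves `Q (1̂ ⊖ u)`
      -- both times, with opposite signs.
      add-up : ∀ u → coef es (1̂ ⊕ s ⊖ u) +ᶻ coef es (1̂ ⊕ t ⊖ u) ≡ w u
      add-up u = cong₂ (λ p q → Q (1̂ ⊕ s ⊖ u ⊖ t) -ᶻ p +ᶻ (q -ᶻ Q (1̂ ⊕ t ⊖ u ⊖ s))) (cancel s) (cancel t)
        ∙ lemma (Q (1̂ ⊕ s ⊖ u ⊖ t)) (Q (1̂ ⊖ u)) (Q (1̂ ⊕ t ⊖ u ⊖ s))
        where
        lemma : ∀ a b c → a -ᶻ b +ᶻ (b -ᶻ c) ≡ a -ᶻ c
        lemma = solve-∀
        cancel : ∀ v → Q (1̂ ⊕ v ⊖ u ⊖ v) ≡ Q (1̂ ⊖ u)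
        cancel v = Q-cong λ x → ⊖-comm (1̂ ⊕ v) u v x ∙ ⊖-cong {c = 1̂ ⊕ v ⊖ v} {d = 1̂} u (⊕⊖-cancel 1̂ v) x

      Q-at-2 : ∀ {u v} → u ≢ v → (∀ c → c v ≡ + 2 → Q c ≡ 0ℤ) → ∀ {x} → x ≢ v → Q (1̂ ⊕ v ⊖ u ⊖ x) ≡ 0ℤ
      Q-at-2 {u} {v} u≢v vanish {x} x≢v = vanish (1̂ ⊕ v ⊖ u ⊖ x)
        (⊖-at-other (1̂ ⊕ v ⊖ u) (x≢v ∘ sym) ∙ ⊖-at-other (1̂ ⊕ v) (u≢v ∘ sym) ∙ ⊕-at-self 1̂ v)

      Q-at-s : ∀ c → c s ≡ + 2 → Q c ≡ 0ℤ
      Q-at-s c = path-last t ys s c uq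

      first : ∀ zs c → Unique (t ∷ zs) → zs ≢ [] → c t ≡ + 2 → coef (path t zs) c ≡ 0ℤ
      first []       c uq ne ct = contradiction refl ne
      first (z ∷ zs) c uq ne ct = path-first t z zs c uq ct

      Q-at-t : ∀ c → c t ≡ + 2 → Q c ≡ 0ℤ
      Q-at-t c = first (ys ++ s ∷ []) c uq λ h →
        case sym (List.length-++ ys ∙ ℕ.+-comm (length ys) 1) ∙ cong length h of λ ()

      Q-at-−1 : ∀ {u v} → u ≢ v → Q (1̂ ⊕ u ⊖ v ⊖ v) ≡ 0ℤ
      Q-at-−1 {u} {v} u≢v = coef-negative (path t (ys ++ s ∷ [])) {v} (1̂ ⊕ u ⊖ v ⊖ v)
        (subst (_<ᶻ 0ℤ) (sym (⊖-at-self (1̂ ⊕ u ⊖ v) v ∙ cong (_-ᶻ 1ℤ) (⊖-at-self (1̂ ⊕ u) v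
          ∙ cong (_-ᶻ 1ℤ) (⊕-at-other 1̂ (u≢v ∘ sym))))) ℤ.-<+)

      -- In both terms an end of the path keeps exponent 2, but it lies on only one edge of the
      -- path.
      w-else : ∀ {u} → u ∈ₗ ys → w u ≡ 0ℤ
      w-else {u} m = cong₂ _-ᶻ_ (Q-at-2 u≢s Q-at-s t≢s) (Q-at-2 u≢t Q-at-t (t≢s ∘ sym))
        where
        u≢s : u ≢ s
        u≢s refl = s∉ (there m)
        u≢t : u ≢ t
        u≢t refl = t∉ (∈ₗ.∈-++⁺ˡ m)

      w-t : w t ≡ -1ℤ
      w-t = cong₂ _-ᶻ_ (Q-at-−1 (t≢s ∘ sym)) (Q-cong (⊖-cong {c = 1̂ ⊕ t ⊖ t} {d = 1̂} s (⊕⊖-cancel 1̂ t)) ∙ Q-backward)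

      w-s : w s ≡ 1ℤ
      w-s = cong₂ _-ᶻ_ (Q-cong (⊖-cong {c = 1̂ ⊕ s ⊖ s} {d = 1̂} t (⊕⊖-cancel 1̂ s)) ∙ Q-forward) (Q-at-−1 t≢s)

    module _ (a : V → ℤ) where

      private
        L : List V → Exponent V → ℤ
        L us = lin (formOn a us) (coef es)

        combine : ∀ us → L us (1̂ ⊕ s) +ᶻ L us (1̂ ⊕ t) ≡ Σ[ us ] λ u → a u *ᶻ w u
        combine []       = refl
        combine (u ∷ us) =
          lemma (a u) (coef es (1̂ ⊕ s ⊖ u)) (L us (1̂ ⊕ s)) (coef es (1̂ ⊕ t ⊖ u)) (L us (1̂ ⊕ t))
          ∙ cong₂ (λ p q → a u *ᶻ p +ᶻ q) (add-up u) (combine us)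
          where
          lemma : ∀ a p l q m → a *ᶻ p +ᶻ l +ᶻ (a *ᶻ q +ᶻ m) ≡ a *ᶻ (p +ᶻ q) +ᶻ (l +ᶻ m)
          lemma = solve-∀

        sum : L vs (1̂ ⊕ s) +ᶻ L vs (1̂ ⊕ t) ≡ a s -ᶻ a t
        sum = combine vs ∙ cong₂ _+ᶻ_ (cong (a t *ᶻ_) w-t)
            (Σ-++ ys (λ u → a u *ᶻ w u) ∙ cong₂ _+ᶻ_ (Σ-zero ys λ u m → cong (a u *ᶻ_) (w-else m) ∙ ℤ.*-zeroʳ (a u))
                                    (cong (λ p → a s *ᶻ p +ᶻ 0ℤ) w-s))
          ∙ lemma (a t) (a s)
          where
          lemma : ∀ a b → a *ᶻ -1ℤ +ᶻ (0ℤ +ᶻ (b *ᶻ 1ℤ +ᶻ 0ℤ)) ≡ b -ᶻ a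
          lemma = solve-∀

        bounds : ∀ {z} → z ≢ 0ℤ → ∀ v → L vs (1̂ ⊕ v) ≡ z → RobustAtOn 1 es a vs
        bounds nz v q = 1̂ , (λ _ → ℤ.+≤+ z≤n) , (λ _ → ℤ.≤-refl) , one , v , nz ∘ (sym q ∙_)

      -- Two entries with nonzero sum cannot both vanish; the vertex to raise is whichever of `s`
      -- and `t` has a nonzero entry.
      oddCycle-robustAtOn : a s ≢ a t → RobustAtOn 1 es a vs
      oddCycle-robustAtOn as≢at with L vs (1̂ ⊕ s) ℤ.≟ 0ℤ | L vs (1̂ ⊕ t) ℤ.≟ 0ℤ
      ... | no nz | _     = bounds nz s refl
      ... | yes _ | no nz = bounds nz t refl
      ... | yes p | yes q = contradiction (ℤ.i-j≡0⇒i≡j (a s) (a t) (sym sum ∙ cong₂ _+ᶻ_ p q)) as≢at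

robust-oddCycle : ∀ {{_ : Index V}} {R : V → V → Set} {x xs} → Unique (x ∷ xs) → (∀ v → v ∈ₗ x ∷ xs) →
                  EdgeList R (cycle x xs) → 2 ∤ length (x ∷ xs) → ∀ {es} → EdgeList R es → Robust 1 es
robust-oddCycle {V} {R = R} {x} {xs} uq all C odd {es} E a (s₀ , t₀ , a≢) =
  rotated (case a s₀ ℤ.≟ a x of λ
    { (no h)  → consecutive a x xs (all s₀) h
    ; (yes h) → consecutive a x xs (all t₀) λ h′ → a≢ (h ∙ sym h′) })
  where
  rotated : (∃ λ pre → ∃ λ s → ∃ λ t → ∃ λ post → x ∷ xs ≡ pre ++ s ∷ t ∷ post × a s ≢ a t) → RobustAt 1 es a
  rotated (pre , s , t , post , eq , as≢at) =
    robustAt-transfer {es = es} {fs} {a} {vs} (enumeration-↭ uq′ all′) E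
      (EdgeList-resp-↭ (cycle-rotate x xs pre s t post eq) C) (X.oddCycle-robustAtOn a as≢at)
    where
    fs : List (V × V)
    fs = (t , s) ∷ path t ((post ++ pre) ++ s ∷ [])
    vs : List V
    vs = t ∷ (post ++ pre) ++ s ∷ []
    p : x ∷ xs ↭ vs
    p = subst (_↭ vs) (sym eq) (↭-trans (Perm.++-comm pre (s ∷ t ∷ post)) (Perm.∷↭∷ʳ s (t ∷ post ++ pre)))
    uq′ : Unique vs
    uq′ = AllPairs-resp-↭ (λ p q → p (sym q)) p uq
    all′ : ∀ v → v ∈ₗ vs
    all′ v = ∈-resp-↭ p (all v)
    module X = OddCycle uq′ all′ (subst (2 ∤_) (Perm.↭-length p) odd)

module _ {P : V → V → Set} where

  cycle-all : ∀ {m} (f : Fin (suc m) → V) z → (∀ i j → toℕ j ≡ suc (toℕ i) → P (f j) (f i)) → P z (f (Fin.fromℕ m)) →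
              All (λ (y , x) → P y x) (path (f zero) (List.tabulate (f ∘ suc) ++ z ∷ []))
  cycle-all {zero}  f z next last = last ∷ []
  cycle-all {suc m} f z next last =
    next zero (suc zero) refl ∷ cycle-all (f ∘ suc) z (λ i j h → next (suc i) (suc j) (cong suc h)) last

cycle-next : ∀ {m} (f : Fin (suc m) → V) z i j → toℕ j ≡ suc (toℕ i) →
             (f j , f i) ∈ₗ path (f zero) (List.tabulate (f ∘ suc) ++ z ∷ [])
cycle-next {m = suc m} f z zero    (suc zero) h = here refl
cycle-next {m = suc m} f z (suc i) (suc j)    h = there (cycle-next (f ∘ suc) z i j (ℕ.suc-injective h))

cycle-last : ∀ {m} (f : Fin (suc m) → V) z →
             (z , f (Fin.fromℕ m)) ∈ₗ path (f zero) (List.tabulate (f ∘ suc) ++ z ∷ [])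
cycle-last {m = zero}  f z = here refl
cycle-last {m = suc m} f z = there (cycle-last (f ∘ suc) z)

robust-isOddCycle : ∀ {n} (K : Graph n) → IsOddCycle K → ∀ {es} → EdgeList (Adj K) es → Robust 1 es
robust-isOddCycle {suc (suc (suc n))} K (odd , _ , c , adj⇔) =
  robust-oddCycle {x = f zero} {List.tabulate (f ∘ suc)} uq all
    (record { apart = cycle-apart (f zero) (f (suc zero)) (f (suc (suc zero))) _ uq
            ; sound = λ { (inj₁ m) → All.lookup sound′ m ; (inj₂ m) → symm K (All.lookup sound′ m) }
            ; complete = complete′ })
    (λ 2∣ → odd (subst (2 ∣_) (List.length-tabulate f) 2∣))
  where
  ℓ = suc (suc (suc n))
  f : Fin ℓ → Fin ℓ
  f = c ⟨$⟩ʳ_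
  f⁻¹ : Fin ℓ → Fin ℓ
  f⁻¹ = c ⟨$⟩ˡ_
  uq : Unique (List.tabulate f)
  uq = Unique.tabulate⁺ {f = f} λ {i} {j} h → sym (inverseˡ c) ∙ cong f⁻¹ h ∙ inverseˡ c
  all : ∀ v → v ∈ₗ List.tabulate f
  all v = subst (_∈ₗ List.tabulate f) (inverseʳ c) (∈ₗ.∈-tabulate⁺ {f = f} (f⁻¹ v))
  sound′ : All (λ (y , x) → Adj K y x) (cycle (f zero) (List.tabulate (f ∘ suc)))
  sound′ = cycle-all f (f zero)
    (λ i j h → symm K (Equivalence.from (adj⇔ i j) (inj₁ (inj₁ h))))
    (symm K (Equivalence.from (adj⇔ (Fin.fromℕ _) zero) (inj₁ (inj₂ (cong suc (Fin.toℕ-fromℕ (suc (suc n))) , refl)))))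
  next∈ : ∀ i j → CyclicNext i j → (f j , f i) ∈ₗ cycle (f zero) (List.tabulate (f ∘ suc))
  next∈ i j (inj₁ h) = cycle-next f (f zero) i j h
  next∈ i j (inj₂ (h , h′))
    rewrite Fin.toℕ-injective {i = j} {j = zero} h′
          | Fin.toℕ-injective {i = i} {j = Fin.fromℕ (suc (suc n))} (ℕ.suc-injective h ∙ sym (Fin.toℕ-fromℕ (suc (suc n)))) =
    cycle-last f (f zero)
  complete′ : ∀ {x y} → Adj K x y → Joins (cycle (f zero) (List.tabulate (f ∘ suc))) x y
  complete′ {x} {y} adj with Equivalence.to (adj⇔ (f⁻¹ x) (f⁻¹ y))
                               (subst (λ v → Adj K v (f (f⁻¹ y))) (sym (inverseʳ c)) (subst (Adj K x) (sym (inverseʳ c)) adj))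
  ... | inj₁ nx = inj₂ (subst (λ v → (v , x) ∈ₗ _) (inverseʳ c) (subst (λ v → (f (f⁻¹ y) , v) ∈ₗ _) (inverseʳ c) (next∈ _ _ nx)))
  ... | inj₂ nx = inj₁ (subst (λ v → (v , y) ∈ₗ _) (inverseʳ c) (subst (λ v → (f (f⁻¹ x) , v) ∈ₗ _) (inverseʳ c) (next∈ _ _ nx)))
robust-isOddCycle {suc (suc zero)} K (_ , s≤s (s≤s ()) , _)
robust-isOddCycle {suc zero}       K (_ , s≤s () , _)
robust-isOddCycle {zero}           K (_ , () , _)

-- Assembling the parts

module Parts {{_ : Index V}} {R : V → V → Set} (R-sym : Symmetric R) {m : ℕ} (part : V → Fin m)
             {U : Fin m → Set} {{index : ∀ {i} → Index (U i)}} {R′ : ∀ i → U i → U i → Set}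
             (φ : ∀ i → U i → V) (φ-injective : ∀ i {u u′} → φ i u ≡ φ i u′ → u ≡ u′)
             (part-φ : ∀ i u → part (φ i u) ≡ i) (φ-onto : ∀ v → ∃ λ u → φ (part v) u ≡ v)
             (R′⇒R : ∀ i {u u′} → R′ i u u′ → R (φ i u) (φ i u′))
             (R⇒R′ : ∀ i {u u′} → R (φ i u) (φ i u′) → R′ i u u′)
             (lower : ∀ i → U i → List V) (lower-unique : ∀ i u → Unique (lower i u))
             (lower-sound : ∀ i u {y} → y ∈ₗ lower i u → R (φ i u) y × toℕ (part y) < toℕ i)
             (lower-complete : ∀ i u {y} → R (φ i u) y → toℕ (part y) < toℕ i → y ∈ₗ lower i u)
             {b : ℕ} (part-coef : ∀ i → ∃ λ es → EdgeList (R′ i) es × ∃ λ f →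
               coef es f ≢ 0ℤ × (∀ u → f u +ᶻ + length (lower i u) ≤ᶻ + b))
             where

  Below : ℕ → V → Set
  Below t v = toℕ (part v) < t

  Upto : ℕ → Set
  Upto t = ∃ λ fs → EdgeList (R ↾ Below t) fs × ∃ λ c →
    coef fs c ≢ 0ℤ × (∀ v → c v ≤ᶻ + b) × (∀ v → ¬ Below t v → c v ≡ 0ℤ)

  step : ∀ i → Upto (toℕ i) → Upto (suc (toℕ i))
  step i (fs , F , c , c-nz , c≤b , c0) with es , E , f , f-nz , f≤b ← part-coef i =
    X.extend es cr fs
    , X.edgeList-extend R-sym (R′⇒R i) (R⇒R′ i) below-off (ℕ.m≤n⇒m≤1+n) (λ u → ℕ.≤-reflexive (cong suc (cong toℕ (part-φ i u))))
        split E F (cr-unique enum-unique) cr-sound cr-complete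
    , X.join (f ∔ X.tally cr) c
    , (λ h → [ f-nz , c-nz ]′ (ℤ.i*j≡0⇒i≡0∨j≡0 (coef es f) (sym (X.coef-block {es = es} {cr} offs out f-nz (λ u → c0 _ (λ lt → below-off lt u refl))) ∙ h)))
    , bounded , vanishes
    where
    module X = Block (φ i) (φ-injective i)
    star : U i → List (U i × V)
    star u = List.map (u ,_) (lower i u)
    cr = concatMap star enum
    below-off : ∀ {v} → Below (toℕ i) v → X.Off v
    below-off lt u refl = ℕ.<-irrefl (cong toℕ (part-φ i u)) lt
    split : ∀ {v} → Below (suc (toℕ i)) v → Below (toℕ i) v ⊎ ∃ λ u → φ i u ≡ v
    split {v} (s≤s le) with ℕ.m≤n⇒m<n∨m≡n le
    ... | inj₁ lt = inj₁ lt
    ... | inj₂ eq = inj₂ (subst (λ j → ∃ λ u → φ j u ≡ v) (Fin.toℕ-injective eq) (φ-onto v))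
    cr-member : ∀ {u y} → (u , y) ∈ₗ cr → y ∈ₗ lower i u
    cr-member k with w , _ , k′ ← ∈ₗ.find (∈ₗ.∈-concatMap⁻ star {xs = enum} k) with _ , k″ , refl ← ∈ₗ.∈-map⁻ _ k′ = k″
    cr-sound : ∀ {u y} → (u , y) ∈ₗ cr → R (φ i u) y × Below (toℕ i) y
    cr-sound k = lower-sound i _ (cr-member k)
    cr-complete : ∀ {u y} → R (φ i u) y → Below (toℕ i) y → (u , y) ∈ₗ cr
    cr-complete {u} r lt = ∈ₗ.∈-concatMap⁺ star
      (Any.map (λ { refl → ∈ₗ.∈-map⁺ _ (lower-complete i u r lt) }) (enum-complete u))
    cr-unique : ∀ {us} → Unique us → Unique (concatMap star us)
    cr-unique [] = []
    cr-unique {u ∷ us} (u∉ ∷ uq) = Unique.++⁺ (Unique.map⁺ (cong proj₂) (lower-unique i u)) (cr-unique uq)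
      λ (k , k′) → case ∈ₗ.∈-map⁻ _ k of λ { (_ , _ , refl) →
        case ∈ₗ.find (∈ₗ.∈-concatMap⁻ star {xs = us} k′) of λ (w , w∈ , k″) →
          case ∈ₗ.∈-map⁻ _ k″ of λ { (_ , _ , refl) → All.lookup u∉ w∈ refl } }
    offs : X.OffTargets cr
    offs = All.tabulate (below-off ∘ proj₂ ∘ cr-sound)
    out : X.Outside fs
    out = All.tabulate λ k → case sound F (inj₁ k) of λ (_ , p , q) → below-off p , below-off q
    tally-star : ∀ u ys us → X.tally (List.map (u ,_) ys ++ us) u ≡ + length ys +ᶻ X.tally us u
    tally-star u []       us = sym (ℤ.+-identityˡ _)
    tally-star u (y ∷ ys) us = cong₂ _+ᶻ_ (tally-star u ys us) (e-same refl) ∙ lemma (+ length ys) (X.tally us u)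
      where
      lemma : ∀ a b → a +ᶻ b +ᶻ 1ℤ ≡ 1ℤ +ᶻ a +ᶻ b
      lemma = solve-∀
    tally-other : ∀ {u w} ys us → u ≢ w → X.tally (List.map (w ,_) ys ++ us) u ≡ X.tally us u
    tally-other []       us u≢w = refl
    tally-other (y ∷ ys) us u≢w = cong₂ _+ᶻ_ (tally-other ys us u≢w) (e-diff u≢w) ∙ ℤ.+-identityʳ _
    tally-∉ : ∀ {u} us → u ∉ₗ us → X.tally (concatMap star us) u ≡ 0ℤ
    tally-∉ []       u∉ = refl
    tally-∉ (w ∷ us) u∉ = tally-other (lower i w) _ (λ { refl → u∉ (here refl) }) ∙ tally-∉ us (u∉ ∘ there)
    tally-∈ : ∀ {u us} → Unique us → u ∈ₗ us → X.tally (concatMap star us) u ≡ + length (lower i u)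
    tally-∈ {u} {_ ∷ us} (u∉ ∷ uq) (here refl) =
      tally-star u (lower i u) _ ∙ cong (+ length (lower i u) +ᶻ_) (tally-∉ us (unique-∉ u∉)) ∙ ℤ.+-identityʳ _
    tally-∈ {u} {w ∷ us} (w∉ ∷ uq) (there k) =
      tally-other (lower i w) _ (λ { refl → All.lookup w∉ k refl }) ∙ tally-∈ uq k
    bounded : ∀ v → X.join (f ∔ X.tally cr) c v ≤ᶻ + b
    bounded v with X.image? v
    ... | inj₂ off = subst (_≤ᶻ + b) (sym (X.join-out _ c off)) (c≤b v)
    ... | inj₁ (u , eq) = subst (_≤ᶻ + b)
      (cong (f u +ᶻ_) (sym (tally-∈ enum-unique (enum-complete u))) ∙ sym (X.join-in _ c eq)) (f≤b u)
    vanishes : ∀ v → ¬ Below (suc (toℕ i)) v → X.join (f ∔ X.tally cr) c v ≡ 0ℤ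
    vanishes v ¬lt with X.image? v
    ... | inj₂ off = X.join-out _ c off ∙ c0 v (¬lt ∘ ℕ.m≤n⇒m≤1+n)
    ... | inj₁ (u , refl) = contradiction (ℕ.≤-reflexive (cong suc (cong toℕ (part-φ i u)))) ¬lt

  upto : ∀ t → t ≤ m → Upto t
  upto zero t≤m = [] , record { apart = [] ; sound = λ { (inj₁ ()) ; (inj₂ ()) } ; complete = λ { (_ , () , _) } }
    , 0̂ , (λ h → case sym (δ-zero (λ _ → refl)) ∙ h of λ ()) , (λ _ → ℤ.+≤+ z≤n) , λ _ _ → refl
  upto (suc t) t<m = subst (Upto ∘ suc) (Fin.toℕ-fromℕ< t<m)
    (step (Fin.fromℕ< t<m) (subst Upto (sym (Fin.toℕ-fromℕ< t<m)) (upto t (ℕ.<⇒≤ t<m))))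

  result : ∃ λ fs → EdgeList R fs × ∃ λ c → coef fs c ≢ 0ℤ × (∀ v → c v ≤ᶻ + b)
  result with fs , F , c , nz , c≤b , _ ← upto m ℕ.≤-refl =
    fs , record { apart = apart F ; sound = proj₁ ∘ sound F ; complete = λ r → complete F (r , Fin.toℕ<n _ , Fin.toℕ<n _) }
    , c , nz , c≤b

-- Edge lists of graphs, and lists of elements of subsets

module _ {ℓ : ℕ} (K : Graph ℓ) where

  private
    adjacent? : (f : Fin ℓ × Fin ℓ) → Dec (Adj K (proj₁ f) (proj₂ f))
    adjacent? (x , y) = adj? K x y

  graphEdges : List (Fin ℓ × Fin ℓ)
  graphEdges = List.filter adjacent? (completeEdges (allFin ℓ))

  edgeList-graphEdges : EdgeList (Adj K) graphEdges
  edgeList-graphEdges = record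
    { apart    = AllPairs.filter⁺ adjacent? (apart C)
    ; sound    = λ { (inj₁ m) → proj₂ (∈ₗ.∈-filter⁻ adjacent? {xs = completeEdges (allFin ℓ)} m)
                   ; (inj₂ m) → symm K (proj₂ (∈ₗ.∈-filter⁻ adjacent? {xs = completeEdges (allFin ℓ)} m)) }
    ; complete = λ r → Sum.map (λ m → ∈ₗ.∈-filter⁺ adjacent? m r) (λ m → ∈ₗ.∈-filter⁺ adjacent? m (symm K r))
                               (complete C λ eq → irrefl K eq r) }
    where
    C = edgeList-complete (Unique.allFin⁺ ℓ) ∈ₗ.∈-allFin

-- One less than the common degree of the vertices of K, hence the bound d; it is α - ρ - 2.
slack : ∀ {ℓ} (K : Graph ℓ) → IsOddCycle K ⊎ IsComplete K → ℕ
slack {ℓ} K = [ (λ _ → 1) , (λ _ → ℓ ∸ 2) ]′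

robust-kind : ∀ {ℓ} (K : Graph ℓ) → 3 ≤ ℓ → (kind : IsOddCycle K ⊎ IsComplete K) →
              ∀ {es} → EdgeList (Adj K) es → Robust (slack K kind) es
robust-kind K 3≤ℓ (inj₁ odd) E = robust-isOddCycle K odd E
robust-kind K (s≤s (s≤s 1≤n)) (inj₂ full) E =
  robust-complete 1≤n (λ r eq → irrefl K eq r) (λ {u} {v} → full u v) E

some-nonConstant : ∀ {ℓ} → 3 ≤ ℓ → ∃ (NonConstant {Fin ℓ})
some-nonConstant (s≤s (s≤s _)) =
  e zero , zero , suc zero , λ h → case sym (e-same {u = zero} refl) ∙ h ∙ e-diff (λ ()) of λ ()

length-filter-tabulate : ∀ {n} {A : Set} {P : A → Set} (P? : ∀ x → Dec (P x)) (f : Fin n → A) (T : Subset n) →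
                         (∀ i → does (P? (f i)) ≡ lookup T i) → length (List.filter P? (List.tabulate f)) ≡ ∣ T ∣
length-filter-tabulate P? f [] h = refl
length-filter-tabulate P? f (b ∷ T) h with P? (f zero) | h zero
... | yes p | refl = cong suc (length-filter-tabulate P? (f ∘ suc) T (h ∘ suc))
... | no ¬p | refl = length-filter-tabulate P? (f ∘ suc) T (h ∘ suc)

module _ {n : ℕ} where

  does-∈? : ∀ (T : Subset n) i → does (i ∈? T) ≡ lookup T i
  does-∈? T i with i ∈? T | lookup T i in eq
  ... | yes p | inside  = refl
  ... | no _  | outside = refl
  ... | yes p | outside = case sym eq ∙ Vec.[]=⇒lookup p of λ ()
  ... | no ¬p | inside  = contradiction (Vec.lookup⇒[]= i T eq) ¬p

  length-elements : ∀ (T : Subset n) → length (elements T) ≡ ∣ T ∣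
  length-elements T = length-filter-tabulate (_∈? T) id T (does-∈? T)

  elements-unique : ∀ (T : Subset n) → Unique (elements T)
  elements-unique T = Unique.filter⁺ (_∈? T) (Unique.allFin⁺ n)

  ∈-elements⁺ : ∀ {T : Subset n} {i} → i ∈ T → i ∈ₗ elements T
  ∈-elements⁺ {T} i∈ = ∈ₗ.∈-filter⁺ (_∈? T) (∈ₗ.∈-allFin _) i∈

  ∈-elements⁻ : ∀ {T : Subset n} {i} → i ∈ₗ elements T → i ∈ T
  ∈-elements⁻ {T} m = proj₂ (∈ₗ.∈-filter⁻ (_∈? T) {xs = allFin n} m)

  ∈-⋃⁺ : ∀ {Ts : List (Subset n)} {T i} → T ∈ₗ Ts → i ∈ T → i ∈ ⋃ Ts
  ∈-⋃⁺ {T ∷ Ts} (here refl) i∈ = Subset.p⊆p∪q (⋃ Ts) i∈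
  ∈-⋃⁺ {T ∷ Ts} (there m)   i∈ = Subset.q⊆p∪q T (⋃ Ts) (∈-⋃⁺ m i∈)

  ∈-⋃⁻ : ∀ (Ts : List (Subset n)) {i} → i ∈ ⋃ Ts → ∃ λ T → T ∈ₗ Ts × i ∈ T
  ∈-⋃⁻ []       i∈ = contradiction i∈ Subset.∉⊥
  ∈-⋃⁻ (T ∷ Ts) i∈ with Subset.x∈p∪q⁻ T (⋃ Ts) i∈
  ... | inj₁ i∈T = T , here refl , i∈T
  ... | inj₂ i∈⋃ with T′ , m , i∈T′ ← ∈-⋃⁻ Ts i∈⋃ = T′ , there m , i∈T′

  ∈-⋃[<]⁺ : ∀ {m} {S : Fin m → Subset n} {i j v} → toℕ j < toℕ i → v ∈ S j → v ∈ ⋃[< i ] S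
  ∈-⋃[<]⁺ {S = S} {i} j<i v∈ = ∈-⋃⁺ (∈ₗ.∈-map⁺ S (∈ₗ.∈-filter⁺ (Fin._<? i) (∈ₗ.∈-allFin _) j<i)) v∈

  ∈-⋃[<]⁻ : ∀ {m} (S : Fin m → Subset n) i {v} → v ∈ ⋃[< i ] S → ∃ λ j → toℕ j < toℕ i × v ∈ S j
  ∈-⋃[<]⁻ {m} S i v∈ with T , k , v∈T ← ∈-⋃⁻ _ v∈ with j , k′ , refl ← ∈ₗ.∈-map⁻ S k =
    j , proj₂ (∈ₗ.∈-filter⁻ (Fin._<? i) {xs = allFin m} k′) , v∈T

  ∈-N⁺ : ∀ (G : Graph n) {u v} → Adj G u v → v ∈ N G u
  ∈-N⁺ G {u} {v} a = Vec.lookup⇒[]= v _ (Vec.lookup∘tabulate _ v ∙ dec-true (adj? G u v) a)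

  ∈-N⁻ : ∀ (G : Graph n) {u v} → v ∈ N G u → Adj G u v
  ∈-N⁻ G {u} {v} v∈ with adj? G u v | sym (Vec.lookup∘tabulate (λ w → does (adj? G u w)) v) ∙ Vec.[]=⇒lookup v∈
  ... | yes a | _ = a
  ... | no _  | ()

lookup-injective : ∀ {A : Set} {xs : List A} → Unique xs → ∀ {i j} → List.lookup xs i ≡ List.lookup xs j → i ≡ j
lookup-injective (x∉ ∷ uq) {zero}  {zero}  h = refl
lookup-injective (x∉ ∷ uq) {zero}  {suc j} h = contradiction h (All.lookup x∉ (∈ₗ.∈-lookup j))
lookup-injective (x∉ ∷ uq) {suc i} {zero}  h = contradiction (sym h) (All.lookup x∉ (∈ₗ.∈-lookup i))
lookup-injective (x∉ ∷ uq) {suc i} {suc j} h = cong suc (lookup-injective uq h)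

⟨$⟩ʳ-injective : ∀ {p} (w : Permutation′ p) {i j} → w ⟨$⟩ʳ i ≡ w ⟨$⟩ʳ j → i ≡ j
⟨$⟩ʳ-injective w h = sym (inverseˡ w) ∙ cong (w ⟨$⟩ˡ_) h ∙ inverseˡ w

module Backward {p : ℕ} (H : Graph p) (w : Permutation′ p) where

  backward : Fin p → Subset p
  backward i = N H (w ⟨$⟩ʳ i) ∩ ⋃[< i ] (λ j → ⁅ w ⟨$⟩ʳ j ⁆)

  -- Positions on the path rather than vertices of H, because the layers are numbered by position.
  backList : Fin p → List (Fin p)
  backList i = List.map (w ⟨$⟩ˡ_) (elements (backward i))

  backList-length : ∀ i → length (backList i) ≡ ∣ backward i ∣
  backList-length i = List.length-map (w ⟨$⟩ˡ_) (elements (backward i)) ∙ length-elements (backward i)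

  backList-unique : ∀ i → Unique (backList i)
  backList-unique i = Unique.map⁺ (λ h → sym (inverseʳ w) ∙ cong (w ⟨$⟩ʳ_) h ∙ inverseʳ w) (elements-unique (backward i))

  backList-sound : ∀ i {j} → j ∈ₗ backList i → Adj H (w ⟨$⟩ʳ i) (w ⟨$⟩ʳ j) × toℕ j < toℕ i
  backList-sound i m with v , k , refl ← ∈ₗ.∈-map⁻ _ m
    with v∈N , v∈⋃ ← Subset.x∈p∩q⁻ (N H (w ⟨$⟩ʳ i)) _ (∈-elements⁻ k)
    with j , j<i , v∈ ← ∈-⋃[<]⁻ (λ j → ⁅ w ⟨$⟩ʳ j ⁆) i v∈⋃
    with refl ← Subset.x∈⁅y⁆⇒x≡y (w ⟨$⟩ʳ j) v∈ =
    subst (Adj H (w ⟨$⟩ʳ i)) (sym (inverseʳ w)) (∈-N⁻ H v∈N) , subst (λ k → toℕ k < toℕ i) (sym (inverseˡ w)) j<i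

  backList-complete : ∀ i {j} → Adj H (w ⟨$⟩ʳ i) (w ⟨$⟩ʳ j) → toℕ j < toℕ i → j ∈ₗ backList i
  backList-complete i {j} a j<i = subst (_∈ₗ backList i) (inverseˡ w) (∈ₗ.∈-map⁺ _ (∈-elements⁺
    (Subset.x∈p∩q⁺ (∈-N⁺ H a , ∈-⋃[<]⁺ {S = λ j → ⁅ w ⟨$⟩ʳ j ⁆} j<i (Subset.x∈⁅x⁆ (w ⟨$⟩ʳ j))))))

layered : ∀ {ℓ p k} (K : Graph ℓ) → 3 ≤ ℓ → (kind : IsOddCycle K ⊎ IsComplete K) →
          (H : Graph (suc (suc p))) (w : Permutation′ (suc (suc p))) → IsHamiltonPath H w →
          (∀ i → ∣ Backward.backward H w i ∣ ≤ k) →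
          ∃ λ es → EdgeList (λ (u , i) (v , j) → (u ≡ v × Adj H (w ⟨$⟩ʳ i) (w ⟨$⟩ʳ j)) ⊎ (i ≡ j × Adj K u v)) es ×
          ∃ λ f → coef es f ≢ 0ℤ × (∀ u → f u ≤ᶻ + (slack K kind + k))
layered {p = p} {k} K 3≤ℓ kind H w ham back≤k =
  Product.map₂ (Product.map₂ (Product.map₂ λ ((_ , f≤) , nz) → nz , f≤)) (L.result (some-nonConstant 3≤ℓ))
  where
  open Backward H w
  -- The path makes the preceding position an earlier neighbour. It is separated from the others
  -- since its layer carries the leading part of the form.
  pred∈ : ∀ i → Fin.inject₁ i ∈ₗ backList (suc i)
  pred∈ i = backList-complete (suc i)
    (symm H (ham (Fin.inject₁ i) (suc i) (cong suc (sym (Fin.toℕ-inject₁ i)))))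
    (s≤s (ℕ.≤-reflexive (Fin.toℕ-inject₁ i)))
  front rear back : Fin (suc p) → List (Fin (suc (suc p)))
  front i = proj₁ (∈-∃++ (pred∈ i))
  rear i = proj₁ (proj₂ (∈-∃++ (pred∈ i)))
  back i = front i ++ rear i
  perm : ∀ i → backList (suc i) ↭ Fin.inject₁ i ∷ back i
  perm i = subst (_↭ Fin.inject₁ i ∷ back i) (sym (proj₂ (proj₂ (∈-∃++ (pred∈ i))))) (shift (Fin.inject₁ i) (front i) (rear i))
  unique : ∀ i → Unique (Fin.inject₁ i ∷ back i)
  unique i = AllPairs-resp-↭ (λ p q → p (sym q)) (perm i) (backList-unique (suc i))
  sound′ : ∀ i {j} → j ∈ₗ Fin.inject₁ i ∷ back i → Adj H (w ⟨$⟩ʳ suc i) (w ⟨$⟩ʳ j) × toℕ j ≤ toℕ i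
  sound′ i m with a , s≤s le ← backList-sound (suc i) (∈-resp-↭ (↭-sym (perm i)) m) = a , le
  complete′ : ∀ i {j} → Adj H (w ⟨$⟩ʳ suc i) (w ⟨$⟩ʳ j) → toℕ j ≤ toℕ i → j ∈ₗ Fin.inject₁ i ∷ back i
  complete′ i a le = ∈-resp-↭ (perm i) (backList-complete (suc i) a (s≤s le))
  back-length : ∀ i → suc (length (back i)) ≤ k
  back-length i = subst (_≤ k) (sym (backList-length (suc i)) ∙ Perm.↭-length (perm i)) (back≤k (suc i))
  module L = Layers {R′ = Adj K} (symm K) {Q = λ i j → Adj H (w ⟨$⟩ʳ i) (w ⟨$⟩ʳ j)} (symm H) (irrefl H refl)
    back unique sound′ complete′ {k} back-length {slack K kind} {graphEdges K} (edgeList-graphEdges K)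
    (robust-kind K 3≤ℓ kind (edgeList-graphEdges K))

AT-weaken : ∀ {n} (G : Graph n) {a b} → AT G ≤ a → a ≤ b → AT G ≤ b
AT-weaken G (k , h , k≤a) a≤b = k , h , ℕ.≤-trans k≤a a≤b

-- A partitioned graph and its product with a path-ordered graph

module Partitioned {n m : ℕ} (G : Graph n) (S : Fin (suc m) → Subset n) (partition : IsPartition S)
                   (3≤∣S∣ : ∀ i → 3 ≤ ∣ S i ∣) (kind : ∀ i → IsOddCycle (G [ S i ]) ⊎ IsComplete (G [ S i ]))
                   (ρ : Fin (suc m) → ℕ)
                   (ρ-bound : ∀ i v → v ∈ S (suc i) → ∣ N G v ∩ ⋃[< suc i ] S ∣ ≤ ρ (suc i))
                   where

  part : Fin n → Fin (suc m)
  part v = proj₁ (partition v)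

  part-∈ : ∀ v → v ∈ S (part v)
  part-∈ v = proj₁ (proj₂ (partition v))

  part-unique : ∀ {v i} → v ∈ S i → part v ≡ i
  part-unique {v} v∈ = proj₂ (proj₂ (partition v)) v∈

  ℓ : Fin (suc m) → ℕ
  ℓ i = length (elements (S i))

  3≤ℓ : ∀ i → 3 ≤ ℓ i
  3≤ℓ i = subst (3 ≤_) (sym (length-elements (S i))) (3≤∣S∣ i)

  vertex : ∀ i → Fin (ℓ i) → Fin n
  vertex i = List.lookup (elements (S i))

  vertex-injective : ∀ i {u u′} → vertex i u ≡ vertex i u′ → u ≡ u′
  vertex-injective i = lookup-injective (elements-unique (S i))

  vertex-∈ : ∀ i u → vertex i u ∈ S i
  vertex-∈ i u = ∈-elements⁻ (∈ₗ.∈-lookup u)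

  part-vertex : ∀ i u → part (vertex i u) ≡ i
  part-vertex i u = part-unique (vertex-∈ i u)

  vertex-onto : ∀ v → ∃ λ u → vertex (part v) u ≡ v
  vertex-onto v = Any.index found , sym (Any.lookup-index found)
    where
    found : v ∈ₗ elements (S (part v))
    found = ∈-elements⁺ (part-∈ v)

  lower : Fin (suc m) → Fin n → List (Fin n)
  lower i v = elements (N G v ∩ ⋃[< i ] S)

  lower-sound : ∀ i v {y} → y ∈ₗ lower i v → Adj G v y × toℕ (part y) < toℕ i
  lower-sound i v m with y∈N , y∈⋃ ← Subset.x∈p∩q⁻ (N G v) _ (∈-elements⁻ m)
    with j , j<i , y∈ ← ∈-⋃[<]⁻ S i y∈⋃ = ∈-N⁻ G y∈N , subst (λ k → toℕ k < toℕ i) (sym (part-unique y∈)) j<i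

  lower-complete : ∀ i v {y} → Adj G v y → toℕ (part y) < toℕ i → y ∈ₗ lower i v
  lower-complete i v {y} a lt = ∈-elements⁺ (Subset.x∈p∩q⁺ (∈-N⁺ G a , ∈-⋃[<]⁺ {S = S} lt (part-∈ y)))

  lower-length : ∀ i v → v ∈ S i → length (lower i v) ≤ ρ i
  lower-length zero v v∈ with lower zero v | lower-sound zero v
  ... | []    | _  = z≤n
  ... | _ ∷ _ | h with () ← proj₂ (h (here refl))
  lower-length (suc i) v v∈ = subst (_≤ ρ (suc i)) (sym (length-elements (N G v ∩ ⋃[< suc i ] S))) (ρ-bound i v v∈)

  d : Fin (suc m) → ℕ
  d i = slack (G [ S i ]) (kind i)

  α-slack : ∀ i → α G S ρ kind i ≡ ρ i + (2 + d i)
  α-slack i with kind i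
  ... | inj₁ _ = refl
  ... | inj₂ _ = cong (λ x → ρ i + x) (sym (length-elements (S i)) ∙ sym (ℕ.m+[n∸m]≡n (ℕ.≤-trans (ℕ.n≤1+n 2) (3≤ℓ i))))

  M : ℕ
  M = maximum (α G S ρ kind)

  α≤M : ∀ i → ρ i + (2 + d i) ≤ M
  α≤M i = subst (_≤ M) (α-slack i) (maximum-upper (α G S ρ kind) i)

  slack≤M : ∀ i → d i + ρ i ≤ M ∸ 2
  slack≤M i = ℕ.m+n≤o⇒m≤o∸n (d i + ρ i) (subst (_≤ M) (rearrange (ρ i) (d i)) (α≤M i))
    where
    rearrange : ∀ r d → r + (2 + d) ≡ d + r + 2
    rearrange r d = ℕ.+-comm r (2 + d) ∙ ℕ.+-comm 2 (d + r)

  -- Makes the truncated subtraction in `M ∸ 2` exact, so that adding 2 recovers `M`.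
  2≤M : 2 ≤ M
  2≤M = ℕ.≤-trans (ℕ.≤-trans (ℕ.m≤m+n 2 (d zero)) (ℕ.m≤n+m (2 + d zero) (ρ zero))) (α≤M zero)

  private
    -- A single copy of the part has no other layer to receive an edge, so it keeps the unit at `v`.
    -- Its exponents reach d + 1, and with ρ added they stay within `suc (M ∸ 2)`.
    part-coef : ∀ i → ∃ λ es → EdgeList (Adj (G [ S i ])) es × ∃ λ f →
                coef es f ≢ 0ℤ × (∀ u → f u +ᶻ + length (lower i (vertex i u)) ≤ᶻ + suc (M ∸ 2))
    part-coef i = graphEdges K , edgeList-graphEdges K , raise (robust⇒coef {es = graphEdges K}
        (robust-kind K (3≤ℓ i) (kind i) (edgeList-graphEdges K)) (some-nonConstant (3≤ℓ i)))
      where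
      K = G [ S i ]
      raise : (∃ λ f → (∀ u → 0ℤ ≤ᶻ f u) × (∀ u → f u ≤ᶻ + d i) × ∃ λ v → coef (graphEdges K) (f ⊕ v) ≢ 0ℤ) →
              ∃ λ f → coef (graphEdges K) f ≢ 0ℤ × (∀ u → f u +ᶻ + length (lower i (vertex i u)) ≤ᶻ + suc (M ∸ 2))
      raise (f , _ , f≤d , v , nz) = f ⊕ v , nz , λ u →
        ℤ.≤-trans (ℤ.+-mono-≤ (ℤ.+-mono-≤ (f≤d u) (e≤1 v u)) (ℤ.+≤+ (lower-length i (vertex i u) (vertex-∈ i u))))
          (ℤ.+≤+ (subst (_≤ suc (M ∸ 2)) (cong (_+ ρ i) (ℕ.+-comm 1 (d i))) (s≤s (slack≤M i))))

    module PG = Parts {R = Adj G} (symm G) part {U = λ i → Fin (ℓ i)} {{indexFin}} {R′ = λ i → Adj (G [ S i ])}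
      vertex vertex-injective part-vertex vertex-onto (λ i r → r) (λ i r → r)
      (λ i u → lower i (vertex i u)) (λ i u → elements-unique (N G (vertex i u) ∩ ⋃[< i ] S))
      (λ i u → lower-sound i (vertex i u)) (λ i u → lower-complete i (vertex i u))
      {suc (M ∸ 2)} part-coef

  coefs⇒AT : ∀ {n} (Γ : Graph n) {b} → (∃ λ fs → EdgeList (Adj Γ) fs × ∃ λ c → coef fs c ≢ 0ℤ × (∀ v → c v ≤ᶻ + b)) →
             AT Γ ≤ suc b
  coefs⇒AT Γ (fs , F , c , nz , c≤b) = coef⇒AT Γ F nz c≤b

  AT-G : AT G ≤ M
  AT-G = AT-weaken G (coefs⇒AT G PG.result) (ℕ.≤-reflexive (ℕ.m+[n∸m]≡n 2≤M))

  module _ {p k : ℕ} (H : Graph (suc (suc p))) (w : Permutation′ (suc (suc p))) (ham : IsHamiltonPath H w)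
           (back≤k : ∀ i → ∣ Backward.backward H w i ∣ ≤ k) where

    private
      h : ℕ
      h = suc (suc p)

      Box : Fin n × Fin h → Fin n × Fin h → Set
      Box X Y = (proj₁ X ≡ proj₁ Y × Adj H (proj₂ X) (proj₂ Y)) ⊎ (proj₂ X ≡ proj₂ Y × Adj G (proj₁ X) (proj₁ Y))

      box⁻ : ∀ {x q y r} → Adj (G □ H) (Fin.combine x q) (Fin.combine y r) → Box (x , q) (y , r)
      box⁻ {x} {q} {y} {r} = subst (λ X → Box X (y , r)) (Fin.remQuot-combine x q)
        ∘ subst (Box (Fin.remQuot h (Fin.combine x q))) (Fin.remQuot-combine y r)

      box⁺ : ∀ {x q y r} → Box (x , q) (y , r) → Adj (G □ H) (Fin.combine x q) (Fin.combine y r)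
      box⁺ {x} {q} {y} {r} = subst (Box (Fin.remQuot h (Fin.combine x q))) (sym (Fin.remQuot-combine y r))
        ∘ subst (λ X → Box X (y , r)) (sym (Fin.remQuot-combine x q))

      part□ : Fin (n ℕ.* h) → Fin (suc m)
      part□ x = part (proj₁ (Fin.remQuot h x))

      part□-combine : ∀ v (q : Fin h) → part□ (Fin.combine v q) ≡ part v
      part□-combine v q = cong (part ∘ proj₁) (Fin.remQuot-combine v q)

      -- The second coordinate of the block is a position on the Hamilton path, which `w` turns into
      -- a vertex; this matches the indexing in `layered`.
      φ : ∀ i → Fin (ℓ i) × Fin h → Fin (n ℕ.* h)
      φ i (u , q) = Fin.combine (vertex i u) (w ⟨$⟩ʳ q)

      φ-injective : ∀ i {u u′} → φ i u ≡ φ i u′ → u ≡ u′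
      φ-injective i {u , q} {v , r} eq with p , q ← Fin.combine-injective (vertex i u) (w ⟨$⟩ʳ q) (vertex i v) (w ⟨$⟩ʳ r) eq =
        cong₂ _,_ (vertex-injective i p) (⟨$⟩ʳ-injective w q)

      part□-φ : ∀ i u → part□ (φ i u) ≡ i
      part□-φ i (u , q) = part□-combine (vertex i u) (w ⟨$⟩ʳ q) ∙ part-vertex i u

      φ-onto : ∀ x → ∃ λ u → φ (part□ x) u ≡ x
      φ-onto x = (proj₁ onto , w ⟨$⟩ˡ proj₂ (Fin.remQuot {n} h x)) ,
        (cong₂ Fin.combine (proj₂ onto) (inverseʳ w) ∙ Fin.combine-remQuot {n} h x)
        where onto = vertex-onto (proj₁ (Fin.remQuot {n} h x))

      R′ : ∀ i → Fin (ℓ i) × Fin h → Fin (ℓ i) × Fin h → Set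
      R′ i (u , q) (v , r) = (u ≡ v × Adj H (w ⟨$⟩ʳ q) (w ⟨$⟩ʳ r)) ⊎ (q ≡ r × Adj (G [ S i ]) u v)

      -- Edges along H stay inside a part, so earlier parts are reached by edges of G only. The copy
      -- of H therefore adds nothing to the bound ρ.
      lower□ : ∀ i → Fin (ℓ i) × Fin h → List (Fin (n ℕ.* h))
      lower□ i (u , q) = List.map (λ y → Fin.combine y (w ⟨$⟩ʳ q)) (lower i (vertex i u))

      lower□-sound : ∀ i u {y} → y ∈ₗ lower□ i u → Adj (G □ H) (φ i u) y × toℕ (part□ y) < toℕ i
      lower□-sound i (u , q) m with y , k , refl ← ∈ₗ.∈-map⁻ _ m with a , lt ← lower-sound i (vertex i u) k =
        box⁺ {vertex i u} {w ⟨$⟩ʳ q} {y} {w ⟨$⟩ʳ q} (inj₂ (refl , a)) , subst (λ j → toℕ j < toℕ i) (sym (part□-combine y (w ⟨$⟩ʳ q))) lt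

      lower□-complete : ∀ i u {y} → Adj (G □ H) (φ i u) y → toℕ (part□ y) < toℕ i → y ∈ₗ lower□ i u
      lower□-complete i (u , q) {y} a lt = subst (_∈ₗ lower□ i (u , q)) (Fin.combine-remQuot {n} h y)
        (member (Fin.remQuot h y) (box⁻ (subst (Adj (G □ H) (φ i (u , q))) (sym (Fin.combine-remQuot {n} h y)) a)) lt)
        where
        member : ∀ Y → Box (vertex i u , w ⟨$⟩ʳ q) Y → toℕ (part (proj₁ Y)) < toℕ i →
                 Fin.combine (proj₁ Y) (proj₂ Y) ∈ₗ lower□ i (u , q)
        member (v , r) (inj₁ (refl , _)) lt = contradiction lt (ℕ.<-irrefl (cong toℕ (part-vertex i u)))
        member (v , r) (inj₂ (refl , b)) lt = ∈ₗ.∈-map⁺ _ (lower-complete i (vertex i u) b lt)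

      lower□-unique : ∀ i u → Unique (lower□ i u)
      lower□-unique i (u , q) = Unique.map⁺
        (λ {y} {y′} eq → proj₁ (Fin.combine-injective y (w ⟨$⟩ʳ q) y′ (w ⟨$⟩ʳ q) eq))
        (elements-unique (N G (vertex i u) ∩ ⋃[< i ] S))

      R′⇒R : ∀ i {u u′} → R′ i u u′ → Adj (G □ H) (φ i u) (φ i u′)
      R′⇒R i {u , q} {v , r} (inj₁ (p , a)) =
        box⁺ {vertex i u} {w ⟨$⟩ʳ q} {vertex i v} {w ⟨$⟩ʳ r} (inj₁ (cong (vertex i) p , a))
      R′⇒R i {u , q} {v , r} (inj₂ (p , a)) =
        box⁺ {vertex i u} {w ⟨$⟩ʳ q} {vertex i v} {w ⟨$⟩ʳ r} (inj₂ (cong (w ⟨$⟩ʳ_) p , a))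

      R⇒R′ : ∀ i {u u′} → Adj (G □ H) (φ i u) (φ i u′) → R′ i u u′
      R⇒R′ i {u , q} {v , r} a = Sum.map (Product.map₁ (vertex-injective i)) (Product.map₁ (⟨$⟩ʳ-injective w))
        (box⁻ {vertex i u} {w ⟨$⟩ʳ q} {vertex i v} {w ⟨$⟩ʳ r} a)

      part-coef□ : ∀ i → ∃ λ es → EdgeList (R′ i) es × ∃ λ f →
                  coef es f ≢ 0ℤ × (∀ u → f u +ᶻ + length (lower□ i u) ≤ᶻ + (M ∸ 2 + k))
      part-coef□ i = Product.map₂ (Product.map₂ λ (f , nz , f≤) → f , nz , bound f f≤)
        (layered (G [ S i ]) (3≤ℓ i) (kind i) H w ham back≤k)
        where
        rearrange : ∀ d r k → d + r + k ≡ d + k + r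
        rearrange d r k = ℕ.+-assoc d r k ∙ cong (λ x → d + x) (ℕ.+-comm r k) ∙ sym (ℕ.+-assoc d k r)
        bound : ∀ (f : Exponent (Fin (ℓ i) × Fin h)) → (∀ u → f u ≤ᶻ + (d i + k)) → ∀ u → f u +ᶻ + length (lower□ i u) ≤ᶻ + (M ∸ 2 + k)
        bound f f≤ (u , q) =
          ℤ.≤-trans (ℤ.+-mono-≤ (f≤ (u , q)) (ℤ.+≤+ (subst (_≤ ρ i) (sym (List.length-map (λ y → Fin.combine y (w ⟨$⟩ʳ q)) (lower i (vertex i u))))
                                                       (lower-length i (vertex i u) (vertex-∈ i u)))))
            (ℤ.+≤+ (subst (_≤ M ∸ 2 + k) (rearrange (d i) (ρ i) k) (ℕ.+-monoˡ-≤ k (slack≤M i))))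

      module P□ = Parts {R = Adj (G □ H)} (symm (G □ H)) part□ {U = λ i → Fin (ℓ i) × Fin h} {{index×}} {R′ = R′}
        φ φ-injective part□-φ φ-onto
        R′⇒R R⇒R′ lower□ lower□-unique lower□-sound lower□-complete {M ∸ 2 + k} part-coef□

    -- Exponents up to `M ∸ 2 + k` are indegrees, and the Alon-Tarsi number exceeds the largest
    -- indegree by one.
    AT-□ : AT (G □ H) ≤ M + k ∸ 1
    AT-□ = AT-weaken (G □ H) (coefs⇒AT (G □ H) P□.result)
      (ℕ.≤-reflexive (cong (λ m → m + k ∸ 1) (ℕ.m+[n∸m]≡n 2≤M)))

theorem9 : ∀ {n m} (G : Graph n) (S : Fin (suc m) → Subset n) →
    IsPartition S →
    (∀ i → 3 ≤ ∣ S i ∣) →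
    (kind : ∀ i → IsOddCycle (G [ S i ]) ⊎ IsComplete (G [ S i ])) →
    (ρ : Fin (suc m) → ℕ) →
    ρ zero ≡ 0 →
    (∀ i v → v ∈ S (suc i) → ∣ N G v ∩ ⋃[< suc i ] S ∣ ≤ ρ (suc i)) →
    ∀ {p} (H : Graph p) → 2 ≤ p →
    (w : Permutation′ p) → IsHamiltonPath H w →
    (k : ℕ) →
    (∀ i → ∣ N H (w ⟨$⟩ʳ i) ∩ ⋃[< i ] (λ j → ⁅ w ⟨$⟩ʳ j ⁆) ∣ ≤ k) →
    (AT G ≤ maximum (α G S ρ kind)) ×
    (AT (G □ H) ≤ maximum (α G S ρ kind) + k ∸ 1)
theorem9 G S partition 3≤∣S∣ kind ρ _ ρ-bound H (s≤s (s≤s z≤n)) w ham k back≤k = AT-G , AT-□ H w ham back≤k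
  where open Partitioned G S partition 3≤∣S∣ kind ρ ρ-bound
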